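{- Let $K$ be a field with a henselian topology $\tau$, and let $B\subseteq K$ be a subset. Then the model-theoretic existential algebraic closure of $B$ in $K$ in the language of rings is a subset of the relative (field-theoretic) algebraic closure of $\Lambda_K\mathbb{F}(B)$ in $K$, where $\mathbb{F}$ is the prime subfield of $K$.
   Context: The existential algebraic closure of $B$ in $K$ is the union of all finite subsets of $K$ that are definable in $K$ by an existential formula of the language of rings with parameters from $B$. Let $p$ be the characteristic exponent of $K$ (the characteristic if positive, else $1$). An extension $F/C$ is separable if $F$ is linearly disjoint from $C^{1/p}$ over $C$. For a field extension $F/D$, $\Lambda_F D$ denotes the smallest subfield $E$ with $D\subseteq E\subseteq F$ such that $F/E$ is separable (it exists by a theorem of Deveney and Mordeson). Henselian topology: a V-topology on $K$ (a field topology induced by a nontrivial absolute value or a nontrivial valuation) that is locally equivalent, in the sense of Prestel and Ziegler, to the topology induced by a nontrivial henselian valuation on some field. Equivalently, a V-topology satisfying the Implicit Function Theorem for polynomials: for every $f\in K[X_0,\dots,X_{m-1},Y]$ and $(e,d)\in K^{m}\times K$ with $f(e,d)=0$ and $\frac{\partial f}{\partial Y}(e,d)\neq0$ there are $\tau$-open $U\ni e$, $V\ni d$ such that $\{f=0\}\cap(U\times V)$ is the graph of a continuous function $U\to V$. -}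

module Defs where

open import Algebra.Bundles using (CommutativeRing; Semiring; Ring; AbelianGroup)
open import Algebra.Morphism.Structures using (module RingMorphisms)
import Algebra.Definitions.RawSemiring as RawSemiringDefs
open import Data.Fin.Base using (Fin; zero; suc; toℕ)
open import Data.Fin.Properties using () renaming (_≟_ to _≟ᶠ_)
open import Data.List.Base using (List)
import Data.List.Membership.Setoid as SetoidMembership
open import Data.Nat.Base using (ℕ; zero; suc)
open import Data.Nat.Divisibility using () renaming (_∣_ to _∣ℕ_)
open import Data.Product.Base using (Σ; ∃; _×_; _,_; proj₁)
open import Data.Sum.Base using (_⊎_)
open import Data.Vec.Functional using (Vector; _∷_)
open import Function.Bundles using (_⇔_)
open import Level using (Level; _⊔_) renaming (suc to lsuc)
open import Relation.Binary.Bundles using (Setoid)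
open import Relation.Binary.Core using (Rel)
open import Relation.Binary.Definitions using (_Respects_)
open import Relation.Binary.PropositionalEquality.Core using (_≡_)
open import Relation.Binary.Structures using (IsTotalOrder)
import Relation.Binary.Construct.Add.Supremum.Equality as SupremumEq
import Relation.Binary.Construct.Add.Supremum.NonStrict as SupremumOrder
import Relation.Binary.Construct.NonStrictToStrict as ToStrict
open import Relation.Nullary using (¬_; yes; no)
open import Relation.Nullary.Construct.Add.Supremum using (_⁺; ⊤⁺; [_])
open import Relation.Unary using (Pred; _∈_; _⊆_; _∪_; _∩_; _≐_; ∅; U; ⋃)

-- A field in the classical sense: the library's HeytingField carries an
-- apartness relation as extra structure.

record Field c ℓ : Set (lsuc (c ⊔ ℓ)) where
  field
    commutativeRing : CommutativeRing c ℓ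

  open CommutativeRing commutativeRing public

  field
    0≉1     : ¬ (0# ≈ 1#)
    inverse : ∀ x → ¬ (x ≈ 0#) → ∃ λ y → x * y ≈ 1#

record OrderedAbelianGroup (s : Level) : Set (lsuc s) where
  field
    abelianGroup : AbelianGroup s s

  open AbelianGroup abelianGroup public

  field
    _≤_          : Rel Carrier s
    isTotalOrder : IsTotalOrder _≈_ _≤_
    ∙-monoʳ-≤    : ∀ z {x y} → x ≤ y → (z ∙ x) ≤ (z ∙ y)

  open SupremumEq _≈_ public using (_≈⁺_)
  open SupremumOrder _≤_ public using (_≤⁺_)

  _∙⁺_ : Carrier ⁺ → Carrier ⁺ → Carrier ⁺
  ⊤⁺    ∙⁺ _     = ⊤⁺
  [ _ ] ∙⁺ ⊤⁺    = ⊤⁺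
  [ x ] ∙⁺ [ y ] = [ x ∙ y ]

-- A Dedekind complete ordered field, that is, a copy of ℝ.

record RealField (s : Level) : Set (lsuc s) where
  field
    field′ : Field s s

  open Field field′ public

  field
    _≤_          : Rel Carrier s
    isTotalOrder : IsTotalOrder _≈_ _≤_
    +-monoʳ-≤    : ∀ z {x y} → x ≤ y → (z + x) ≤ (z + y)
    *-nonNeg     : ∀ {x y} → 0# ≤ x → 0# ≤ y → 0# ≤ (x * y)

  open ToStrict _≈_ _≤_ public using (_<_)

  UpperBound : Pred Carrier s → Pred Carrier s
  UpperBound S u = ∀ x → x ∈ S → x ≤ u

  field
    complete : (S : Pred Carrier s) → ∃ S → ∃ (UpperBound S) →
               ∃ λ u → UpperBound S u × (∀ w → UpperBound S w → u ≤ w)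

record Topology {c ℓ} (S : Setoid c ℓ) : Set (lsuc (c ⊔ ℓ)) where
  open Setoid S

  Subset : Set (lsuc (c ⊔ ℓ))
  Subset = Pred Carrier (c ⊔ ℓ)

  field
    Open      : Pred Subset (c ⊔ ℓ)
    open-resp : ∀ {U} → Open U → U Respects _≈_
    open-≐    : ∀ {U V} → U ≐ V → Open U → Open V
    open-all  : ∀ {U} → (∀ x → x ∈ U) → Open U
    open-∩    : ∀ {U V} → Open U → Open V → Open (U ∩ V)
    open-⋃    : {I : Set (c ⊔ ℓ)} (F : I → Subset) →
                (∀ i → Open (F i)) → Open (⋃ I F)

  -- Openness of subsets of the m-th power in the product topology.
  Openᵐ : ∀ {m} → Pred (Pred (Vector Carrier m) (c ⊔ ℓ)) (lsuc (c ⊔ ℓ))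
  Openᵐ {m} W = ∀ e → e ∈ W →
    Σ (Fin m → Subset) λ N →
      (∀ i → Open (N i) × e i ∈ N i) ×
      (∀ x → (∀ i → x i ∈ N i) → x ∈ W)

-- Terms of the language of rings, with parameters from P and n variables.

infixl 6 _:+_
infixl 7 _:*_
infix  4 _:≈_

data Term {a} (P : Set a) (n : ℕ) : Set a where
  :0 :1     : Term P n
  par       : P → Term P n
  var       : Fin n → Term P n
  _:+_ _:*_ : Term P n → Term P n → Term P n
  :-_       : Term P n → Term P n

data QuantifierFree {a} (P : Set a) (n : ℕ) : Set a where
  _:≈_      : Term P n → Term P n → QuantifierFree P n
  :¬_       : QuantifierFree P n → QuantifierFree P n
  _:∧_ _:∨_ : QuantifierFree P n → QuantifierFree P n → QuantifierFree P n

-- Existential formulas in one free variable, which is variable 0; the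
-- other variables are existentially quantified.

record Existential {a} (P : Set a) : Set a where
  constructor :∃
  field
    {quantified} : ℕ
    matrix       : QuantifierFree P (suc quantified)

-- A polynomial over A in n variables is given by a term with parameters
-- from A. Different terms may stand for the same polynomial, but they then
-- have the same values, and their derivatives stand for the same polynomial.

Polynomial : ∀ {a} → Set a → ℕ → Set a
Polynomial = Term

∂ : ∀ {a} {A : Set a} {n} → Fin n → Polynomial A n → Polynomial A n
∂ i :0       = :0
∂ i :1       = :0
∂ i (par a)  = :0
∂ i (var j) with i ≟ᶠ j
... | yes _  = :1
... | no  _  = :0
∂ i (f :+ g) = ∂ i f :+ ∂ i g
∂ i (f :* g) = ∂ i f :* g :+ f :* ∂ i g
∂ i (:- f)   = :- ∂ i f

module _ {c ℓ} (K : Field c ℓ) where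
  open Field K
  open RawSemiringDefs (Semiring.rawSemiring semiring) using (sum; _^_) renaming (_×_ to _·_)
  open SetoidMembership setoid using () renaming (_∈_ to _∈ₗ_)

  private
    s : Level
    s = c ⊔ ℓ

    Subset : Set (lsuc s)
    Subset = Pred Carrier s

  module _ {a} {P : Set a} (⟦_⟧ₚ : P → Carrier) where

    evalTerm : ∀ {n} → Term P n → Vector Carrier n → Carrier
    evalTerm :0       ρ = 0#
    evalTerm :1       ρ = 1#
    evalTerm (par p)  ρ = ⟦ p ⟧ₚ
    evalTerm (var i)  ρ = ρ i
    evalTerm (t :+ u) ρ = evalTerm t ρ + evalTerm u ρ
    evalTerm (t :* u) ρ = evalTerm t ρ * evalTerm u ρ
    evalTerm (:- t)   ρ = - evalTerm t ρ

    Holds : ∀ {n} → QuantifierFree P n → Vector Carrier n → Set ℓ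
    Holds (t :≈ u) ρ = evalTerm t ρ ≈ evalTerm u ρ
    Holds (:¬ φ)   ρ = ¬ Holds φ ρ
    Holds (φ :∧ ψ) ρ = Holds φ ρ × Holds ψ ρ
    Holds (φ :∨ ψ) ρ = Holds φ ρ ⊎ Holds ψ ρ

    Defines : Existential P → Pred Carrier s
    Defines (:∃ {k} φ) x = Σ (Vector Carrier k) λ ys → Holds φ (x ∷ ys)

  evalPoly : ∀ {n} → Polynomial Carrier n → Vector Carrier n → Carrier
  evalPoly = evalTerm (λ a → a)

  Finite : Subset → Set s
  Finite S = Σ (List Carrier) λ xs → ∀ x → (x ∈ S) ⇔ (x ∈ₗ xs)

  ExistentialClosure : Subset → Subset
  ExistentialClosure B x =
    Σ (Existential (∃ B)) λ φ → Finite (Defines proj₁ φ) × x ∈ Defines proj₁ φ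

  record IsSubfield (E : Subset) : Set s where
    field
      resp       : E Respects _≈_
      0-closed   : 0# ∈ E
      1-closed   : 1# ∈ E
      +-closed   : ∀ {x y} → x ∈ E → y ∈ E → x + y ∈ E
      *-closed   : ∀ {x y} → x ∈ E → y ∈ E → x * y ∈ E
      neg-closed : ∀ {x} → x ∈ E → - x ∈ E
      inv-closed : ∀ {x y} → x ∈ E → x * y ≈ 1# → y ∈ E

  data ⟨_⟩ {a} (S : Pred Carrier a) : Pred Carrier (s ⊔ a) where
    gen  : ∀ {x} → x ∈ S → x ∈ ⟨ S ⟩
    resp : ∀ {x y} → x ≈ y → x ∈ ⟨ S ⟩ → y ∈ ⟨ S ⟩
    zer  : 0# ∈ ⟨ S ⟩
    one  : 1# ∈ ⟨ S ⟩
    add  : ∀ {x y} → x ∈ ⟨ S ⟩ → y ∈ ⟨ S ⟩ → x + y ∈ ⟨ S ⟩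
    mul  : ∀ {x y} → x ∈ ⟨ S ⟩ → y ∈ ⟨ S ⟩ → x * y ∈ ⟨ S ⟩
    neg  : ∀ {x} → x ∈ ⟨ S ⟩ → - x ∈ ⟨ S ⟩
    inv  : ∀ {x y} → x ∈ ⟨ S ⟩ → x * y ≈ 1# → y ∈ ⟨ S ⟩

  PrimeField : Subset
  PrimeField = ⟨ ∅ ⟩

  PrimeField⟨_⟩ : Subset → Subset
  PrimeField⟨ B ⟩ = ⟨ PrimeField ∪ B ⟩

  RelativeAlgebraicClosure : Subset → Subset
  RelativeAlgebraicClosure E x =
    Σ ℕ λ n → Σ (Vector Carrier n) λ a →
      (∀ i → a i ∈ E) ×
      (∃ λ i → ¬ (a i ≈ 0#)) ×
      sum (λ i → a i * x ^ toℕ i) ≈ 0#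

  HasCharacteristic : ℕ → Set ℓ
  HasCharacteristic q = ∀ n → ((n · 1#) ≈ 0#) ⇔ (q ∣ℕ n)

  HasCharacteristicExponent : ℕ → Set ℓ
  HasCharacteristicExponent p =
    (HasCharacteristic 0 × p ≡ 1) ⊎
    (∃ λ q → HasCharacteristic (suc q) × p ≡ suc q)

  LinearlyIndependent : Subset → ∀ {n} → Vector Carrier n → Set s
  LinearlyIndependent C {n} x =
    (a : Vector Carrier n) → (∀ i → a i ∈ C) →
    sum (λ i → a i * x i) ≈ 0# → ∀ i → a i ≈ 0#

  -- L and M are linearly disjoint over their common subfield C.
  LinearlyDisjoint : Subset → Subset → Subset → Set s
  LinearlyDisjoint L M C =
    ∀ {n} (x : Vector Carrier n) → (∀ i → x i ∈ L) →
    LinearlyIndependent C x → LinearlyIndependent M x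

record Overfield {c ℓ} (F : Field c ℓ) : Set (lsuc (c ⊔ ℓ)) where
  field
    Ω : Field c ℓ

  private
    module F = Field F
    module Ω = Field Ω

  open RingMorphisms (Ring.rawRing F.ring) (Ring.rawRing Ω.ring) using (IsRingMonomorphism)
  open RawSemiringDefs (Semiring.rawSemiring Ω.semiring) using (_^_)

  field
    ι                  : F.Carrier → Ω.Carrier
    isRingMonomorphism : IsRingMonomorphism ι

  Image : ∀ {a} → Pred F.Carrier a → Pred Ω.Carrier (c ⊔ ℓ ⊔ a)
  Image S z = ∃ λ x → x ∈ S × z Ω.≈ ι x

  Roots : ℕ → Pred F.Carrier (c ⊔ ℓ) → Pred Ω.Carrier (c ⊔ ℓ)
  Roots p C z = z ^ p ∈ Image C

  HasRoots : ℕ → Pred F.Carrier (c ⊔ ℓ) → Set (c ⊔ ℓ)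
  HasRoots p C = ∀ x → x ∈ C → ∃ λ z → (z ^ p) Ω.≈ ι x

module _ {c ℓ} (F : Field c ℓ) where
  open Field F using (Carrier)

  -- F is linearly disjoint from C^{1/p} over C. Whether this holds does
  -- not depend on the overfield of F in which C^{1/p} is formed, so the
  -- choice of an algebraic closure is replaced by a quantification over all
  -- overfields that contain C^{1/p}.
  IsSeparableOver : ℕ → Pred Carrier (c ⊔ ℓ) → Set (lsuc (c ⊔ ℓ))
  IsSeparableOver p C =
    (O : Overfield F) → let open Overfield O in
    HasRoots p C → LinearlyDisjoint Ω (Image U) (Roots p C) (Image C)

  -- E = Λ_F D, where p is the characteristic exponent of F.
  record IsΛ (p : ℕ) (D E : Pred Carrier (c ⊔ ℓ)) : Set (lsuc (c ⊔ ℓ)) where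
    field
      isSubfield : IsSubfield F E
      contains   : D ⊆ E
      separable  : IsSeparableOver p E
      smallest   : ∀ E′ → IsSubfield F E′ → D ⊆ E′ → IsSeparableOver p E′ →
                   E ⊆ E′

module _ {c ℓ} (K : Field c ℓ) where
  open Field K

  private
    s : Level
    s = c ⊔ ℓ

  record NontrivialAbsoluteValue : Set (lsuc s) where
    field
      ℝ : RealField s

    private
      module ℝ = RealField ℝ

    field
      ∣_∣        : Carrier → ℝ.Carrier
      cong       : ∀ {x y} → x ≈ y → ∣ x ∣ ℝ.≈ ∣ y ∣
      nonNeg     : ∀ x → ℝ.0# ℝ.≤ ∣ x ∣
      definite   : ∀ x → (∣ x ∣ ℝ.≈ ℝ.0#) ⇔ (x ≈ 0#)
      homo-*     : ∀ x y → ∣ x * y ∣ ℝ.≈ (∣ x ∣ ℝ.* ∣ y ∣)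
      triangle   : ∀ x y → ∣ x + y ∣ ℝ.≤ (∣ x ∣ ℝ.+ ∣ y ∣)
      nontrivial : ∃ λ x → ¬ (x ≈ 0#) × ¬ (∣ x ∣ ℝ.≈ ℝ.1#)

    IsOpen : Pred (Pred Carrier s) s
    IsOpen U = ∀ x → x ∈ U →
      ∃ λ ε → ℝ.0# ℝ.< ε × (∀ y → ∣ y - x ∣ ℝ.< ε → y ∈ U)

  -- The value group Γ is v(K^×): for a larger group the balls below might
  -- give a finer topology.
  record NontrivialValuation : Set (lsuc s) where
    field
      Γ : OrderedAbelianGroup s

    private
      module Γ = OrderedAbelianGroup Γ

    field
      v           : Carrier → Γ.Carrier ⁺
      cong        : ∀ {x y} → x ≈ y → v x Γ.≈⁺ v y
      definite    : ∀ x → (v x Γ.≈⁺ ⊤⁺) ⇔ (x ≈ 0#)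
      homo-*      : ∀ x y → v (x * y) Γ.≈⁺ (v x Γ.∙⁺ v y)
      ultrametric : ∀ {γ} x y → γ Γ.≤⁺ v x → γ Γ.≤⁺ v y → γ Γ.≤⁺ v (x + y)
      surjective  : ∀ γ → ∃ λ x → v x Γ.≈⁺ [ γ ]
      nontrivial  : ∃ λ x → ¬ (x ≈ 0#) × ¬ (v x Γ.≈⁺ [ Γ.ε ])

    IsOpen : Pred (Pred Carrier s) s
    IsOpen U = ∀ x → x ∈ U →
      ∃ λ γ → ∀ y → [ γ ] Γ.≤⁺ v (y - x) → y ∈ U

module _ {c ℓ} (K : Field c ℓ) (τ : Topology (Field.setoid K)) where
  open Field K using (Carrier; _≈_; 0#)
  open Topology τ

  -- A topology induced by an absolute value or a valuation is a field
  -- topology, so this is not required separately.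
  IsVTopology : Set (lsuc (c ⊔ ℓ))
  IsVTopology =
    (Σ (NontrivialAbsoluteValue K) λ a →
       ∀ U → Open U ⇔ NontrivialAbsoluteValue.IsOpen a U) ⊎
    (Σ (NontrivialValuation K) λ v →
       ∀ U → Open U ⇔ NontrivialValuation.IsOpen v U)

  -- {f = 0} ∩ (U × V) is the graph of a continuous function g : U → V.
  -- In a vector y ∷ x, the variable Y of f comes first.
  record IsImplicitFunction {m} (f : Polynomial Carrier (suc m))
                            (U : Pred (Vector Carrier m) (c ⊔ ℓ))
                            (V : Pred Carrier (c ⊔ ℓ))
                            (g : ∀ x → x ∈ U → Carrier) :
                            Set (lsuc (c ⊔ ℓ)) where
    field
      into       : ∀ x (x∈U : x ∈ U) → g x x∈U ∈ V
      graph      : ∀ x (x∈U : x ∈ U) y →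
                   (y ∈ V × evalPoly K f (y ∷ x) ≈ 0#) ⇔ (y ≈ g x x∈U)
      continuous : ∀ W → Open W → Openᵐ (λ x → Σ (x ∈ U) λ x∈U → g x x∈U ∈ W)

  ImplicitFunctionTheorem : Set (lsuc (c ⊔ ℓ))
  ImplicitFunctionTheorem =
    ∀ {m} (f : Polynomial Carrier (suc m)) (e : Vector Carrier m) (d : Carrier) →
    evalPoly K f (d ∷ e) ≈ 0# →
    ¬ (evalPoly K (∂ zero f) (d ∷ e) ≈ 0#) →
    ∃ λ U → ∃ λ V →
      Openᵐ U × Open V × e ∈ U × d ∈ V ×
      Σ (∀ x → x ∈ U → Carrier) (IsImplicitFunction f U V)

  record IsHenselian : Set (lsuc (c ⊔ ℓ)) where
    field
      isVTopology             : IsVTopology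
      implicitFunctionTheorem : ImplicitFunctionTheorem

{-# OPTIONS --safe #-}

-- Let z be the tuple formed by an element x of the finite set defined by the formula and by
-- witnesses for the quantifiers. If the coordinates of z are algebraically dependent over Λ,
-- then a relation f(z) = 0 of least degree has some ∂f/∂zᵢ(z) ≠ 0, because K/Λ is separable
-- (MacLane's criterion, applied to the Frobenius embedding of K in itself). So zᵢ is a simple
-- root of its minimal polynomial over the other coordinates. Removing such coordinates one by
-- one leaves an algebraically independent tuple t, and the Implicit Function Theorem, applied
-- to the minimal polynomials in reverse order, extends every t′ near t to a point z′ near z
-- that satisfies all the equations over Λ that z satisfies. Inequations persist near z, so z′
-- satisfies the formula, and its first coordinate lies in a finite set and is near x, hence
-- equals x. Now x satisfies an equation P(x, t) = 0 over Λ with P(Y, t) ≠ 0. Then P(x, t′) = 0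
-- for all t′ near t, so P(x, T) = 0, which makes x algebraic over Λ.
module Submission where

open import Algebra.Bundles using (CommutativeRing)
import Algebra.Properties.AbelianGroup
import Algebra.Properties.CommutativeSemiring.Binomial
import Algebra.Properties.CommutativeSemiring.Exp
import Algebra.Properties.Ring
import Algebra.Properties.Semiring.Exp
import Algebra.Properties.Semiring.Mult.TCOptimised
import Algebra.Properties.Semiring.Sum
import Algebra.Solver.Ring
open import Algebra.Solver.Ring.AlmostCommutativeRing using (fromCommutativeRing; _-Raw-AlmostCommutative⟶_)
open import Axiom.ExcludedMiddle using (ExcludedMiddle)
open import Data.Fin.Base using (Fin; zero; suc; toℕ; fromℕ; inject₁; punchIn; punchOut; _↑ˡ_; _↑ʳ_)
open import Data.Fin.Properties using (punchIn-punchOut; toℕ-fromℕ; toℕ-inject₁; toℕ<n) renaming (_≟_ to _≟ᶠ_)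
import Data.Integer.Base as ℤ
import Data.Integer.Properties as ℤ
open import Data.List.Base as List using (List; []; _∷_)
open import Data.List.Membership.Propositional using () renaming (_∈_ to _∈ₚ_)
open import Data.List.Membership.Propositional.Properties using (∈-++⁺ˡ; ∈-++⁺ʳ; ∈-++⁻; ∈-map⁺; ∈-map⁻)
import Data.List.Membership.Setoid as SetoidMembership
open import Data.List.Relation.Unary.Any using (here; there)
open import Data.Maybe.Base using (Maybe; just; nothing)
open import Data.Nat.Base as ℕ using (ℕ; zero; suc)
open import Data.Nat.Combinatorics using (_C_; nCn≡1; nCk+nC[k+1]≡[n+1]C[k+1])
open import Data.Nat.Divisibility using (∣-refl; ∣⇒≤; ∣m∣n⇒∣m+n; ∣m+n∣m⇒∣n; 0∣⇒≡0) renaming (_∣_ to _∣ℕ_)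
import Data.Nat.Properties as ℕ
open import Data.Nat.Solver using (module +-*-Solver)
open import Data.Product.Base as Product using (Σ; ∃; ∃₂; _×_; _,_; proj₁; proj₂)
open import Data.Sum.Base as Sum using (inj₁; inj₂)
open import Data.Unit.Polymorphic.Base using (⊤; tt)
open import Data.Vec.Functional as Vec using (Vector; insertAt; init; last)
open import Data.Vec.Functional.Properties using (insertAt-lookup; insertAt-punchIn; lookup-++ˡ; lookup-++ʳ)
open import Defs hiding (⟨_⟩; resp; zer; one; add; mul; neg; inv)
open import Function.Base using (_∘_; id)
open import Function.Bundles using (Equivalence)
open import Level using (Level; _⊔_)
open import Relation.Binary.Construct.Add.Supremum.Equality as SupremumEq using (≈⁺-trans)
open import Relation.Binary.Construct.Add.Supremum.NonStrict as SupremumOrder using ()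
open import Relation.Binary.PropositionalEquality as ≡ using (_≡_; _≢_)
import Relation.Binary.Reasoning.Setoid
open import Relation.Binary.Structures using (IsTotalOrder)
open import Relation.Nullary using (¬_; Dec; yes; no; contradiction)
open import Relation.Nullary.Construct.Add.Supremum using (⊤⁺; [_])
open import Relation.Unary using (Pred; _∈_; _⊆_; _∩_)

-- An identity found at z has to be read again at every z′ nearby. Division is therefore carried out
-- with cleared denominators, on polynomials and not on their values: one pseudo-division identity
-- serves both points, as long as the leading coefficient stays nonzero. For the same reason
-- algebraicity is measured over the rings Λ[z], never over their fraction fields. Under x ↦ xᵖ, K
-- becomes the subfield Kᵖ of K, and the p-th roots of the copy Λᵖ are the elements of Λ. Linear
-- disjointness then says that elements independent over Λ have p-th powers independent over Λ.
-- Applied to monomials in z, this rules out a least relation all of whose derivatives vanish.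
-- Besides the implicit functions themselves, the topology has to keep inequations true and to
-- separate points; both come from solving g(X) Y = 1. It also has to make open sets infinite, so
-- that a polynomial vanishing on a box is zero. At the end the coefficients of P(x, T) in T are
-- polynomials in x over Λ: if x were transcendental, they would all be zero polynomials, against
-- P(Y, t) ≠ 0.

module RingSolver {c ℓ} (R : CommutativeRing c ℓ) where
  open CommutativeRing R
  open Algebra.Properties.Ring ring
  open Algebra.Properties.AbelianGroup +-abelianGroup using (⁻¹-∙-comm)
  open Algebra.Properties.Semiring.Mult.TCOptimised semiring
    using () renaming (_×_ to _·_; 1+× to 1+·; ×-homo-+ to ·-homo-+; ×1-homo-* to ·1-homo-*)
  open Relation.Binary.Reasoning.Setoid setoid

  -- With this variant of multiplication `1 · 1#` computes to `1#`, so `κ (ℤ.+ 1)` in a solver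
  -- equation is `1#` by definition.
  ⟦_⟧ℤ : ℤ.ℤ → Carrier
  ⟦ ℤ.+ n ⟧ℤ      = n · 1#
  ⟦ ℤ.-[1+ n ] ⟧ℤ = - (suc n · 1#)

  private
    x≈[x+y]-y : ∀ x y → x ≈ (x + y) - y
    x≈[x+y]-y x y = begin
      x             ≈⟨ +-identityʳ x ⟨
      x + 0#        ≈⟨ +-congˡ (-‿inverseʳ y) ⟨
      x + (y - y)   ≈⟨ +-assoc x y (- y) ⟨
      (x + y) - y   ∎

    cancel-1 : ∀ x y → x - y ≈ (1# + x) - (1# + y)
    cancel-1 x y = begin
      x - y                    ≈⟨ +-congʳ (x≈[x+y]-y x 1#) ⟩
      ((x + 1#) - 1#) - y      ≈⟨ +-assoc _ _ _ ⟩
      (x + 1#) + (- 1# - y)    ≈⟨ +-cong (+-comm x 1#) (⁻¹-∙-comm 1# y) ⟩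
      (1# + x) - (1# + y)      ∎

  ⊖-homo : ∀ m n → ⟦ m ℤ.⊖ n ⟧ℤ ≈ m · 1# - n · 1#
  ⊖-homo m zero = begin
    m · 1#         ≈⟨ +-identityʳ _ ⟨
    m · 1# + 0#    ≈⟨ +-congˡ -0#≈0# ⟨
    m · 1# - 0#    ∎
  ⊖-homo zero (suc n) = sym (+-identityˡ _)
  ⊖-homo (suc m) (suc n) = begin
    ⟦ suc m ℤ.⊖ suc n ⟧ℤ             ≡⟨ ≡.cong ⟦_⟧ℤ (ℤ.[1+m]⊖[1+n]≡m⊖n m n) ⟩
    ⟦ m ℤ.⊖ n ⟧ℤ                     ≈⟨ ⊖-homo m n ⟩
    m · 1# - n · 1#                  ≈⟨ cancel-1 _ _ ⟩
    (1# + m · 1#) - (1# + n · 1#)    ≈⟨ +-cong (1+· m 1#) (-‿cong (1+· n 1#)) ⟨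
    suc m · 1# - suc n · 1#          ∎

  +-homo : ∀ i j → ⟦ i ℤ.+ j ⟧ℤ ≈ ⟦ i ⟧ℤ + ⟦ j ⟧ℤ
  +-homo (ℤ.+ m) (ℤ.+ n) = ·-homo-+ 1# m n
  +-homo (ℤ.+ m) ℤ.-[1+ n ] = ⊖-homo m (suc n)
  +-homo ℤ.-[1+ m ] (ℤ.+ n) = trans (⊖-homo n (suc m)) (+-comm _ _)
  +-homo ℤ.-[1+ m ] ℤ.-[1+ n ] = begin
    - (suc (suc (m ℕ.+ n)) · 1#)         ≡⟨ ≡.cong (λ k → - (suc k · 1#)) (≡.sym (ℕ.+-suc m n)) ⟩
    - ((suc m ℕ.+ suc n) · 1#)           ≈⟨ -‿cong (·-homo-+ 1# (suc m) (suc n)) ⟩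
    - (suc m · 1# + suc n · 1#)          ≈⟨ ⁻¹-∙-comm _ _ ⟨
    - (suc m · 1#) - suc n · 1#          ∎

  neg-homo : ∀ i → ⟦ ℤ.- i ⟧ℤ ≈ - ⟦ i ⟧ℤ
  neg-homo (ℤ.+ zero)   = sym -0#≈0#
  neg-homo ℤ.+[1+ n ]   = refl
  neg-homo ℤ.-[1+ n ]   = sym (-‿involutive _)

  private
    *-homo⁺⁺ : ∀ m n → ⟦ (ℤ.+ m) ℤ.* (ℤ.+ n) ⟧ℤ ≈ m · 1# * n · 1#
    *-homo⁺⁺ m n = begin
      ⟦ (ℤ.+ m) ℤ.* (ℤ.+ n) ⟧ℤ   ≡⟨ ≡.cong ⟦_⟧ℤ (ℤ.pos-* m n) ⟨
      (m ℕ.* n) · 1#             ≈⟨ ·1-homo-* m n ⟩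
      m · 1# * n · 1#            ∎

    *-homo⁺ : ∀ m j → ⟦ (ℤ.+ m) ℤ.* j ⟧ℤ ≈ m · 1# * ⟦ j ⟧ℤ
    *-homo⁺ m (ℤ.+ n) = *-homo⁺⁺ m n
    *-homo⁺ m ℤ.-[1+ n ] = begin
      ⟦ (ℤ.+ m) ℤ.* ℤ.-[1+ n ] ⟧ℤ        ≡⟨ ≡.cong ⟦_⟧ℤ (ℤ.neg-distribʳ-* (ℤ.+ m) ℤ.+[1+ n ]) ⟨
      ⟦ ℤ.- ((ℤ.+ m) ℤ.* ℤ.+[1+ n ]) ⟧ℤ  ≈⟨ neg-homo ((ℤ.+ m) ℤ.* ℤ.+[1+ n ]) ⟩
      - ⟦ (ℤ.+ m) ℤ.* ℤ.+[1+ n ] ⟧ℤ      ≈⟨ -‿cong (*-homo⁺⁺ m (suc n)) ⟩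
      - (m · 1# * suc n · 1#)            ≈⟨ -‿distribʳ-* _ _ ⟩
      m · 1# * - (suc n · 1#)            ∎

  *-homo : ∀ i j → ⟦ i ℤ.* j ⟧ℤ ≈ ⟦ i ⟧ℤ * ⟦ j ⟧ℤ
  *-homo (ℤ.+ m) j = *-homo⁺ m j
  *-homo ℤ.-[1+ m ] j = begin
    ⟦ ℤ.-[1+ m ] ℤ.* j ⟧ℤ          ≡⟨ ≡.cong ⟦_⟧ℤ (ℤ.neg-distribˡ-* ℤ.+[1+ m ] j) ⟨
    ⟦ ℤ.- (ℤ.+[1+ m ] ℤ.* j) ⟧ℤ    ≈⟨ neg-homo (ℤ.+[1+ m ] ℤ.* j) ⟩
    - ⟦ ℤ.+[1+ m ] ℤ.* j ⟧ℤ        ≈⟨ -‿cong (*-homo⁺ (suc m) j) ⟩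
    - (suc m · 1# * ⟦ j ⟧ℤ)        ≈⟨ -‿distribˡ-* _ _ ⟩
    - (suc m · 1#) * ⟦ j ⟧ℤ        ∎

  ℤ⟶R : CommutativeRing.rawRing ℤ.+-*-commutativeRing -Raw-AlmostCommutative⟶ fromCommutativeRing R
  ℤ⟶R = record
    { ⟦_⟧ = ⟦_⟧ℤ ; +-homo = +-homo ; *-homo = *-homo ; -‿homo = neg-homo
    ; 0-homo = refl ; 1-homo = refl }

  -- Coefficients are compared in ℤ, where equality is decidable. The solver thus proves exactly
  -- identities valid over ℤ, which hold in every characteristic.
  coeff≟ : ∀ i j → Maybe (⟦ i ⟧ℤ ≈ ⟦ j ⟧ℤ)
  coeff≟ i j with i ℤ.≟ j
  ... | yes ≡.refl = just refl
  ... | no _       = nothing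

  open Algebra.Solver.Ring _ (fromCommutativeRing R) ℤ⟶R coeff≟ public
    using (solve)
    renaming (_:+_ to _⊕_; _:*_ to _⊗_; :-_ to ⊝_; _:-_ to _⊖_; _:=_ to _⊜_; con to κ)

-- Classical logic and elementary field arithmetic

module Classical (em : ∀ {a} → ExcludedMiddle a) where

  dec : ∀ {a} (A : Set a) → Dec A
  dec A = em

  ¬¬-elim : ∀ {a} {A : Set a} → ¬ ¬ A → A
  ¬¬-elim {A = A} ¬¬a with dec A
  ... | yes a = a
  ... | no ¬a = contradiction ¬a ¬¬a

  ¬∀⇒∃¬ : ∀ {a b} {A : Set a} {B : A → Set b} → ¬ (∀ x → B x) → ∃ λ x → ¬ B x
  ¬∀⇒∃¬ ¬∀ = ¬¬-elim λ ¬∃ → ¬∀ λ x → ¬¬-elim λ ¬b → ¬∃ (x , ¬b)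

module FieldProperties (em : ∀ {a} → ExcludedMiddle a) {c ℓ} (K : Field c ℓ) where
  open Classical em
  open Field K public hiding (zero)
  open Algebra.Properties.Ring ring public using (-0#≈0#)
  open Algebra.Properties.Semiring.Exp semiring public
    using (_^_; ^-congˡ)
  open Algebra.Properties.Semiring.Sum semiring public
    using (sum; sum-cong-≋; sum-init-last; sum-remove; sum-replicate-zero; *-distribˡ-sum; ∑-distrib-+)
  open RingSolver commutativeRing public using (solve; _⊕_; _⊗_; ⊝_; _⊖_; _⊜_; κ)
  open Relation.Binary.Reasoning.Setoid setoid public

  ≉-resp : ∀ {x y} → x ≈ y → x ≉ 0# → y ≉ 0#
  ≉-resp x≈y x≉0 y≈0 = x≉0 (trans x≈y y≈0)

  *-cancel-0 : ∀ {x y} → x ≉ 0# → x * y ≈ 0# → y ≈ 0#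
  *-cancel-0 {x} {y} x≉0 xy≈0 = let x⁻¹ , xx⁻¹≈1 = inverse x x≉0 in begin
    y                ≈⟨ *-identityˡ y ⟨
    1# * y           ≈⟨ *-congʳ xx⁻¹≈1 ⟨
    (x * x⁻¹) * y    ≈⟨ solve 3 (λ x y z → (x ⊗ y) ⊗ z ⊜ y ⊗ (x ⊗ z)) refl x x⁻¹ y ⟩
    x⁻¹ * (x * y)    ≈⟨ *-congˡ xy≈0 ⟩
    x⁻¹ * 0#         ≈⟨ zeroʳ x⁻¹ ⟩
    0#               ∎

  *-≉0 : ∀ {x y} → x ≉ 0# → y ≉ 0# → x * y ≉ 0#
  *-≉0 x≉0 y≉0 xy≈0 = y≉0 (*-cancel-0 x≉0 xy≈0)

  1≉0 : 1# ≉ 0#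
  1≉0 1≈0 = 0≉1 (sym 1≈0)

  +≈0⇒≈- : ∀ {x y} → x + y ≈ 0# → y ≈ - x
  +≈0⇒≈- {x} {y} eq = begin
    y               ≈⟨ solve 2 (λ x y → y ⊜ (x ⊕ y) ⊖ x) refl x y ⟩
    (x + y) - x     ≈⟨ +-congʳ eq ⟩
    0# - x          ≈⟨ +-identityˡ _ ⟩
    - x             ∎

  -≈0⇒≈ : ∀ {x y} → x - y ≈ 0# → x ≈ y
  -≈0⇒≈ {x} {y} eq = begin
    x               ≈⟨ solve 2 (λ x y → x ⊜ (x ⊖ y) ⊕ y) refl x y ⟩
    (x - y) + y     ≈⟨ +-congʳ eq ⟩
    0# + y          ≈⟨ +-identityˡ y ⟩
    y               ∎

  sum-≈0 : ∀ {n} {a : Vector Carrier n} → (∀ i → a i ≈ 0#) → sum a ≈ 0#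
  sum-≈0 {n} a≈0 = trans (sum-cong-≋ a≈0) (sum-replicate-zero n)

  powerSum : ∀ {n} → Vector Carrier n → Carrier → Carrier
  powerSum a x = sum (λ i → a i * x ^ toℕ i)

  powerSum-cong : ∀ {n} {a b : Vector Carrier n} x → (∀ i → a i ≈ b i) → powerSum a x ≈ powerSum b x
  powerSum-cong x a≈b = sum-cong-≋ (λ i → *-congʳ (a≈b i))

  powerSum-suc : ∀ {n} (a : Vector Carrier (suc n)) x →
                 powerSum a x ≈ a zero + x * powerSum (a ∘ suc) x
  powerSum-suc a x = +-cong (*-identityʳ _) (begin
    sum (λ i → a (suc i) * (x * x ^ toℕ i))
      ≈⟨ sum-cong-≋ (λ i → solve 3 (λ a x y → a ⊗ (x ⊗ y) ⊜ x ⊗ (a ⊗ y)) refl (a (suc i)) x (x ^ toℕ i)) ⟩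
    sum (λ i → x * (a (suc i) * x ^ toℕ i))
      ≈⟨ *-distribˡ-sum x (λ i → a (suc i) * x ^ toℕ i) ⟨
    x * powerSum (a ∘ suc) x ∎)

  powerSum-init : ∀ {n} (a : Vector Carrier (suc n)) x →
                  powerSum a x ≈ powerSum (init a) x + last a * x ^ n
  powerSum-init {n} a x = trans (sum-init-last (λ i → a i * x ^ toℕ i))
    (+-cong (sum-cong-≋ (λ i → *-congˡ {a (inject₁ i)} (reflexive (≡.cong (x ^_) (toℕ-inject₁ i)))))
            (*-congˡ (reflexive (≡.cong (x ^_) (toℕ-fromℕ n)))))

  powerSum-linear : ∀ {n} (a b : Vector Carrier n) r s x →
                    powerSum (λ i → r * a i + s * b i) x ≈ r * powerSum a x + s * powerSum b x
  powerSum-linear a b r s x = begin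
    sum (λ i → (r * a i + s * b i) * x ^ toℕ i)
      ≈⟨ sum-cong-≋ (λ i → solve 5 (λ a b r s x → (r ⊗ a ⊕ s ⊗ b) ⊗ x ⊜ r ⊗ (a ⊗ x) ⊕ s ⊗ (b ⊗ x)) refl
                             (a i) (b i) r s (x ^ toℕ i)) ⟩
    sum (λ i → r * (a i * x ^ toℕ i) + s * (b i * x ^ toℕ i))
      ≈⟨ ∑-distrib-+ (λ i → r * (a i * x ^ toℕ i)) _ ⟩
    sum (λ i → r * (a i * x ^ toℕ i)) + sum (λ i → s * (b i * x ^ toℕ i))
      ≈⟨ +-cong (*-distribˡ-sum r (λ i → a i * x ^ toℕ i)) (*-distribˡ-sum s (λ i → b i * x ^ toℕ i)) ⟨
    r * powerSum a x + s * powerSum b x ∎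

  init-last-≈0 : ∀ {n} (a : Vector Carrier (suc n)) → (∀ i → init a i ≈ 0#) → last a ≈ 0# → ∀ i → a i ≈ 0#
  init-last-≈0 {zero}  a p q zero    = q
  init-last-≈0 {suc n} a p q zero    = p zero
  init-last-≈0 {suc n} a p q (suc i) = init-last-≈0 (a ∘ suc) (p ∘ suc) q i

  record IsSubring {r} (R : Pred Carrier r) : Set (c ⊔ ℓ ⊔ r) where
    field
      R-0    : R 0#
      R-1    : R 1#
      R-+    : ∀ {x y} → R x → R y → R (x + y)
      R-*    : ∀ {x y} → R x → R y → R (x * y)
      R-neg  : ∀ {x} → R x → R (- x)

  -- `R` of any level is allowed, so that the ring generated by a tuple can take its place; for
  -- `R = E` this unfolds to `RelativeAlgebraicClosure K E`.
  AlgebraicOver : ∀ {r} → Pred Carrier r → Pred Carrier (c ⊔ ℓ ⊔ r)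
  AlgebraicOver R x = Σ ℕ λ n → Σ (Vector Carrier n) λ a →
    (∀ i → R (a i)) × (∃ λ i → a i ≉ 0#) × powerSum a x ≈ 0#

-- Algebraicity is transitive: over a domain R, x is algebraic iff it maps some
-- finite-dimensional space containing 1 into itself.
module Algebraicity (em : ∀ {a} → ExcludedMiddle a) {c ℓ} (K : Field c ℓ) where
  open FieldProperties em K
  open Classical em

  module _ {r} {R : Pred Carrier r} (isSubring : IsSubring R) where
    open IsSubring isSubring

    -- The vectors that have a nonzero R-multiple in the R-module generated by ws.
    data Span : List Carrier → Pred Carrier (c ⊔ ℓ ⊔ r) where
      []   : ∀ {v} → v ≈ 0# → Span [] v
      step : ∀ {w ws v} s a → R s → s ≉ 0# → R a → Span ws (s * v - a * w) → Span (w ∷ ws) v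

    span-resp : ∀ {ws v v′} → v ≈ v′ → Span ws v → Span ws v′
    span-resp eq ([] v≈0) = [] (trans (sym eq) v≈0)
    span-resp eq (step s a Rs s≉0 Ra p) = step s a Rs s≉0 Ra (span-resp (+-congʳ (*-congˡ eq)) p)

    span-* : ∀ {ws v x} → R x → Span ws v → Span ws (x * v)
    span-* {x = x} Rx ([] v≈0) = [] (trans (*-congˡ v≈0) (zeroʳ x))
    span-* {v = v} {x} Rx (step {w} s a Rs s≉0 Ra p) = step s (x * a) Rs s≉0 (R-* Rx Ra)
      (span-resp (solve 5 (λ x s v a w → x ⊗ (s ⊗ v ⊖ a ⊗ w) ⊜ s ⊗ (x ⊗ v) ⊖ (x ⊗ a) ⊗ w) refl x s v a w)
                 (span-* Rx p))

    span-cancel : ∀ {ws v x} → R x → x ≉ 0# → Span ws (x * v) → Span ws v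
    span-cancel Rx x≉0 ([] xv≈0) = [] (*-cancel-0 x≉0 xv≈0)
    span-cancel {v = v} {x} Rx x≉0 (step {w} s a Rs s≉0 Ra p) =
      step (s * x) a (R-* Rs Rx) (*-≉0 s≉0 x≉0) Ra (span-resp (+-congʳ (sym (*-assoc s x v))) p)

    span-+ : ∀ {ws v v′} → Span ws v → Span ws v′ → Span ws (v + v′)
    span-+ ([] v≈0) ([] v′≈0) = [] (trans (+-cong v≈0 v′≈0) (+-identityˡ 0#))
    span-+ {v = v} {v′} (step {w} s a Rs s≉0 Ra p) (step t b Rt t≉0 Rb q) =
      step (s * t) (t * a + s * b) (R-* Rs Rt) (*-≉0 s≉0 t≉0) (R-+ (R-* Rt Ra) (R-* Rs Rb))
        (span-resp (solve 7 (λ s a t b v v′ w →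
                      t ⊗ (s ⊗ v ⊖ a ⊗ w) ⊕ s ⊗ (t ⊗ v′ ⊖ b ⊗ w)
                      ⊜ (s ⊗ t) ⊗ (v ⊕ v′) ⊖ (t ⊗ a ⊕ s ⊗ b) ⊗ w) refl s a t b v v′ w)
                   (span-+ (span-* Rt p) (span-* Rs q)))

    span-0 : ∀ {ws} → Span ws 0#
    span-0 {[]} = [] refl
    span-0 {w ∷ ws} = step 1# 0# R-1 1≉0 R-0
      (span-resp (solve 1 (λ w → κ (ℤ.+ 0) ⊜ κ (ℤ.+ 1) ⊗ κ (ℤ.+ 0) ⊖ κ (ℤ.+ 0) ⊗ w) refl w) span-0)

    span-there : ∀ {w ws v} → Span ws v → Span (w ∷ ws) v
    span-there {w} {v = v} p = step 1# 0# R-1 1≉0 R-0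
      (span-resp (solve 2 (λ v w → v ⊜ κ (ℤ.+ 1) ⊗ v ⊖ κ (ℤ.+ 0) ⊗ w) refl v w) p)

    span-∈ : ∀ {w ws} → w ∈ₚ ws → Span ws w
    span-∈ {w} (here ≡.refl) = step 1# 1# R-1 1≉0 R-1
      (span-resp (solve 1 (λ w → κ (ℤ.+ 0) ⊜ κ (ℤ.+ 1) ⊗ w ⊖ κ (ℤ.+ 1) ⊗ w) refl w) span-0)
    span-∈ (there w∈ws) = span-there (span-∈ w∈ws)

    -- Multiplication by y is linear, so its values on the generators decide. Each step puts s (y v)
    -- into the span, and the nonzero denominator s is cancelled.
    span-bind : ∀ {ws us v} y → (∀ {w} → w ∈ₚ ws → Span us (y * w)) → Span ws v → Span us (y * v)
    span-bind y f ([] v≈0) = span-resp (sym (trans (*-congˡ v≈0) (zeroʳ y))) span-0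
    span-bind {v = v} y f (step {w} s a Rs s≉0 Ra p) = span-cancel Rs s≉0
      (span-resp (solve 5 (λ s a v w y → y ⊗ (s ⊗ v ⊖ a ⊗ w) ⊕ a ⊗ (y ⊗ w) ⊜ s ⊗ (y ⊗ v)) refl s a v w y)
                 (span-+ (span-bind y (f ∘ there) p) (span-* Ra (f (here ≡.refl)))))

    Dependent : ∀ {n} → Vector Carrier n → Set (c ⊔ ℓ ⊔ r)
    Dependent {n} vs = Σ (Vector Carrier n) λ b →
      (∀ i → R (b i)) × (∃ λ i → b i ≉ 0#) × sum (λ i → b i * vs i) ≈ 0#

    private
      identity₁ : ∀ a a′ s v s′ v′ w → a * (s * v - a′ * w) + (- a′) * (s′ * v′ - a * w) ≈ a * (s * v) - a′ * (s′ * v′)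
      identity₁ = solve 7 (λ a a′ s v s′ v′ w →
        a ⊗ (s ⊗ v ⊖ a′ ⊗ w) ⊕ (⊝ a′) ⊗ (s′ ⊗ v′ ⊖ a ⊗ w) ⊜ a ⊗ (s ⊗ v) ⊖ a′ ⊗ (s′ ⊗ v′)) refl

      identity₂ : ∀ x y z → - x * y * z ≈ - (y * z) * x
      identity₂ = solve 3 (λ x y z → (⊝ x) ⊗ y ⊗ z ⊜ (⊝ (y ⊗ z)) ⊗ x) refl

      identity₃ : ∀ b a a′ s v t → - t * (b * a′) + b * (a * s) * v ≈ b * (a * (s * v) - a′ * t)
      identity₃ = solve 6 (λ b a a′ s v t →
        (⊝ t) ⊗ (b ⊗ a′) ⊕ b ⊗ (a ⊗ s) ⊗ v ⊜ b ⊗ (a ⊗ (s ⊗ v) ⊖ a′ ⊗ t)) refl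

      -- Gaussian elimination without division: with `a j` as pivot, the combinations `us` no longer
      -- involve w, and a dependence between them gives one between the `vs`.
      eliminate : ∀ {n w ws} (vs : Vector Carrier (suc n)) (s a : Vector Carrier (suc n)) j →
                  (∀ i → R (s i)) → (∀ i → s i ≉ 0#) → (∀ i → R (a i)) → a j ≉ 0# →
                  (∀ i → Span ws (s i * vs i - a i * w)) →
                  ((us : Vector Carrier n) → (∀ i → Span ws (us i)) → Dependent us) → Dependent vs
      eliminate {n} {w} {ws} vs s a j Rs s≉0 Ra aⱼ≉0 p IH = lift (IH us us∈)
        where
        us : Vector Carrier n
        us k = a j * (s (punchIn j k) * vs (punchIn j k)) - a (punchIn j k) * (s j * vs j)
        us∈ : ∀ k → Span ws (us k)
        us∈ k = span-resp
          (identity₁ (a j) (a (punchIn j k)) (s (punchIn j k)) (vs (punchIn j k)) (s j) (vs j) w)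
          (span-+ (span-* (Ra j) (p (punchIn j k))) (span-* (R-neg (Ra (punchIn j k))) (p j)))
        R-sum : ∀ {n} {x : Vector Carrier n} → (∀ i → R (x i)) → R (sum x)
        R-sum {zero} Rx = R-0
        R-sum {suc n} Rx = R-+ (Rx zero) (R-sum (Rx ∘ suc))
        R-insert : ∀ {n} (x : Vector Carrier n) y j → (∀ i → R (x i)) → R y → ∀ i → R (insertAt x j y i)
        R-insert x y zero Rx Ry zero = Ry
        R-insert x y zero Rx Ry (suc i) = Rx i
        R-insert {suc n} x y (suc j) Rx Ry zero = Rx zero
        R-insert {suc n} x y (suc j) Rx Ry (suc i) = R-insert (x ∘ suc) y j (Rx ∘ suc) Ry i

        lift : Dependent us → Dependent vs
        lift (b , Rb , (i , bᵢ≉0) , eq) = B , RB , (punchIn j i , Bᵢ≉0) , B-relation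
          where
          b′ : Vector Carrier n
          b′ k = b k * (a j * s (punchIn j k))
          σ = sum (λ k → b k * a (punchIn j k))
          -- This is the coefficient of `vs j` once the sum of the b k * us k is expanded.
          e = - σ * s j
          B = insertAt b′ j e
          RB : ∀ k → R (B k)
          RB = R-insert b′ e j (λ k → R-* (Rb k) (R-* (Ra j) (Rs _)))
                 (R-* (R-neg (R-sum (λ k → R-* (Rb k) (Ra _)))) (Rs j))
          Bᵢ≉0 : B (punchIn j i) ≉ 0#
          Bᵢ≉0 = ≉-resp (sym (reflexive (insertAt-punchIn b′ j e i))) (*-≉0 bᵢ≉0 (*-≉0 aⱼ≉0 (s≉0 _)))
          B-relation : sum (λ k → B k * vs k) ≈ 0#
          B-relation = begin
            sum (λ k → B k * vs k)
              ≈⟨ sum-remove (λ k → B k * vs k) ⟩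
            B j * vs j + sum (λ k → B (punchIn j k) * vs (punchIn j k))
              ≈⟨ +-cong (*-congʳ (reflexive (insertAt-lookup b′ j e)))
                        (sum-cong-≋ λ k → *-congʳ (reflexive (insertAt-punchIn b′ j e k))) ⟩
            e * vs j + sum (λ k → b′ k * vs (punchIn j k))
              ≈⟨ +-congʳ (trans (identity₂ σ (s j) (vs j))
                                (*-distribˡ-sum (- (s j * vs j)) (λ k → b k * a (punchIn j k)))) ⟩
            sum (λ k → - (s j * vs j) * (b k * a (punchIn j k))) + sum (λ k → b′ k * vs (punchIn j k))
              ≈⟨ ∑-distrib-+ (λ k → - (s j * vs j) * (b k * a (punchIn j k))) _ ⟨
            sum (λ k → - (s j * vs j) * (b k * a (punchIn j k)) + b′ k * vs (punchIn j k))
              ≈⟨ sum-cong-≋ (λ k → identity₃ (b k) (a j) (a (punchIn j k)) (s (punchIn j k)) (vs (punchIn j k))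
                                            (s j * vs j)) ⟩
            sum (λ k → b k * us k)
              ≈⟨ eq ⟩
            0# ∎

    span⇒dependent : ∀ ws (vs : Vector Carrier (suc (List.length ws))) → (∀ i → Span ws (vs i)) → Dependent vs
    span⇒dependent [] vs p with p zero
    ... | [] v≈0 = (λ _ → 1#) , (λ _ → R-1) , (zero , 1≉0)
                 , trans (+-identityʳ _) (trans (*-identityˡ _) v≈0)
    span⇒dependent (w ∷ ws) vs p = by-cases (dec (∃ λ j → a j ≉ 0#))
      where
      data View (v : Carrier) : Set (c ⊔ ℓ ⊔ r) where
        view : ∀ s a → R s → s ≉ 0# → R a → Span ws (s * v - a * w) → View v
      viewSpan : ∀ {v} → Span (w ∷ ws) v → View v
      viewSpan (step s a Rs s≉0 Ra q) = view s a Rs s≉0 Ra q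
      coefficients : ∀ i → ∃₂ λ s a → R s × s ≉ 0# × R a × Span ws (s * vs i - a * w)
      coefficients i with viewSpan (p i)
      ... | view s a Rs s≉0 Ra q = s , a , Rs , s≉0 , Ra , q
      s = λ i → proj₁ (coefficients i)
      a = λ i → proj₁ (proj₂ (coefficients i))
      Rs = λ i → proj₁ (proj₂ (proj₂ (coefficients i)))
      s≉0 = λ i → proj₁ (proj₂ (proj₂ (proj₂ (coefficients i))))
      Ra = λ i → proj₁ (proj₂ (proj₂ (proj₂ (proj₂ (coefficients i)))))
      q = λ i → proj₂ (proj₂ (proj₂ (proj₂ (proj₂ (coefficients i)))))

      by-cases : Dec (∃ λ j → a j ≉ 0#) → Dependent vs
      by-cases (yes (j , aⱼ≉0)) = eliminate vs s a j Rs s≉0 Ra aⱼ≉0 q (span⇒dependent ws)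
      by-cases (no a≈0) =
        let b , Rb , (i , bᵢ≉0) , eq = span⇒dependent ws (vs ∘ suc) λ i → span-cancel (Rs (suc i)) (s≉0 (suc i))
              (span-resp (begin
                 s (suc i) * vs (suc i) - a (suc i) * w
                   ≈⟨ +-congˡ (-‿cong (*-congʳ (¬¬-elim λ aᵢ≉0 → a≈0 (suc i , aᵢ≉0)))) ⟩
                 s (suc i) * vs (suc i) - 0# * w
                   ≈⟨ solve 2 (λ x w → x ⊖ κ (ℤ.+ 0) ⊗ w ⊜ x) refl (s (suc i) * vs (suc i)) w ⟩
                 s (suc i) * vs (suc i) ∎) (q (suc i)))
        in 0# Vec.∷ b , (λ { zero → R-0 ; (suc i) → Rb i }) , (suc i , bᵢ≉0)
         , trans (+-congʳ (zeroˡ _)) (trans (+-identityˡ _) eq)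

    Stabilizer : List Carrier → Pred Carrier (c ⊔ ℓ ⊔ r)
    Stabilizer ws y = ∀ {v} → Span ws v → Span ws (y * v)

    stabilizer-+ : ∀ {ws x y} → Stabilizer ws x → Stabilizer ws y → Stabilizer ws (x + y)
    stabilizer-+ p q v∈ = span-resp (sym (distribʳ _ _ _)) (span-+ (p v∈) (q v∈))

    stabilizer-* : ∀ {ws x y} → Stabilizer ws x → Stabilizer ws y → Stabilizer ws (x * y)
    stabilizer-* p q v∈ = span-resp (sym (*-assoc _ _ _)) (p (q v∈))

    stabilizer-sum : ∀ {n ws} {a : Vector Carrier n} → (∀ i → Stabilizer ws (a i)) → Stabilizer ws (sum a)
    stabilizer-sum {zero} p v∈ = span-resp (sym (zeroˡ _)) span-0
    stabilizer-sum {suc n} p = stabilizer-+ (p zero) (stabilizer-sum (p ∘ suc))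

    stabilizer-^ : ∀ {ws x} → Stabilizer ws x → ∀ n → Stabilizer ws (x ^ n)
    stabilizer-^ p zero v∈ = span-resp (sym (*-identityˡ _)) v∈
    stabilizer-^ p (suc n) = stabilizer-* p (stabilizer-^ p n)

    -- Every power of x is that power applied to 1, hence in the space; one more power than there
    -- are generators must be dependent.
    stabilizer⇒algebraic : ∀ {ws x} → Span ws 1# → Stabilizer ws x → AlgebraicOver R x
    stabilizer⇒algebraic {ws} {x} 1∈ p =
      let b , Rb , b≉0 , eq = span⇒dependent ws (λ i → x ^ toℕ i)
                                λ i → span-resp (*-identityʳ _) (stabilizer-^ p (toℕ i) 1∈)
      in _ , b , Rb , b≉0 , eq

    -- If a₀ ≠ 0, the relation reads x (a₁ + a₂ x + ...) = - a₀, so the bracket is an inverse of x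
    -- up to a nonzero factor in R. If a₀ = 0, a factor x is divided off first.
    algebraic⇒inverse : ∀ {n x ws} (a : Vector Carrier n) → (∀ i → R (a i)) → (∃ λ i → a i ≉ 0#) →
                        powerSum a x ≈ 0# → x ≉ 0# → Stabilizer ws x →
                        ∃₂ λ y r → Stabilizer ws y × R r × r ≉ 0# × y * x ≈ r
    algebraic⇒inverse {suc n} {x} a Ra (i , aᵢ≉0) eq x≉0 stab with dec (a zero ≈ 0#)
    ... | no a₀≉0 = powerSum (a ∘ suc) x , - a zero
                  , stabilizer-sum (λ i → stabilizer-* (span-* (Ra (suc i))) (stabilizer-^ stab (toℕ i)))
                  , R-neg (Ra zero)
                  , (λ -a₀≈0 → a₀≉0 (trans (solve 1 (λ x → x ⊜ ⊝ (⊝ x)) refl _) (trans (-‿cong -a₀≈0) -0#≈0#)))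
                  , trans (*-comm _ x) (+≈0⇒≈- (trans (sym (powerSum-suc a x)) eq))
    ... | yes a₀≈0 = algebraic⇒inverse (a ∘ suc) (Ra ∘ suc) (tail≉0 i aᵢ≉0)
                       (*-cancel-0 x≉0 (begin
                          x * powerSum (a ∘ suc) x           ≈⟨ +-identityˡ _ ⟨
                          0# + x * powerSum (a ∘ suc) x      ≈⟨ +-congʳ a₀≈0 ⟨
                          a zero + x * powerSum (a ∘ suc) x  ≈⟨ powerSum-suc a x ⟨
                          powerSum a x                       ≈⟨ eq ⟩
                          0#                                 ∎)) x≉0 stab
      where
      tail≉0 : ∀ i → a i ≉ 0# → ∃ λ i → a (suc i) ≉ 0#
      tail≉0 zero a₀≉0 = contradiction a₀≈0 a₀≉0
      tail≉0 (suc i) aᵢ≉0 = i , aᵢ≉0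

    module _ {r′} {R′ : Pred Carrier r′} (V : List Carrier) (1∈V : Span V 1#) (R′⊆ : ∀ {y} → R′ y → Stabilizer V y) where

      private
        products : Carrier → ℕ → List Carrier
        products x zero = []
        products x (suc e) = List.map (x ^ e *_) V List.++ products x e

        ∈-products⁺ : ∀ {x j e w} → j ℕ.< e → w ∈ₚ V → x ^ j * w ∈ₚ products x e
        ∈-products⁺ {x} {j} {suc e} j<e w∈V with j ℕ.≟ e
        ... | yes ≡.refl = ∈-++⁺ˡ (∈-map⁺ (x ^ e *_) w∈V)
        ... | no j≢e = ∈-++⁺ʳ _ (∈-products⁺ (ℕ.≤∧≢⇒< (ℕ.≤-pred j<e) j≢e) w∈V)

        ∈-products⁻ : ∀ {x} e {u} → u ∈ₚ products x e → ∃₂ λ j w → j ℕ.< e × w ∈ₚ V × u ≡ x ^ j * w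
        ∈-products⁻ {x} (suc e) u∈ with ∈-++⁻ (List.map (x ^ e *_) V) u∈
        ... | inj₁ u∈map = let w , w∈V , eq = ∈-map⁻ (x ^ e *_) u∈map in e , w , ℕ.≤-refl , w∈V , eq
        ... | inj₂ u∈ = let j , w , j<e , rest = ∈-products⁻ e u∈ in j , w , ℕ.m<n⇒m<1+n j<e , rest

        span-products : ∀ {x j e w} → j ℕ.< e → Span V w → Span (products x e) (x ^ j * w)
        span-products {x} {j} j<e = span-bind (x ^ j) (λ w∈V → span-∈ (∈-products⁺ j<e w∈V))

        stabilizer-products : ∀ {x e y} → Stabilizer V y → Stabilizer (products x e) y
        stabilizer-products {x} {e} {y} p = span-bind y λ u∈ → lemma (∈-products⁻ e u∈)
          where
          lemma : ∀ {u} → (∃₂ λ j w → j ℕ.< e × w ∈ₚ V × u ≡ x ^ j * w) → Span (products x e) (y * u)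
          lemma (j , w , j<e , w∈V , ≡.refl) = span-resp
            (solve 3 (λ x y w → x ⊗ (y ⊗ w) ⊜ y ⊗ (x ⊗ w)) refl (x ^ j) y w)
            (span-products j<e (p (span-∈ w∈V)))

      private
        Extension : Carrier → Set _
        Extension x = ∃ λ U → Span U 1# × (∀ {y} → Stabilizer V y → Stabilizer U y) × Stabilizer U x

        -- The new space is generated by the x ^ j * w with j < n and w in V. Multiplication by x
        -- leaves it only at x ^ n * w, which the relation expresses by lower powers after division
        -- by the leading coefficient u. That division is possible up to a factor in R: u stabilises
        -- V, so it is algebraic over R.
        adjoin-leading : ∀ {x} e (a : Vector Carrier (suc e)) → (∀ i → R′ (a i)) → last a ≉ 0# →
                         powerSum a x ≈ 0# → Extension x
        adjoin-leading {x} zero a R′a last≉0 eq =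
          contradiction (trans (sym (trans (+-identityʳ _) (*-identityʳ _))) eq) last≉0
        adjoin-leading {x} (suc e) a R′a last≉0 eq =
          U , span-resp (*-identityˡ 1#) (span-products {x} {0} {n} (ℕ.s≤s ℕ.z≤n) 1∈V)
            , stabilizer-products {x} {n} , stab-x
          where
          n = suc e
          U = products x n
          u = last a
          S = powerSum (init a) x

          span-sum : ∀ {n} {a : Vector Carrier n} → (∀ i → Span U (a i)) → Span U (sum a)
          span-sum {zero} p = span-0
          span-sum {suc n} p = span-+ (p zero) (span-sum (p ∘ suc))

          u-inverse : ∃₂ λ y r → Stabilizer U y × R r × r ≉ 0# × y * u ≈ r
          u-inverse with stabilizer⇒algebraic 1∈V (R′⊆ (R′a (fromℕ n)))
          ... | _ , b , Rb , b≉0 , b-relation =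
            algebraic⇒inverse b Rb b≉0 b-relation last≉0 (stabilizer-products {x} {n} (R′⊆ (R′a (fromℕ n))))

          S*w∈U : ∀ {w} → w ∈ₚ V → Span U (S * w)
          S*w∈U {w} w∈V = span-resp
            (trans (sym (*-distribˡ-sum w (λ i → init a i * x ^ toℕ i))) (*-comm w S))
            (span-sum λ i → span-resp (solve 3 (λ a x w → a ⊗ (x ⊗ w) ⊜ w ⊗ (a ⊗ x)) refl (init a i) (x ^ toℕ i) w)
              (stabilizer-products {x} {n} (R′⊆ (R′a (inject₁ i))) (span-products (toℕ<n i) (span-∈ w∈V))))

          top : ∀ {w} → w ∈ₚ V → Span U (x * (x ^ e * w))
          top {w} w∈V with u-inverse
          ... | y , t , stab-y , Rt , t≉0 , yu≈t = span-cancel Rt t≉0 (span-resp (begin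
            y * (- 1# * (S * w))
              ≈⟨ solve 3 (λ y S w → y ⊗ ((⊝ κ (ℤ.+ 1)) ⊗ (S ⊗ w)) ⊜ y ⊗ ((⊝ S) ⊗ w)) refl y S w ⟩
            y * (- S * w)
              ≈⟨ *-congˡ (*-congʳ (+≈0⇒≈- (trans (sym (powerSum-init a x)) eq))) ⟨
            y * (u * x ^ n * w)
              ≈⟨ solve 5 (λ y u x z w → y ⊗ (u ⊗ (x ⊗ z) ⊗ w) ⊜ (y ⊗ u) ⊗ (x ⊗ (z ⊗ w))) refl y u x (x ^ e) w ⟩
            (y * u) * (x * (x ^ e * w))
              ≈⟨ *-congʳ yu≈t ⟩
            t * (x * (x ^ e * w)) ∎)
            (stab-y (span-* (R-neg R-1) (S*w∈U w∈V))))

          stab-x : Stabilizer U x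
          stab-x = span-bind x λ u∈ → shift (∈-products⁻ n u∈)
            where
            shift : ∀ {v} → (∃₂ λ j w → j ℕ.< n × w ∈ₚ V × v ≡ x ^ j * w) → Span U (x * v)
            shift (j , w , j<n , w∈V , ≡.refl) with suc j ℕ.<? n
            ... | yes 1+j<n = span-resp (*-assoc _ _ _) (span-products 1+j<n (span-∈ w∈V))
            ... | no 1+j≮n with ℕ.≤-antisym j<n (ℕ.≮⇒≥ 1+j≮n)
            ... | ≡.refl = top w∈V

        adjoin′ : ∀ n {x} (a : Vector Carrier n) → (∀ i → R′ (a i)) → (∃ λ i → a i ≉ 0#) →
                  powerSum a x ≈ 0# → Extension x
        adjoin′ zero a _ (() , _) _
        adjoin′ (suc e) {x} a R′a (i , aᵢ≉0) eq with dec (last a ≈ 0#)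
        ... | no last≉0 = adjoin-leading e a R′a last≉0 eq
        ... | yes last≈0 = adjoin′ e (init a) (R′a ∘ inject₁)
          (¬∀⇒∃¬ (λ init≈0 → aᵢ≉0 (init-last-≈0 a init≈0 last≈0 i))) (begin
            powerSum (init a) x                     ≈⟨ +-identityʳ _ ⟨
            powerSum (init a) x + 0#                ≈⟨ +-congˡ (zeroˡ _) ⟨
            powerSum (init a) x + 0# * x ^ e        ≈⟨ +-congˡ (*-congʳ last≈0) ⟨
            powerSum (init a) x + last a * x ^ e    ≈⟨ powerSum-init a x ⟨
            powerSum a x                            ≈⟨ eq ⟩
            0#                                      ∎)

      -- The coefficients may come from a ring R′ larger than R whose elements are themselves only
      -- algebraic over R; this is what makes transitivity work.
      adjoin : ∀ {x} → AlgebraicOver R′ x → Extension x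
      adjoin (n , a , R′a , a≉0 , eq) = adjoin′ n a R′a a≉0 eq

-- Polynomials over a subfield: evaluation, derivatives, substitution

module Polynomials (em : ∀ {a} → ExcludedMiddle a) {c ℓ} (K : Field c ℓ)
                   {E : Pred (Field.Carrier K) (c ⊔ ℓ)} (isSubfield : IsSubfield K E) where
  open FieldProperties em K
  open Classical em
  open IsSubfield isSubfield hiding (resp)
  open import Algebra.Properties.Semiring.Mult semiring public
    using () renaming (_×_ to _·_; ×-congʳ to ·-congʳ; ×-assoc-* to ·-assoc-*; ×-comm-* to ·-comm-*)

  private
    s : Level
    s = c ⊔ ℓ

  Coefficient : Set s
  Coefficient = ∃ E

  -- c ◂ f stands for c + X₀ f, where c does not contain the variable X₀.
  data Poly : ℕ → Set s where
    con : Coefficient → Poly 0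
    nil : ∀ {n} → Poly (suc n)
    _◂_ : ∀ {n} → Poly n → Poly (suc n) → Poly (suc n)

  infixr 5 _◂_

  private variable
    m n : ℕ

  ev : Poly n → Vector Carrier n → Carrier
  ev (con (a , _)) ρ = a
  ev nil           ρ = 0#
  ev (f ◂ g)       ρ = ev f (ρ ∘ suc) + ρ zero * ev g ρ

  ev-cong : ∀ (f : Poly n) {ρ ρ′} → (∀ i → ρ i ≈ ρ′ i) → ev f ρ ≈ ev f ρ′
  ev-cong (con a) ρ≈ρ′ = refl
  ev-cong nil     ρ≈ρ′ = refl
  ev-cong (f ◂ g) ρ≈ρ′ = +-cong (ev-cong f (ρ≈ρ′ ∘ suc)) (*-cong (ρ≈ρ′ zero) (ev-cong g ρ≈ρ′))

  constant : Coefficient → Poly n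
  constant {zero}  a = con a
  constant {suc n} a = constant a ◂ nil

  ev-constant : ∀ a (ρ : Vector Carrier n) → ev (constant a) ρ ≈ proj₁ a
  ev-constant {zero}  a ρ = refl
  ev-constant {suc n} a ρ = trans (+-cong (ev-constant a (ρ ∘ suc)) (zeroʳ _)) (+-identityʳ _)

  0ₚ 1ₚ : Poly n
  0ₚ = constant (0# , 0-closed)
  1ₚ = constant (1# , 1-closed)

  ev-0 : ∀ (ρ : Vector Carrier n) → ev 0ₚ ρ ≈ 0#
  ev-0 = ev-constant (0# , 0-closed)

  ev-1 : ∀ (ρ : Vector Carrier n) → ev 1ₚ ρ ≈ 1#
  ev-1 = ev-constant (1# , 1-closed)

  variable′ : Fin n → Poly n
  variable′ zero    = 0ₚ ◂ 1ₚ ◂ nil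
  variable′ (suc i) = variable′ i ◂ nil

  ev-variable : ∀ i (ρ : Vector Carrier n) → ev (variable′ i) ρ ≈ ρ i
  ev-variable zero ρ = begin
    ev 0ₚ (ρ ∘ suc) + ρ zero * (ev 1ₚ (ρ ∘ suc) + ρ zero * 0#)
      ≈⟨ +-cong (ev-0 (ρ ∘ suc)) (*-congˡ (+-congʳ (ev-1 (ρ ∘ suc)))) ⟩
    0# + ρ zero * (1# + ρ zero * 0#)
      ≈⟨ solve 1 (λ x → κ (ℤ.+ 0) ⊕ x ⊗ (κ (ℤ.+ 1) ⊕ x ⊗ κ (ℤ.+ 0)) ⊜ x) refl (ρ zero) ⟩
    ρ zero ∎
  ev-variable (suc i) ρ = trans (+-cong (ev-variable i (ρ ∘ suc)) (zeroʳ _)) (+-identityʳ _)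

  infixl 6 _+ₚ_
  infixl 7 _*ₚ_ _•_
  infix  8 -ₚ_

  _+ₚ_ : Poly n → Poly n → Poly n
  con (a , a∈) +ₚ con (b , b∈) = con (a + b , +-closed a∈ b∈)
  nil          +ₚ g            = g
  (a ◂ f)      +ₚ nil          = a ◂ f
  (a ◂ f)      +ₚ (b ◂ g)      = (a +ₚ b) ◂ (f +ₚ g)

  -ₚ_ : Poly n → Poly n
  -ₚ con (a , a∈) = con (- a , neg-closed a∈)
  -ₚ nil          = nil
  -ₚ (a ◂ f)      = -ₚ a ◂ -ₚ f

  _*ₚ_ : Poly n → Poly n → Poly n
  _•_  : Poly n → Poly (suc n) → Poly (suc n)
  con (a , a∈) *ₚ con (b , b∈) = con (a * b , *-closed a∈ b∈)
  nil          *ₚ g            = nil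
  (a ◂ f)      *ₚ g            = a • g +ₚ (0ₚ ◂ f *ₚ g)
  a • nil     = nil
  a • (b ◂ g) = (a *ₚ b) ◂ a • g

  ev-+ : ∀ (f g : Poly n) ρ → ev (f +ₚ g) ρ ≈ ev f ρ + ev g ρ
  ev-+ (con a) (con b) ρ = refl
  ev-+ nil     g       ρ = sym (+-identityˡ _)
  ev-+ (a ◂ f) nil     ρ = sym (+-identityʳ _)
  ev-+ (a ◂ f) (b ◂ g) ρ = trans (+-cong (ev-+ a b _) (*-congˡ (ev-+ f g ρ)))
    (solve 5 (λ a b x f g → (a ⊕ b) ⊕ x ⊗ (f ⊕ g) ⊜ (a ⊕ x ⊗ f) ⊕ (b ⊕ x ⊗ g)) refl
       (ev a (ρ ∘ suc)) (ev b (ρ ∘ suc)) (ρ zero) (ev f ρ) (ev g ρ))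

  ev-neg : ∀ (f : Poly n) ρ → ev (-ₚ f) ρ ≈ - ev f ρ
  ev-neg (con a) ρ = refl
  ev-neg nil     ρ = sym -0#≈0#
  ev-neg (a ◂ f) ρ = trans (+-cong (ev-neg a _) (*-congˡ (ev-neg f ρ)))
    (solve 3 (λ a x f → ⊝ a ⊕ x ⊗ (⊝ f) ⊜ ⊝ (a ⊕ x ⊗ f)) refl (ev a (ρ ∘ suc)) (ρ zero) (ev f ρ))

  ev-* : ∀ (f g : Poly n) ρ → ev (f *ₚ g) ρ ≈ ev f ρ * ev g ρ
  ev-• : ∀ (a : Poly n) g ρ → ev (a • g) ρ ≈ ev a (ρ ∘ suc) * ev g ρ
  ev-* (con a) (con b) ρ = refl
  ev-* nil     g       ρ = sym (zeroˡ _)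
  ev-* (a ◂ f) g       ρ = begin
    ev (a • g +ₚ (0ₚ ◂ f *ₚ g)) ρ
      ≈⟨ ev-+ (a • g) _ ρ ⟩
    ev (a • g) ρ + (ev 0ₚ (ρ ∘ suc) + ρ zero * ev (f *ₚ g) ρ)
      ≈⟨ +-cong (ev-• a g ρ) (+-cong (ev-0 (ρ ∘ suc)) (*-congˡ (ev-* f g ρ))) ⟩
    ev a (ρ ∘ suc) * ev g ρ + (0# + ρ zero * (ev f ρ * ev g ρ))
      ≈⟨ solve 4 (λ a x f g → a ⊗ g ⊕ (κ (ℤ.+ 0) ⊕ x ⊗ (f ⊗ g)) ⊜ (a ⊕ x ⊗ f) ⊗ g) refl
           (ev a (ρ ∘ suc)) (ρ zero) (ev f ρ) (ev g ρ) ⟩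
    (ev a (ρ ∘ suc) + ρ zero * ev f ρ) * ev g ρ ∎
  ev-• a nil     ρ = sym (zeroʳ _)
  ev-• a (b ◂ g) ρ = trans (+-cong (ev-* a b _) (*-congˡ (ev-• a g ρ)))
    (solve 4 (λ a b x g → a ⊗ b ⊕ x ⊗ (a ⊗ g) ⊜ a ⊗ (b ⊕ x ⊗ g)) refl
       (ev a (ρ ∘ suc)) (ev b (ρ ∘ suc)) (ρ zero) (ev g ρ))

  ·-closed : ∀ k {x} → x ∈ E → k · x ∈ E
  ·-closed zero    x∈ = 0-closed
  ·-closed (suc k) x∈ = +-closed x∈ (·-closed k x∈)

  scale : ℕ → Poly n → Poly n
  scale k (con (a , a∈)) = con (k · a , ·-closed k a∈)
  scale k nil            = nil
  scale k (f ◂ g)        = scale k f ◂ scale k g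

  -- For g = Σ gᵢ X₀ⁱ this is Σ (k + i) gᵢ X₀ⁱ, so weight 1 gives the derivative of X₀ g. Working
  -- coefficient by coefficient lets the vanishing of a derivative be read off as a condition on
  -- each coefficient.
  weighted : ℕ → Poly (suc n) → Poly (suc n)
  weighted k nil     = nil
  weighted k (f ◂ g) = scale k f ◂ weighted (suc k) g

  D : Fin n → Poly n → Poly n
  D zero    nil     = nil
  D zero    (f ◂ g) = weighted 1 g
  D (suc i) nil     = nil
  D (suc i) (f ◂ g) = D i f ◂ D (suc i) g

  ev-scale : ∀ k (f : Poly n) ρ → ev (scale k f) ρ ≈ k · ev f ρ
  ev-scale k (con a) ρ = refl
  ev-scale zero    nil ρ = refl
  ev-scale (suc k) nil ρ = trans (ev-scale k nil ρ) (sym (+-identityˡ _))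
  ev-scale k (f ◂ g) ρ = begin
    ev (scale k f) (ρ ∘ suc) + ρ zero * ev (scale k g) ρ
      ≈⟨ +-cong (ev-scale k f _) (*-congˡ (ev-scale k g ρ)) ⟩
    k · ev f (ρ ∘ suc) + ρ zero * (k · ev g ρ)
      ≈⟨ +-congˡ (·-comm-* k _ _) ⟩
    k · ev f (ρ ∘ suc) + k · (ρ zero * ev g ρ)
      ≈⟨ ·-distrib k (ev f (ρ ∘ suc)) (ρ zero * ev g ρ) ⟨
    k · (ev f (ρ ∘ suc) + ρ zero * ev g ρ) ∎
    where
    ·-distrib : ∀ k x y → k · (x + y) ≈ k · x + k · y
    ·-distrib zero    x y = sym (+-identityˡ 0#)
    ·-distrib (suc k) x y = trans (+-congˡ (·-distrib k x y))
      (solve 4 (λ x y u v → (x ⊕ y) ⊕ (u ⊕ v) ⊜ (x ⊕ u) ⊕ (y ⊕ v)) refl x y (k · x) (k · y))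

  -- On g, weighting acts as the operator k + X₀ ∂/∂X₀.
  ev-weighted : ∀ k (g : Poly (suc n)) ρ → ev (weighted k g) ρ ≈ k · ev g ρ + ρ zero * ev (D zero g) ρ
  ev-weighted k nil ρ = trans (sym (zeroʳ _)) (trans (sym (+-identityˡ _)) (+-congʳ (sym (k·0 k))))
    where
    k·0 : ∀ k → k · 0# ≈ 0#
    k·0 zero    = refl
    k·0 (suc k) = trans (+-identityˡ _) (k·0 k)
  ev-weighted k (f ◂ g) ρ = begin
    ev (scale k f) (ρ ∘ suc) + ρ zero * ev (weighted (suc k) g) ρ
      ≈⟨ +-cong (ev-scale k f _) (*-congˡ (ev-weighted (suc k) g ρ)) ⟩
    k · ev f (ρ ∘ suc) + ρ zero * ((ev g ρ + k · ev g ρ) + ρ zero * ev (D zero g) ρ)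
      -- The solver has no notion of a variable multiple k · x; written as (k · 1#) * x, it has the
      -- variable k · 1#.
      ≈⟨ +-congˡ (*-congˡ (+-congʳ (+-congˡ (k·≈ k (ev g ρ))))) ⟩
    k · ev f (ρ ∘ suc) + ρ zero * ((ev g ρ + (k · 1#) * ev g ρ) + ρ zero * ev (D zero g) ρ)
      ≈⟨ +-congʳ (k·≈ k (ev f (ρ ∘ suc))) ⟩
    (k · 1#) * ev f (ρ ∘ suc) + ρ zero * ((ev g ρ + (k · 1#) * ev g ρ) + ρ zero * ev (D zero g) ρ)
      ≈⟨ solve 5 (λ k f x g d → k ⊗ f ⊕ x ⊗ ((g ⊕ k ⊗ g) ⊕ x ⊗ d) ⊜ k ⊗ (f ⊕ x ⊗ g) ⊕ x ⊗ ((κ (ℤ.+ 1) ⊗ g) ⊕ x ⊗ d)) refl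
           (k · 1#) (ev f (ρ ∘ suc)) (ρ zero) (ev g ρ) (ev (D zero g) ρ) ⟩
    (k · 1#) * ev (f ◂ g) ρ + ρ zero * ((1# * ev g ρ) + ρ zero * ev (D zero g) ρ)
      ≈⟨ +-cong (sym (k·≈ k (ev (f ◂ g) ρ)))
           (*-congˡ (trans (+-congʳ (trans (*-identityˡ _) (sym (+-identityʳ _)))) (sym (ev-weighted 1 g ρ)))) ⟩
    k · ev (f ◂ g) ρ + ρ zero * ev (D zero (f ◂ g)) ρ ∎
    where
    k·≈ : ∀ k x → k · x ≈ (k · 1#) * x
    k·≈ k x = trans (·-congʳ k (sym (*-identityˡ x))) (sym (·-assoc-* k 1# x))

  ev-D◂ : ∀ (f : Poly n) g ρ → ev (D zero (f ◂ g)) ρ ≈ ev g ρ + ρ zero * ev (D zero g) ρ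
  ev-D◂ f g ρ = trans (ev-weighted 1 g ρ) (+-congʳ (+-identityʳ _))

  D-+ : ∀ (f g : Poly (suc n)) ρ → ev (D zero (f +ₚ g)) ρ ≈ ev (D zero f) ρ + ev (D zero g) ρ
  D-+ nil     g       ρ = sym (+-identityˡ _)
  D-+ (a ◂ f) nil     ρ = sym (+-identityʳ _)
  D-+ (a ◂ f) (b ◂ g) ρ = begin
    ev (D zero ((a +ₚ b) ◂ (f +ₚ g))) ρ
      ≈⟨ ev-D◂ (a +ₚ b) (f +ₚ g) ρ ⟩
    ev (f +ₚ g) ρ + ρ zero * ev (D zero (f +ₚ g)) ρ
      ≈⟨ +-cong (ev-+ f g ρ) (*-congˡ (D-+ f g ρ)) ⟩
    (ev f ρ + ev g ρ) + ρ zero * (ev (D zero f) ρ + ev (D zero g) ρ)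
      ≈⟨ solve 5 (λ f g x f′ g′ → (f ⊕ g) ⊕ x ⊗ (f′ ⊕ g′) ⊜ (f ⊕ x ⊗ f′) ⊕ (g ⊕ x ⊗ g′)) refl
           (ev f ρ) (ev g ρ) (ρ zero) (ev (D zero f) ρ) (ev (D zero g) ρ) ⟩
    (ev f ρ + ρ zero * ev (D zero f) ρ) + (ev g ρ + ρ zero * ev (D zero g) ρ)
      ≈⟨ +-cong (ev-D◂ a f ρ) (ev-D◂ b g ρ) ⟨
    ev (D zero (a ◂ f)) ρ + ev (D zero (b ◂ g)) ρ ∎

  D-neg : ∀ (f : Poly (suc n)) ρ → ev (D zero (-ₚ f)) ρ ≈ - ev (D zero f) ρ
  D-neg nil     ρ = sym -0#≈0#
  D-neg (a ◂ f) ρ = begin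
    ev (D zero (-ₚ a ◂ -ₚ f)) ρ
      ≈⟨ ev-D◂ (-ₚ a) (-ₚ f) ρ ⟩
    ev (-ₚ f) ρ + ρ zero * ev (D zero (-ₚ f)) ρ
      ≈⟨ +-cong (ev-neg f ρ) (*-congˡ (D-neg f ρ)) ⟩
    - ev f ρ + ρ zero * - ev (D zero f) ρ
      ≈⟨ solve 3 (λ f x f′ → ⊝ f ⊕ x ⊗ (⊝ f′) ⊜ ⊝ (f ⊕ x ⊗ f′)) refl (ev f ρ) (ρ zero) (ev (D zero f) ρ) ⟩
    - (ev f ρ + ρ zero * ev (D zero f) ρ)
      ≈⟨ -‿cong (ev-D◂ a f ρ) ⟨
    - ev (D zero (a ◂ f)) ρ ∎

  D-• : ∀ (a : Poly n) g ρ → ev (D zero (a • g)) ρ ≈ ev a (ρ ∘ suc) * ev (D zero g) ρ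
  D-• a nil     ρ = sym (zeroʳ _)
  D-• a (b ◂ g) ρ = begin
    ev (D zero ((a *ₚ b) ◂ a • g)) ρ
      ≈⟨ ev-D◂ (a *ₚ b) (a • g) ρ ⟩
    ev (a • g) ρ + ρ zero * ev (D zero (a • g)) ρ
      ≈⟨ +-cong (ev-• a g ρ) (*-congˡ (D-• a g ρ)) ⟩
    ev a (ρ ∘ suc) * ev g ρ + ρ zero * (ev a (ρ ∘ suc) * ev (D zero g) ρ)
      ≈⟨ solve 4 (λ a g x g′ → a ⊗ g ⊕ x ⊗ (a ⊗ g′) ⊜ a ⊗ (g ⊕ x ⊗ g′)) refl
           (ev a (ρ ∘ suc)) (ev g ρ) (ρ zero) (ev (D zero g) ρ) ⟩
    ev a (ρ ∘ suc) * (ev g ρ + ρ zero * ev (D zero g) ρ)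
      ≈⟨ *-congˡ (ev-D◂ b g ρ) ⟨
    ev a (ρ ∘ suc) * ev (D zero (b ◂ g)) ρ ∎

  D-* : ∀ (f g : Poly (suc n)) ρ →
        ev (D zero (f *ₚ g)) ρ ≈ ev (D zero f) ρ * ev g ρ + ev f ρ * ev (D zero g) ρ
  D-* nil     g ρ = solve 2 (λ g g′ → κ (ℤ.+ 0) ⊜ κ (ℤ.+ 0) ⊗ g ⊕ κ (ℤ.+ 0) ⊗ g′) refl (ev g ρ) (ev (D zero g) ρ)
  D-* (a ◂ f) g ρ = begin
    ev (D zero (a • g +ₚ (0ₚ ◂ f *ₚ g))) ρ
      ≈⟨ D-+ (a • g) (0ₚ ◂ f *ₚ g) ρ ⟩
    ev (D zero (a • g)) ρ + ev (D zero (0ₚ ◂ f *ₚ g)) ρ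
      ≈⟨ +-cong (D-• a g ρ) (trans (ev-D◂ 0ₚ (f *ₚ g) ρ) (+-cong (ev-* f g ρ) (*-congˡ (D-* f g ρ)))) ⟩
    A * G′ + (F * G + x * (F′ * G + F * G′))
      ≈⟨ solve 6 (λ A x F F′ G G′ →
           A ⊗ G′ ⊕ (F ⊗ G ⊕ x ⊗ (F′ ⊗ G ⊕ F ⊗ G′)) ⊜ (F ⊕ x ⊗ F′) ⊗ G ⊕ (A ⊕ x ⊗ F) ⊗ G′) refl A x F F′ G G′ ⟩
    (F + x * F′) * G + (A + x * F) * G′
      ≈⟨ +-congʳ (*-congʳ (ev-D◂ a f ρ)) ⟨
    ev (D zero (a ◂ f)) ρ * G + (A + x * F) * G′ ∎
    where
    A = ev a (ρ ∘ suc)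
    x = ρ zero
    F = ev f ρ
    F′ = ev (D zero f) ρ
    G = ev g ρ
    G′ = ev (D zero g) ρ

  -- The target is any type with a sum and a product, since two are needed: `Poly m` for renaming
  -- variables and `Term Carrier m` for passing to the polynomials of the Implicit Function Theorem.
  -- Evaluation and the chain rule are then proved once for both.
  module Substitution {a} {A : Set a} (_+ᴬ_ _*ᴬ_ : A → A → A) (0ᴬ : A) (ι : Coefficient → A) where

    subst : (Fin n → A) → Poly n → A
    subst σ (con a) = ι a
    subst σ nil     = 0ᴬ
    subst σ (f ◂ g) = subst (σ ∘ suc) f +ᴬ (σ zero *ᴬ subst σ g)

    module Evaluation (h : A → Carrier)
      (h-+ : ∀ x y → h (x +ᴬ y) ≈ h x + h y) (h-* : ∀ x y → h (x *ᴬ y) ≈ h x * h y)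
      (h-0 : h 0ᴬ ≈ 0#) (h-ι : ∀ a → h (ι a) ≈ proj₁ a) where

      ev-subst : ∀ (f : Poly n) σ → h (subst σ f) ≈ ev f (h ∘ σ)
      ev-subst (con a) σ = h-ι a
      ev-subst nil     σ = h-0
      ev-subst (f ◂ g) σ = trans (h-+ _ _)
        (+-cong (ev-subst f (σ ∘ suc)) (trans (h-* _ _) (*-congˡ (ev-subst g σ))))

      module Derivation (d : A → Carrier)
        (d-+ : ∀ x y → d (x +ᴬ y) ≈ d x + d y) (d-* : ∀ x y → d (x *ᴬ y) ≈ d x * h y + h x * d y)
        (d-0 : d 0ᴬ ≈ 0#) (d-ι : ∀ a → d (ι a) ≈ 0#) where

        d-subst-0 : ∀ (f : Poly n) σ → (∀ i → d (σ i) ≈ 0#) → d (subst σ f) ≈ 0#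
        d-subst-0 (con a) σ dσ = d-ι a
        d-subst-0 nil     σ dσ = d-0
        d-subst-0 (f ◂ g) σ dσ = begin
          d (subst (σ ∘ suc) f +ᴬ (σ zero *ᴬ subst σ g))
            ≈⟨ trans (d-+ _ _) (+-cong (d-subst-0 f (σ ∘ suc) (dσ ∘ suc)) (d-* _ _)) ⟩
          0# + (d (σ zero) * h (subst σ g) + h (σ zero) * d (subst σ g))
            ≈⟨ +-congˡ (+-cong (*-congʳ (dσ zero)) (*-congˡ (d-subst-0 g σ dσ))) ⟩
          0# + (0# * h (subst σ g) + h (σ zero) * 0#)
            ≈⟨ solve 2 (λ x y → κ (ℤ.+ 0) ⊕ (κ (ℤ.+ 0) ⊗ x ⊕ y ⊗ κ (ℤ.+ 0)) ⊜ κ (ℤ.+ 0)) refl _ _ ⟩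
          0# ∎

        -- The chain rule, for images whose derivatives are 1 at i and 0 elsewhere: only the i-th
        -- partial derivative survives.
        d-subst : ∀ (f : Poly n) σ i → d (σ i) ≈ 1# → (∀ j → j ≢ i → d (σ j) ≈ 0#) →
                  d (subst σ f) ≈ ev (D i f) (h ∘ σ)
        d-subst nil σ zero    dσᵢ dσⱼ = d-0
        d-subst nil σ (suc i) dσᵢ dσⱼ = d-0
        d-subst (f ◂ g) σ zero dσᵢ dσⱼ = begin
          d (subst (σ ∘ suc) f +ᴬ (σ zero *ᴬ subst σ g))
            ≈⟨ trans (d-+ _ _) (+-cong (d-subst-0 f (σ ∘ suc) (λ j → dσⱼ (suc j) λ ())) (d-* _ _)) ⟩
          0# + (d (σ zero) * h (subst σ g) + h (σ zero) * d (subst σ g))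
            ≈⟨ +-congˡ (+-cong (*-cong dσᵢ (ev-subst g σ)) (*-congˡ (d-subst g σ zero dσᵢ dσⱼ))) ⟩
          0# + (1# * ev g (h ∘ σ) + h (σ zero) * ev (D zero g) (h ∘ σ))
            ≈⟨ trans (+-identityˡ _) (+-congʳ (*-identityˡ _)) ⟩
          ev g (h ∘ σ) + h (σ zero) * ev (D zero g) (h ∘ σ)
            ≈⟨ ev-D◂ f g (h ∘ σ) ⟨
          ev (D zero (f ◂ g)) (h ∘ σ) ∎
        d-subst (f ◂ g) σ (suc i) dσᵢ dσⱼ = begin
          d (subst (σ ∘ suc) f +ᴬ (σ zero *ᴬ subst σ g))
            ≈⟨ trans (d-+ _ _) (+-cong (d-subst f (σ ∘ suc) i dσᵢ (λ j j≢i → dσⱼ (suc j) λ { ≡.refl → j≢i ≡.refl })) (d-* _ _)) ⟩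
          ev (D i f) (h ∘ σ ∘ suc) + (d (σ zero) * h (subst σ g) + h (σ zero) * d (subst σ g))
            ≈⟨ +-congˡ (+-cong (*-congʳ (dσⱼ zero λ ())) (*-congˡ (d-subst g σ (suc i) dσᵢ dσⱼ))) ⟩
          ev (D i f) (h ∘ σ ∘ suc) + (0# * h (subst σ g) + h (σ zero) * ev (D (suc i) g) (h ∘ σ))
            ≈⟨ +-congˡ (trans (+-congʳ (zeroˡ _)) (+-identityˡ _)) ⟩
          ev (D i f) (h ∘ σ ∘ suc) + h (σ zero) * ev (D (suc i) g) (h ∘ σ) ∎

  rename : (Fin n → Fin m) → Poly n → Poly m
  rename σ = Substitution.subst _+ₚ_ _*ₚ_ 0ₚ constant (variable′ ∘ σ)

  module _ (ρ : Vector Carrier m) where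
    open Substitution.Evaluation _+ₚ_ _*ₚ_ 0ₚ constant (λ f → ev f ρ)
      (λ f g → ev-+ f g ρ) (λ f g → ev-* f g ρ) (ev-0 ρ) (λ a → ev-constant a ρ)

    ev-rename : ∀ (σ : Fin n → Fin m) f → ev (rename σ f) ρ ≈ ev f (ρ ∘ σ)
    ev-rename σ f = trans (ev-subst f (variable′ ∘ σ)) (ev-cong f (λ i → ev-variable (σ i) ρ))

  module _ (ρ : Vector Carrier (suc m)) where
    open Substitution.Evaluation _+ₚ_ _*ₚ_ 0ₚ constant (λ f → ev f ρ)
      (λ f g → ev-+ f g ρ) (λ f g → ev-* f g ρ) (ev-0 ρ) (λ a → ev-constant a ρ)
    open Derivation (λ f → ev (D zero f) ρ) (λ f g → D-+ f g ρ) (λ f g → D-* f g ρ) refl (λ a → refl)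

    -- The sum and product rules above are stated for the front variable; derivatives by another
    -- variable are reduced to it by moving that variable to the front.
    D-rename : ∀ (σ : Fin n → Fin (suc m)) i → σ i ≡ zero → (∀ j → j ≢ i → ∃ λ k → σ j ≡ suc k) → ∀ f →
               ev (D zero (rename σ f)) ρ ≈ ev (D i f) (ρ ∘ σ)
    D-rename σ i σᵢ σⱼ f = trans
      (d-subst f (variable′ ∘ σ) i (D-zero σᵢ) (λ j j≢i → D-suc (proj₂ (σⱼ j j≢i))))
      (ev-cong (D i f) (λ i → ev-variable (σ i) ρ))
      where
      D-zero : ∀ {j} → j ≡ zero → ev (D zero (variable′ j)) ρ ≈ 1#
      D-zero ≡.refl = trans (ev-D◂ 0ₚ (1ₚ ◂ nil) ρ)
        (trans (+-cong (ev-1 ρ) (zeroʳ _)) (+-identityʳ _))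
      D-suc : ∀ {j k} → j ≡ suc k → ev (D zero (variable′ j)) ρ ≈ 0#
      D-suc ≡.refl = refl

  toTerm : (Fin n → Fin m) → Poly n → Term Carrier m
  toTerm σ = Substitution.subst _:+_ _:*_ :0 (par ∘ proj₁) (var ∘ σ)

  module _ (ρ : Vector Carrier m) where
    open Substitution.Evaluation _:+_ _:*_ :0 (par ∘ proj₁) (λ t → evalPoly K t ρ)
      (λ _ _ → refl) (λ _ _ → refl) refl (λ _ → refl)

    eval-toTerm : ∀ (σ : Fin n → Fin m) f → evalPoly K (toTerm σ f) ρ ≈ ev f (ρ ∘ σ)
    eval-toTerm σ f = ev-subst f (var ∘ σ)

  module _ (ρ : Vector Carrier (suc m)) where
    open Substitution.Evaluation _:+_ _:*_ :0 (par ∘ proj₁) (λ t → evalPoly K t ρ)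
      (λ _ _ → refl) (λ _ _ → refl) refl (λ _ → refl)
    open Derivation (λ t → evalPoly K (∂ zero t) ρ) (λ _ _ → refl) (λ _ _ → refl) refl (λ _ → refl)

    ∂-toTerm : ∀ (f : Poly (suc m)) → evalPoly K (∂ zero (toTerm (λ i → i) f)) ρ ≈ ev (D zero f) ρ
    ∂-toTerm f = d-subst f var zero refl λ { zero 0≢0 → contradiction ≡.refl 0≢0 ; (suc j) _ → refl }

    ∂-toTerm-0 : ∀ (f : Poly n) (σ : Fin n → Fin m) → evalPoly K (∂ zero (toTerm (suc ∘ σ) f)) ρ ≈ 0#
    ∂-toTerm-0 f σ = d-subst-0 f (var ∘ suc ∘ σ) (λ _ → refl)

  fromTerm : ∀ {p} {P : Set p} → (P → Coefficient) → Term P n → Poly n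
  fromTerm c :0       = 0ₚ
  fromTerm c :1       = 1ₚ
  fromTerm c (par a)  = constant (c a)
  fromTerm c (var i)  = variable′ i
  fromTerm c (t :+ u) = fromTerm c t +ₚ fromTerm c u
  fromTerm c (t :* u) = fromTerm c t *ₚ fromTerm c u
  fromTerm c (:- t)   = -ₚ fromTerm c t

  ev-fromTerm : ∀ {p} {P : Set p} (c : P → Coefficient) (t : Term P n) ρ →
                ev (fromTerm c t) ρ ≈ evalTerm K (proj₁ ∘ c) t ρ
  ev-fromTerm c :0       ρ = ev-0 ρ
  ev-fromTerm c :1       ρ = ev-1 ρ
  ev-fromTerm c (par a)  ρ = ev-constant _ ρ
  ev-fromTerm c (var i)  ρ = ev-variable i ρ
  ev-fromTerm c (t :+ u) ρ = trans (ev-+ (fromTerm c t) _ ρ) (+-cong (ev-fromTerm c t ρ) (ev-fromTerm c u ρ))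
  ev-fromTerm c (t :* u) ρ = trans (ev-* (fromTerm c t) _ ρ) (*-cong (ev-fromTerm c t ρ) (ev-fromTerm c u ρ))
  ev-fromTerm c (:- t)   ρ = trans (ev-neg (fromTerm c t) ρ) (-‿cong (ev-fromTerm c t ρ))

  Zero : Poly n → Set ℓ
  Zero (con (a , _)) = a ≈ 0#
  Zero nil           = ⊤
  Zero (f ◂ g)       = Zero f × Zero g

  ev-Zero : ∀ (f : Poly n) → Zero f → ∀ ρ → ev f ρ ≈ 0#
  ev-Zero (con a) a≈0         ρ = a≈0
  ev-Zero nil     _           ρ = refl
  ev-Zero (f ◂ g) (f≈0 , g≈0) ρ =
    trans (+-cong (ev-Zero f f≈0 _) (trans (*-congˡ (ev-Zero g g≈0 ρ)) (zeroʳ _))) (+-identityˡ 0#)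

  -- After specialisation of the other variables to ρ, f becomes the zero polynomial in X₀. This is
  -- weaker than `Zero f`, which concerns the coefficients in E.
  CoefficientsVanish : Poly (suc n) → Vector Carrier n → Set ℓ
  CoefficientsVanish nil     ρ = ⊤
  CoefficientsVanish (f ◂ g) ρ = ev f ρ ≈ 0# × CoefficientsVanish g ρ

  vanish⇒D≈0 : ∀ (f : Poly (suc n)) ρ → CoefficientsVanish f (ρ ∘ suc) → ev f ρ ≈ 0# × ev (D zero f) ρ ≈ 0#
  vanish⇒D≈0 nil     ρ _ = refl , refl
  vanish⇒D≈0 (f ◂ g) ρ (f≈0 , g≈0) with vanish⇒D≈0 g ρ g≈0
  ... | ev≈0 , D≈0 =
      trans (+-cong f≈0 (trans (*-congˡ ev≈0) (zeroʳ _))) (+-identityˡ 0#)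
    , trans (ev-D◂ f g ρ) (trans (+-cong ev≈0 (trans (*-congˡ D≈0) (zeroʳ _))) (+-identityˡ 0#))

  toPoly : Vector (Poly n) m → Poly (suc n)
  toPoly {m = zero}  a = nil
  toPoly {m = suc m} a = a zero ◂ toPoly (a ∘ suc)

  ev-toPoly : ∀ (a : Vector (Poly n) m) ρ → ev (toPoly a) ρ ≈ powerSum (λ i → ev (a i) (ρ ∘ suc)) (ρ zero)
  ev-toPoly {m = zero}  a ρ = refl
  ev-toPoly {m = suc m} a ρ = trans (+-congˡ (*-congˡ (ev-toPoly (a ∘ suc) ρ)))
    (sym (powerSum-suc (λ i → ev (a i) (ρ ∘ suc)) (ρ zero)))

  toPoly-vanish : ∀ (a : Vector (Poly n) m) ρ → (∀ i → ev (a i) ρ ≈ 0#) → CoefficientsVanish (toPoly a) ρ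
  toPoly-vanish {m = zero}  a ρ p = tt
  toPoly-vanish {m = suc m} a ρ p = p zero , toPoly-vanish (a ∘ suc) ρ (p ∘ suc)

  length : Poly (suc n) → ℕ
  length nil     = 0
  length (f ◂ g) = suc (length g)

  coefficient : (f : Poly (suc n)) → Vector (Poly n) (length f)
  coefficient (f ◂ g) zero    = f
  coefficient (f ◂ g) (suc i) = coefficient g i

  ev-coefficient : ∀ (f : Poly (suc n)) ρ → ev f ρ ≈ powerSum (λ i → ev (coefficient f i) (ρ ∘ suc)) (ρ zero)
  ev-coefficient nil     ρ = refl
  ev-coefficient (f ◂ g) ρ = trans (+-congˡ (*-congˡ (ev-coefficient g ρ)))
    (sym (powerSum-suc (λ i → ev (coefficient (f ◂ g) i) (ρ ∘ suc)) (ρ zero)))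

  coefficient-vanish : ∀ (f : Poly (suc n)) ρ → (∀ i → ev (coefficient f i) ρ ≈ 0#) → CoefficientsVanish f ρ
  coefficient-vanish nil     ρ p = tt
  coefficient-vanish (f ◂ g) ρ p = p zero , coefficient-vanish g ρ (p ∘ suc)

-- Polynomials vanishing on infinite sets; transitivity of algebraicity

module Vanishing (em : ∀ {a} → ExcludedMiddle a) {c ℓ} (K : Field c ℓ)
                 {E : Pred (Field.Carrier K) (c ⊔ ℓ)} (isSubfield : IsSubfield K E) where
  open FieldProperties em K
  open Classical em
  open Polynomials em K isSubfield
  open IsSubfield isSubfield hiding (resp)

  private
    s : Level
    s = c ⊔ ℓ
    variable
      m n : ℕ

  Infinite : Pred Carrier s → Set s
  Infinite S = ∀ xs → ∃ λ y → y ∈ S × (∀ x → x ∈ₚ xs → y ≉ x)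

  private
    -- Synthetic division by X - r: the coefficients of the quotient are the values at r of the
    -- successive tails of a, as in Horner's scheme.
    quotient : Carrier → Vector Carrier (suc n) → Vector Carrier n
    quotient {suc n} r a zero    = powerSum (a ∘ suc) r
    quotient {suc n} r a (suc i) = quotient r (a ∘ suc) i

    quotient-correct : ∀ r (a : Vector Carrier (suc n)) y →
                       powerSum a y ≈ powerSum a r + (y - r) * powerSum (quotient r a) y
    quotient-correct {zero} r a y =
      solve 3 (λ a y r → a ⊕ κ (ℤ.+ 0) ⊜ a ⊕ κ (ℤ.+ 0) ⊕ (y ⊖ r) ⊗ κ (ℤ.+ 0)) refl (a zero * 1#) y r
    quotient-correct {suc n} r a y = begin
      powerSum a y
        ≈⟨ powerSum-suc a y ⟩
      a zero + y * powerSum (a ∘ suc) y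
        ≈⟨ +-congˡ (*-congˡ (quotient-correct r (a ∘ suc) y)) ⟩
      a zero + y * (P + (y - r) * Q)
        ≈⟨ solve 5 (λ a y r P Q → a ⊕ y ⊗ (P ⊕ (y ⊖ r) ⊗ Q) ⊜ (a ⊕ r ⊗ P) ⊕ (y ⊖ r) ⊗ (P ⊕ y ⊗ Q)) refl (a zero) y r P Q ⟩
      (a zero + r * P) + (y - r) * (P + y * Q)
        ≈⟨ +-cong (powerSum-suc a r) (*-congˡ (powerSum-suc (quotient r a) y)) ⟨
      powerSum a r + (y - r) * powerSum (quotient r a) y ∎
      where
      P = powerSum (a ∘ suc) r
      Q = powerSum (quotient r (a ∘ suc)) y

    quotient≈0 : ∀ r (a : Vector Carrier (suc n)) → powerSum a r ≈ 0# → (∀ i → quotient r a i ≈ 0#) → ∀ i → a i ≈ 0#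
    quotient≈0 {zero} r a root q≈0 zero = trans (sym (trans (+-identityʳ _) (*-identityʳ _))) root
    quotient≈0 {suc n} r a root q≈0 zero = begin
      a zero                            ≈⟨ +-identityʳ _ ⟨
      a zero + 0#                       ≈⟨ +-congˡ (trans (*-congˡ (q≈0 zero)) (zeroʳ r)) ⟨
      a zero + r * powerSum (a ∘ suc) r ≈⟨ powerSum-suc a r ⟨
      powerSum a r                      ≈⟨ root ⟩
      0#                                ∎
    quotient≈0 {suc n} r a root q≈0 (suc i) = quotient≈0 r (a ∘ suc) (q≈0 zero) (q≈0 ∘ suc) i

  -- A root r in S is divided off; the quotient vanishes on S without r, which is still infinite,
  -- and has one coefficient less.
  powerSum-vanish : ∀ {S} → Infinite S → (a : Vector Carrier n) → (∀ y → y ∈ S → powerSum a y ≈ 0#) → ∀ i → a i ≈ 0#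
  powerSum-vanish {suc n} {S} infinite a a≈0 = quotient≈0 r a (a≈0 r r∈S)
    (powerSum-vanish {n} {λ y → y ∈ S × y ≉ r} S∖r-infinite (quotient r a) λ y (y∈S , y≉r) →
      *-cancel-0 (λ y-r≈0 → y≉r (-≈0⇒≈ y-r≈0)) (begin
        (y - r) * powerSum (quotient r a) y                    ≈⟨ +-identityˡ _ ⟨
        0# + (y - r) * powerSum (quotient r a) y               ≈⟨ +-congʳ (a≈0 r r∈S) ⟨
        powerSum a r + (y - r) * powerSum (quotient r a) y     ≈⟨ quotient-correct r a y ⟨
        powerSum a y                                           ≈⟨ a≈0 y y∈S ⟩
        0#                                                     ∎))
    where
    r = proj₁ (infinite [])
    r∈S = proj₁ (proj₂ (infinite []))
    S∖r-infinite : Infinite (λ y → y ∈ S × y ≉ r)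
    S∖r-infinite xs with infinite (r ∷ xs)
    ... | y , y∈S , y≉ = y , (y∈S , y≉ r (here ≡.refl)) , λ x x∈ → y≉ x (there x∈)

  coefficients-vanish : ∀ {S} → Infinite S → ∀ (f : Poly (suc n)) ρ → (∀ y → y ∈ S → ev f (y Vec.∷ ρ) ≈ 0#) →
                        ∀ i → ev (coefficient f i) ρ ≈ 0#
  coefficients-vanish infinite f ρ f≈0 = powerSum-vanish infinite (λ i → ev (coefficient f i) ρ)
    λ y y∈S → trans (sym (ev-coefficient f (y Vec.∷ ρ))) (f≈0 y y∈S)

  coefficients-Zero : (f : Poly (suc n)) → (∀ i → Zero (coefficient f i)) → Zero f
  coefficients-Zero nil     p = tt
  coefficients-Zero (f ◂ g) p = p zero , coefficients-Zero g (p ∘ suc)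

  Box : (Fin n → Pred Carrier s) → Pred (Vector Carrier n) s
  Box N ρ = ∀ i → ρ i ∈ N i

  box-∷ : ∀ (N : Fin (suc n) → Pred Carrier s) {y ρ} → y ∈ N zero → ρ ∈ Box (N ∘ suc) → (y Vec.∷ ρ) ∈ Box N
  box-∷ N y∈ ρ∈ zero    = y∈
  box-∷ N y∈ ρ∈ (suc i) = ρ∈ i

  vanish-on-box : ∀ {N : Fin n → Pred Carrier s} → (∀ i → Infinite (N i)) → (f : Poly n) →
                  (∀ ρ → ρ ∈ Box N → ev f ρ ≈ 0#) → Zero f
  vanish-on-box {zero} infinite (con a) f≈0 = f≈0 (λ ()) (λ ())
  vanish-on-box {suc n} {N} infinite f f≈0 = coefficients-Zero f λ i →
    vanish-on-box (infinite ∘ suc) (coefficient f i) λ ρ ρ∈ →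
      coefficients-vanish (infinite zero) f ρ (λ y y∈ → f≈0 (y Vec.∷ ρ) (box-∷ N y∈ ρ∈)) i

  coefficient-∈ : ∀ (f : Poly 0) ρ → ev f ρ ∈ E
  coefficient-∈ (con (a , a∈)) ρ = a∈

  -- The box variables are removed one at a time from the front, which is why x stands last. What is
  -- left are polynomials over E in one variable with root x, and a nonzero coefficient would make x
  -- algebraic.
  transcendental⇒Zero : ∀ {x} → ¬ AlgebraicOver E x →
    ∀ {N : Fin n → Pred Carrier s} → (∀ i → Infinite (N i)) → (f : Poly (suc n)) →
    (∀ ρ → ρ ∈ Box N → ev f (insertAt ρ (fromℕ n) x) ≈ 0#) → Zero f
  transcendental⇒Zero {zero} {x} ¬alg infinite f f≈0 = coefficients-Zero f λ i →
    vanish-on-box {N = λ ()} (λ ()) (coefficient f i) λ ρ _ → ¬¬-elim λ fᵢ≉0 →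
      ¬alg (_ , (λ i → ev (coefficient f i) ρ) , (λ i → coefficient-∈ (coefficient f i) ρ) , (i , fᵢ≉0)
           , trans (trans (powerSum-cong x (λ i → ev-cong (coefficient f i) λ ())) (sym (ev-coefficient f (insertAt ρ zero x))))
                   (f≈0 ρ (λ ())))
  transcendental⇒Zero {suc n} {x} ¬alg {N} infinite f f≈0 = coefficients-Zero f λ i →
    transcendental⇒Zero ¬alg (infinite ∘ suc) (coefficient f i) λ ρ ρ∈ →
      coefficients-vanish (infinite zero) f (insertAt ρ (fromℕ n) x)
        (λ y y∈ → trans (ev-cong f λ { zero → refl ; (suc i) → refl }) (f≈0 (y Vec.∷ ρ) (box-∷ N y∈ ρ∈))) i

  -- Identities between polynomials are proved here through their values. Over an infinite field the
  -- values determine the coefficients in X₀ at ρ, and hence the derivative.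
  D-respects-≈ : Infinite (λ _ → ⊤) → (f g : Poly (suc n)) (ρ : Vector Carrier n) →
                 (∀ y → ev f (y Vec.∷ ρ) ≈ ev g (y Vec.∷ ρ)) →
                 ∀ y → ev (D zero f) (y Vec.∷ ρ) ≈ ev (D zero g) (y Vec.∷ ρ)
  D-respects-≈ infinite f g ρ f≈g y = -≈0⇒≈ (begin
    ev (D zero f) (y Vec.∷ ρ) - ev (D zero g) (y Vec.∷ ρ)
      ≈⟨ trans (D-+ f (-ₚ g) _) (+-congˡ (D-neg g _)) ⟨
    ev (D zero (f +ₚ -ₚ g)) (y Vec.∷ ρ)
      ≈⟨ proj₂ (vanish⇒D≈0 (f +ₚ -ₚ g) (y Vec.∷ ρ) (coefficient-vanish (f +ₚ -ₚ g) ρ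
           (coefficients-vanish infinite (f +ₚ -ₚ g) ρ λ y _ →
             trans (trans (ev-+ f (-ₚ g) _) (+-cong (f≈g y) (ev-neg g _))) (-‿inverseʳ _)))) ⟩
    0# ∎)

  -- This is the ring E[ρ].
  Values : Vector Carrier n → Pred Carrier s
  Values ρ v = ∃ λ f → ev f ρ ≈ v

  Values-isSubring : ∀ (ρ : Vector Carrier n) → IsSubring (Values ρ)
  Values-isSubring ρ = record
    { R-0    = 0ₚ , ev-0 ρ
    ; R-1    = 1ₚ , ev-1 ρ
    ; R-+    = λ (f , p) (g , q) → f +ₚ g , trans (ev-+ f g ρ) (+-cong p q)
    ; R-*    = λ (f , p) (g , q) → f *ₚ g , trans (ev-* f g ρ) (*-cong p q)
    ; R-neg  = λ (f , p) → -ₚ f , trans (ev-neg f ρ) (-‿cong p)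
    }

  algebraic-⊆ : ∀ {r r′} {R : Pred Carrier r} {R′ : Pred Carrier r′} → (∀ {x} → R x → R′ x) →
                ∀ {x} → AlgebraicOver R x → AlgebraicOver R′ x
  algebraic-⊆ R⊆R′ (n , a , Ra , rest) = n , a , (λ i → R⊆R′ (Ra i)) , rest

  algebraic-trans : ∀ {θ} {ρ : Vector Carrier n} {x} → AlgebraicOver (Values ρ) θ →
                    AlgebraicOver (Values (θ Vec.∷ ρ)) x → AlgebraicOver (Values ρ) x
  algebraic-trans {θ = θ} {ρ} {x} algθ algx = adjoin-x (adjoin isSubring (1# ∷ []) 1∈1 (λ y∈ → span-* isSubring y∈) algθ)
    where
    open Algebraicity em K
    isSubring = Values-isSubring ρ
    1∈1 : Span isSubring (1# ∷ []) 1#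
    1∈1 = span-∈ isSubring (here ≡.refl)

    adjoin-x : _ → AlgebraicOver (Values ρ) x
    adjoin-x (V , 1∈V , _ , θ-stab) = conclude (adjoin isSubring V 1∈V Values⊆ algx)
      where
      ev-stab : ∀ f → Stabilizer isSubring V (ev f (θ Vec.∷ ρ))
      ev-stab nil     = span-* isSubring (IsSubring.R-0 isSubring)
      ev-stab (f ◂ g) = stabilizer-+ isSubring (span-* isSubring (f , refl))
                          (stabilizer-* isSubring θ-stab (ev-stab g))

      Values⊆ : ∀ {y} → Values (θ Vec.∷ ρ) y → Stabilizer isSubring V y
      Values⊆ (f , fθ≈y) v∈ = span-resp isSubring (*-congʳ fθ≈y) (ev-stab f v∈)

      conclude : _ → AlgebraicOver (Values ρ) x
      conclude (W , 1∈W , _ , x-stab) = stabilizer⇒algebraic isSubring 1∈W x-stab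

-- Frobenius and MacLane's criterion

[1+k]C≡[1+n]C : ∀ n k → suc k ℕ.* (suc n C suc k) ≡ suc n ℕ.* (n C k)
[1+k]C≡[1+n]C zero zero = ≡.refl
[1+k]C≡[1+n]C zero (suc k) = ℕ.*-zeroʳ (suc (suc k))
[1+k]C≡[1+n]C (suc n) zero = begin
  1 ℕ.* (suc (suc n) C 1)          ≡⟨ ≡.cong (1 ℕ.*_) (nCk+nC[k+1]≡[n+1]C[k+1] (suc n) 0) ⟨
  1 ℕ.* (1 ℕ.+ (suc n C 1))        ≡⟨ solve 1 (λ x → con 1 ⊗ (con 1 ⊕ x) ⊜ con 1 ⊕ con 1 ⊗ x) ≡.refl (suc n C 1) ⟩
  1 ℕ.+ 1 ℕ.* (suc n C 1)          ≡⟨ ≡.cong (1 ℕ.+_) ([1+k]C≡[1+n]C n 0) ⟩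
  1 ℕ.+ suc n ℕ.* 1                ≡⟨⟩
  suc (suc n) ℕ.* 1                ∎
  where open ≡.≡-Reasoning; open +-*-Solver using (solve; con) renaming (_:+_ to _⊕_; _:*_ to _⊗_; _:=_ to _⊜_)
[1+k]C≡[1+n]C (suc n) (suc k) = begin
  suc (suc k) ℕ.* (suc (suc n) C suc (suc k))
    ≡⟨ ≡.cong (suc (suc k) ℕ.*_) (nCk+nC[k+1]≡[n+1]C[k+1] (suc n) (suc k)) ⟨
  suc (suc k) ℕ.* ((suc n C suc k) ℕ.+ (suc n C suc (suc k)))
    ≡⟨ solve 3 (λ k x y → (con 1 ⊕ k) ⊗ (x ⊕ y) ⊜ x ⊕ (k ⊗ x ⊕ (con 1 ⊕ k) ⊗ y)) ≡.refl
         (suc k) (suc n C suc k) (suc n C suc (suc k)) ⟩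
  (suc n C suc k) ℕ.+ (suc k ℕ.* (suc n C suc k) ℕ.+ suc (suc k) ℕ.* (suc n C suc (suc k)))
    ≡⟨ ≡.cong ((suc n C suc k) ℕ.+_) (≡.cong₂ ℕ._+_ ([1+k]C≡[1+n]C n k) ([1+k]C≡[1+n]C n (suc k))) ⟩
  (suc n C suc k) ℕ.+ (suc n ℕ.* (n C k) ℕ.+ suc n ℕ.* (n C suc k))
    ≡⟨ ≡.cong ((suc n C suc k) ℕ.+_) (ℕ.*-distribˡ-+ (suc n) (n C k) (n C suc k)) ⟨
  (suc n C suc k) ℕ.+ suc n ℕ.* ((n C k) ℕ.+ (n C suc k))
    ≡⟨ ≡.cong (λ x → (suc n C suc k) ℕ.+ suc n ℕ.* x) (nCk+nC[k+1]≡[n+1]C[k+1] n k) ⟩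
  suc (suc n) ℕ.* (suc n C suc k) ∎
  where open ≡.≡-Reasoning; open +-*-Solver using (solve; con) renaming (_:+_ to _⊕_; _:*_ to _⊗_; _:=_ to _⊜_)

module Frobenius (em : ∀ {a} → ExcludedMiddle a) {c ℓ} (K : Field c ℓ)
                 (q : ℕ) (char : HasCharacteristic K (suc q)) where
  open FieldProperties em K
  open Classical em
  open import Algebra.Properties.Semiring.Mult semiring
    using (×1-homo-*; ×-congʳ; ×-assoc-*) renaming (_×_ to _·_)
  open Algebra.Properties.CommutativeSemiring.Exp commutativeSemiring using (^-distrib-*)
  open Algebra.Properties.CommutativeSemiring.Binomial commutativeSemiring using (theorem; binomialTerm; binomial)

  p : ℕ
  p = suc q

  p·1≈0 : p · 1# ≈ 0#
  p·1≈0 = Equivalence.from (char p) ∣-refl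

  ∤⇒≉0 : ∀ {n} → ¬ (p ∣ℕ n) → n · 1# ≉ 0#
  ∤⇒≉0 p∤n n≈0 = p∤n (Equivalence.to (char _) n≈0)

  q≢0 : q ≢ 0
  q≢0 ≡.refl = 1≉0 (trans (sym (+-identityʳ 1#)) p·1≈0)

  private
    -- In K, k + 1 times the binomial coefficient equals p times another one, which is 0; and k + 1
    -- is nonzero in K, being positive and less than p.
    C≈0 : ∀ k → k ℕ.< q → (p C suc k) · 1# ≈ 0#
    C≈0 k k<q = *-cancel-0 {suc k · 1#} (∤⇒≉0 λ p∣1+k → ℕ.<⇒≱ (ℕ.s≤s k<q) (∣⇒≤ p∣1+k)) (begin
      (suc k · 1#) * ((p C suc k) · 1#)  ≈⟨ ×1-homo-* (suc k) (p C suc k) ⟨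
      (suc k ℕ.* (p C suc k)) · 1#       ≡⟨ ≡.cong (_· 1#) ([1+k]C≡[1+n]C q k) ⟩
      (p ℕ.* (q C k)) · 1#               ≈⟨ ×1-homo-* p (q C k) ⟩
      (p · 1#) * ((q C k) · 1#)          ≈⟨ *-congʳ p·1≈0 ⟩
      0# * ((q C k) · 1#)                ≈⟨ zeroˡ _ ⟩
      0#                                 ∎)

    ·≈* : ∀ n x → n · x ≈ (n · 1#) * x
    ·≈* n x = trans (×-congʳ n (sym (*-identityˡ x))) (sym (×-assoc-* n 1# x))

  ^p-+ : ∀ x y → (x + y) ^ p ≈ x ^ p + y ^ p
  ^p-+ x y = begin
    (x + y) ^ p
      ≈⟨ theorem p x y ⟩
    t zero + sum (t ∘ suc)
      ≈⟨ +-congˡ (sum-init-last (t ∘ suc)) ⟩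
    t zero + (sum (init (t ∘ suc)) + t (fromℕ p))
      ≈⟨ +-cong first (+-cong (sum-≈0 middle) top) ⟩
    y ^ p + (0# + x ^ p)
      ≈⟨ solve 2 (λ x y → y ⊕ (κ (ℤ.+ 0) ⊕ x) ⊜ x ⊕ y) refl (x ^ p) (y ^ p) ⟩
    x ^ p + y ^ p ∎
    where
    t = binomialTerm x y p
    first : t zero ≈ y ^ p
    first = trans (+-identityʳ _) (*-identityˡ _)
    top : t (fromℕ p) ≈ x ^ p
    top = begin
      (p C toℕ (fromℕ p)) · (x ^ toℕ (fromℕ p) * y ^ (p ℕ.∸ toℕ (fromℕ p)))
        ≡⟨ ≡.cong (λ k → (p C k) · (x ^ k * y ^ (p ℕ.∸ k))) (toℕ-fromℕ p) ⟩
      (p C p) · (x ^ p * y ^ (p ℕ.∸ p))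
        ≡⟨ ≡.cong₂ (λ k l → k · (x ^ p * y ^ l)) (nCn≡1 p) (ℕ.n∸n≡0 p) ⟩
      1 · (x ^ p * 1#)
        ≈⟨ trans (+-identityʳ _) (*-identityʳ _) ⟩
      x ^ p ∎
    middle : ∀ i → t (suc (inject₁ i)) ≈ 0#
    middle i = begin
      t (suc (inject₁ i))
        ≈⟨ ·≈* (p C suc (toℕ (inject₁ i))) _ ⟩
      ((p C suc (toℕ (inject₁ i))) · 1#) * binomial x y p (suc (inject₁ i))
        ≈⟨ *-congʳ (C≈0 _ (≡.subst (ℕ._< q) (≡.sym (toℕ-inject₁ i)) (toℕ<n i))) ⟩
      0# * binomial x y p (suc (inject₁ i))
        ≈⟨ zeroˡ _ ⟩
      0# ∎

  0^p : 0# ^ p ≈ 0#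
  0^p = zeroˡ _

  1^n : ∀ n → 1# ^ n ≈ 1#
  1^n zero    = refl
  1^n (suc n) = trans (*-identityˡ _) (1^n n)

  ^p-neg : ∀ x → (- x) ^ p ≈ - (x ^ p)
  ^p-neg x = +≈0⇒≈- (trans (sym (^p-+ x (- x))) (trans (^-congˡ p (-‿inverseʳ x)) 0^p))

  ^-≈0 : ∀ n {x} → x ^ n ≈ 0# → x ≈ 0#
  ^-≈0 zero    1≈0  = contradiction 1≈0 1≉0
  ^-≈0 (suc n) {x} eq with dec (x ≈ 0#)
  ... | yes x≈0 = x≈0
  ... | no x≉0  = ^-≈0 n (*-cancel-0 x≉0 eq)

  ^p-injective : ∀ {x y} → x ^ p ≈ y ^ p → x ≈ y
  ^p-injective {x} {y} eq = -≈0⇒≈ (^-≈0 p (begin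
    (x - y) ^ p          ≈⟨ ^p-+ x (- y) ⟩
    x ^ p + (- y) ^ p    ≈⟨ +-congˡ (^p-neg y) ⟩
    x ^ p - y ^ p        ≈⟨ +-congʳ eq ⟩
    y ^ p - y ^ p        ≈⟨ -‿inverseʳ _ ⟩
    0#                   ∎))

  ^p-sum : ∀ {n} (x : Vector Carrier n) → sum x ^ p ≈ sum (λ i → x i ^ p)
  ^p-sum {zero}  x = 0^p
  ^p-sum {suc n} x = trans (^p-+ _ _) (+-congˡ (^p-sum (x ∘ suc)))

  -- K, embedded in itself by Frobenius, contains all p-th roots.
  frobenius : Overfield K
  frobenius = record
    { Ω = K
    ; ι = _^ p
    ; isRingMonomorphism = record
      { isRingHomomorphism = record
        { isSemiringHomomorphism = record
          { isNearSemiringHomomorphism = record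
            { +-isMonoidHomomorphism = record
              { isMagmaHomomorphism = record
                { isRelHomomorphism = record { cong = ^-congˡ p }
                ; homo = ^p-+ }
              ; ε-homo = 0^p }
            ; *-homo = λ x y → ^-distrib-* x y p }
          ; 1#-homo = 1^n p }
        ; -‿homo = ^p-neg }
      ; injective = ^p-injective }
    }

  -- In the overfield `frobenius`, the image of K is Kᵖ, that of E is Eᵖ, and every element of E is
  -- a p-th root of an element of Eᵖ. Since Frobenius is injective, independence of the k i over E
  -- is independence of the k i ^ p over Eᵖ, which linear disjointness extends to E.
  separable⇒independent : ∀ {E : Pred Carrier (c ⊔ ℓ)} → IsSeparableOver K p E →
    ∀ {n} (a k : Vector Carrier n) → (∀ i → a i ∈ E) →
    (∀ b → (∀ i → b i ∈ E) → sum (λ i → b i * k i) ≈ 0# → ∀ i → b i ≈ 0#) →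
    sum (λ i → a i * k i ^ p) ≈ 0# → ∀ i → a i ≈ 0#
  separable⇒independent {E} separable a k a∈E independent = 
    separable frobenius (λ x _ → x , refl) (λ i → k i ^ p) (λ i → k i , _ , refl) independentᵖ a
      (λ i → a i , a∈E i , refl)
    where
    independentᵖ : (b : Vector Carrier _) → (∀ i → b i ∈ Overfield.Image frobenius E) →
                   sum (λ i → b i * k i ^ p) ≈ 0# → ∀ i → b i ≈ 0#
    independentᵖ b b∈ eq i = begin
      b i                    ≈⟨ proj₂ (proj₂ (b∈ i)) ⟩
      proj₁ (b∈ i) ^ p       ≈⟨ ^-congˡ p (independent (proj₁ ∘ b∈) (λ i → proj₁ (proj₂ (b∈ i))) (^-≈0 p (begin
        sum (λ i → proj₁ (b∈ i) * k i) ^ p           ≈⟨ ^p-sum (λ i → proj₁ (b∈ i) * k i) ⟩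
        sum (λ i → (proj₁ (b∈ i) * k i) ^ p)         ≈⟨ sum-cong-≋ (λ i → trans (^-distrib-* (proj₁ (b∈ i)) (k i) p)
                                                                           (*-congʳ (sym (proj₂ (proj₂ (b∈ i)))))) ⟩
        sum (λ i → b i * k i ^ p)                    ≈⟨ eq ⟩
        0#                                           ∎)) i) ⟩
      0# ^ p                 ≈⟨ 0^p ⟩
      0#                     ∎

-- Algebraic independence from derivatives

module Independence (em : ∀ {a} → ExcludedMiddle a) {c ℓ} (K : Field c ℓ)
                    {E : Pred (Field.Carrier K) (c ⊔ ℓ)} (isSubfield : IsSubfield K E) where
  open FieldProperties em K
  open Classical em
  open Polynomials em K isSubfield
  open IsSubfield isSubfield hiding (resp)

  private variable
    m n : ℕ

  -- The total degree is less than e, not counting vanishing coefficients.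
  DegreeLT : ℕ → Poly n → Set ℓ
  DegreeLT zero    f       = Zero f
  DegreeLT (suc e) (con a) = ⊤
  DegreeLT (suc e) nil     = ⊤
  DegreeLT (suc e) (f ◂ g) = DegreeLT (suc e) f × DegreeLT e g

  degree-suc : ∀ e (f : Poly n) → DegreeLT e f → DegreeLT (suc e) f
  degree-suc e       (con a) p = tt
  degree-suc e       nil     p = tt
  degree-suc zero    (f ◂ g) (p , q) = degree-suc zero f p , q
  degree-suc (suc e) (f ◂ g) (p , q) = degree-suc (suc e) f p , degree-suc e g q

  degree-mono : ∀ {d e} → d ℕ.≤′ e → (f : Poly n) → DegreeLT d f → DegreeLT e f
  degree-mono (ℕ.≤′-reflexive ≡.refl) f p = p
  degree-mono {e = suc e} (ℕ.≤′-step d≤e) f p = degree-suc e f (degree-mono d≤e f p)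

  degree-bound : (f : Poly n) → ∃ λ e → DegreeLT (suc e) f
  degree-bound (con a) = 0 , tt
  degree-bound nil     = 0 , tt
  degree-bound (f ◂ g) =
    let d , p = degree-bound f
        e , q = degree-bound g
    in d ℕ.⊔ suc e , degree-mono (ℕ.≤⇒≤′ (ℕ.s≤s (ℕ.m≤m⊔n d (suc e)))) f p
                   , degree-mono (ℕ.≤⇒≤′ (ℕ.m≤n⊔m d (suc e))) g q

  nil-degree : ∀ e → DegreeLT {suc n} e nil
  nil-degree zero    = tt
  nil-degree (suc e) = tt

  degree-scale : ∀ e k (f : Poly n) → DegreeLT e f → DegreeLT e (scale k f)
  degree-scale zero    k (con a) a≈0 = trans (·-congʳ k a≈0) (k·0 k)
    where
    k·0 : ∀ k → k · 0# ≈ 0#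
    k·0 zero    = refl
    k·0 (suc k) = trans (+-identityˡ _) (k·0 k)
  degree-scale (suc e) k (con a) p = tt
  degree-scale e       k nil     p = nil-degree e
  degree-scale zero    k (f ◂ g) (p , q) = degree-scale zero k f p , degree-scale zero k g q
  degree-scale (suc e) k (f ◂ g) (p , q) = degree-scale (suc e) k f p , degree-scale e k g q

  degree-weighted : ∀ e k (f : Poly (suc n)) → DegreeLT e f → DegreeLT e (weighted k f)
  degree-weighted e       k nil     p = nil-degree e
  degree-weighted zero    k (f ◂ g) (p , q) = degree-scale zero k f p , degree-weighted zero (suc k) g q
  degree-weighted (suc e) k (f ◂ g) (p , q) = degree-scale (suc e) k f p , degree-weighted e (suc k) g q

  D-Zero : ∀ i (f : Poly n) → Zero f → Zero (D i f)
  D-Zero zero    nil     p = tt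
  D-Zero zero    (f ◂ g) (p , q) = degree-weighted zero 1 g q
  D-Zero (suc i) nil     p = tt
  D-Zero (suc i) (f ◂ g) (p , q) = D-Zero i f p , D-Zero (suc i) g q

  degree-D : ∀ e i (f : Poly n) → DegreeLT (suc e) f → DegreeLT e (D i f)
  degree-D e       zero    nil     p = nil-degree e
  degree-D e       zero    (f ◂ g) (p , q) = degree-weighted e 1 g q
  degree-D e       (suc i) nil     p = nil-degree e
  degree-D zero    (suc i) (f ◂ g) (p , q) = degree-D zero i f p , D-Zero (suc i) g q
  degree-D (suc e) (suc i) (f ◂ g) (p , q) = degree-D (suc e) i f p , degree-D e (suc i) g q

  unscale : ∀ {k} → k · 1# ≉ 0# → (f : Poly n) → Zero (scale k f) → Zero f
  unscale {k = k} k≉0 (con (a , _)) ka≈0 = *-cancel-0 k≉0 (begin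
    (k · 1#) * a   ≈⟨ ·-assoc-* k 1# a ⟩
    k · (1# * a)   ≈⟨ ·-congʳ k (*-identityˡ a) ⟩
    k · a          ≈⟨ ka≈0 ⟩
    0#             ∎)
  unscale k≉0 nil     p = tt
  unscale k≉0 (f ◂ g) (p , q) = unscale k≉0 f p , unscale k≉0 g q

  constant-Zero : ∀ (f : Poly n) ρ → DegreeLT 1 f → ev f ρ ≈ 0# → Zero f
  constant-Zero (con a) ρ p       a≈0 = a≈0
  constant-Zero nil     ρ p       _   = tt
  constant-Zero (f ◂ g) ρ (p , q) eq  = constant-Zero f (ρ ∘ suc) p (begin
    ev f (ρ ∘ suc)                        ≈⟨ +-identityʳ _ ⟨
    ev f (ρ ∘ suc) + 0#                   ≈⟨ +-congˡ (trans (*-congˡ (ev-Zero g q ρ)) (zeroʳ _)) ⟨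
    ev f (ρ ∘ suc) + ρ zero * ev g ρ      ≈⟨ eq ⟩
    0#                                    ∎) , q

  -- This is the case in which no coordinate of z is a simple root of a relation, so that no
  -- coordinate can be removed.
  DerivativeClosed : Vector Carrier n → Set (c ⊔ ℓ)
  DerivativeClosed z = ∀ f i → ev f z ≈ 0# → ev (D i f) z ≈ 0#

  module CharacteristicZero (char : HasCharacteristic K 0) where

    weighted-Zero : ∀ k (f : Poly (suc n)) → Zero (weighted (suc k) f) → Zero f
    weighted-Zero k nil     _ = tt
    weighted-Zero k (f ◂ g) (p , q) =
      unscale (λ 1+k≈0 → ℕ.1+n≢0 (0∣⇒≡0 (Equivalence.to (char (suc k)) 1+k≈0))) f p , weighted-Zero (suc k) g q

    D-Zero⇒constant : (f : Poly n) → (∀ i → Zero (D i f)) → DegreeLT 1 f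
    D-Zero⇒constant (con a) _ = tt
    D-Zero⇒constant nil     _ = tt
    D-Zero⇒constant (f ◂ g) p = D-Zero⇒constant f (λ i → proj₁ (p (suc i))) , weighted-Zero 0 g (p zero)

    -- By induction all derivatives of f are zero polynomials. In characteristic zero only the
    -- constant coefficient of f can then be nonzero, and it equals the value at z.
    independent : {z : Vector Carrier n} → DerivativeClosed z → ∀ e (f : Poly n) →
                  DegreeLT e f → ev f z ≈ 0# → Zero f
    independent closed zero    f p eq = p
    independent {z = z} closed (suc e) f p eq = constant-Zero f z
      (D-Zero⇒constant f λ i → independent closed e (D i f) (degree-D e i f p) (closed f i eq)) eq

  -- `build` keeps the monomials of f and replaces the coefficients, turning a linear relation
  -- between values of monomials into a polynomial relation. Vanishing coefficients get no monomial:
  -- `DegreeLT` does not count them, so filling their places could break the degree bound. Of the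
  -- monomials only their compatibility with powers is recorded.
  record Expansion (f : Poly n) : Set (c ⊔ ℓ) where
    field
      {size}       : ℕ
      coeff        : Vector Carrier size
      coeff-∈      : ∀ k → coeff k ∈ E
      monomial     : Vector (Vector Carrier n → Carrier) size
      monomial-^   : ∀ e k ρ → monomial k (λ i → ρ i ^ e) ≈ monomial k ρ ^ e
      expand       : ∀ ρ → ev f ρ ≈ sum (λ k → coeff k * monomial k ρ)
      coeff-Zero   : (∀ k → coeff k ≈ 0#) → Zero f
      build        : Vector Coefficient size → Poly n
      build-ev     : ∀ b ρ → ev (build b) ρ ≈ sum (λ k → proj₁ (b k) * monomial k ρ)
      build-degree : ∀ b e → DegreeLT e f → DegreeLT e (build b)
      build-Zero   : ∀ b → Zero (build b) → ∀ k → proj₁ (b k) ≈ 0#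

  private
    sum-++ : ∀ k {l} (x : Vector Carrier (k ℕ.+ l)) → sum x ≈ sum (x ∘ (_↑ˡ l)) + sum (x ∘ (k ↑ʳ_))
    sum-++ zero    x = sym (+-identityˡ _)
    sum-++ (suc k) x = trans (+-congˡ (sum-++ k (x ∘ suc))) (sym (+-assoc _ _ _))

    ++-elim : ∀ k {l} {r} (P : Fin (k ℕ.+ l) → Set r) → (∀ i → P (i ↑ˡ l)) → (∀ i → P (k ↑ʳ i)) → ∀ i → P i
    ++-elim zero    P p q i       = q i
    ++-elim (suc k) P p q zero    = p zero
    ++-elim (suc k) P p q (suc i) = ++-elim k (P ∘ suc) (p ∘ suc) q i

    1^ : ∀ e → 1# ^ e ≈ 1#
    1^ zero    = refl
    1^ (suc e) = trans (*-identityˡ _) (1^ e)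

  open Algebra.Properties.CommutativeSemiring.Exp commutativeSemiring using (^-distrib-*)

  expansion : (f : Poly n) → Expansion f
  expansion (con (a , a∈)) with dec (a ≈ 0#)
  ... | yes a≈0 = record
    { size = 0 ; coeff = λ () ; coeff-∈ = λ () ; monomial = λ () ; monomial-^ = λ _ ()
    ; expand = λ _ → a≈0 ; coeff-Zero = λ _ → a≈0
    ; build = λ _ → con (a , a∈) ; build-ev = λ _ _ → a≈0 ; build-degree = λ _ _ p → p ; build-Zero = λ _ _ () }
  ... | no a≉0 = record
    { size = 1 ; coeff = λ _ → a ; coeff-∈ = λ _ → a∈ ; monomial = λ _ _ → 1# ; monomial-^ = λ e _ _ → sym (1^ e)
    ; expand = λ _ → sym (trans (+-identityʳ _) (*-identityʳ _)) ; coeff-Zero = λ p → p zero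
    ; build = λ b → con (b zero) ; build-ev = λ _ _ → sym (trans (+-identityʳ _) (*-identityʳ _))
    ; build-degree = λ { b zero a≈0 → contradiction a≈0 a≉0 ; b (suc e) _ → tt }
    ; build-Zero = λ { b p zero → p } }
  expansion nil = record
    { size = 0 ; coeff = λ () ; coeff-∈ = λ () ; monomial = λ () ; monomial-^ = λ _ ()
    ; expand = λ _ → refl ; coeff-Zero = λ _ → tt
    ; build = λ _ → nil ; build-ev = λ _ _ → refl ; build-degree = λ _ _ p → p ; build-Zero = λ _ _ () }
  expansion (f ◂ g) = combine (expansion f) (expansion g)
    where
    combine : Expansion f → Expansion g → Expansion (f ◂ g)
    combine X Y = record
      { coeff = coeff′
      ; coeff-∈ = ++-elim k _ (λ i → ≡.subst E (≡.sym (coeffˡ i)) (X.coeff-∈ i))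
                              (λ i → ≡.subst E (≡.sym (coeffʳ i)) (Y.coeff-∈ i))
      ; monomial = monomial′
      ; monomial-^ = λ e → ++-elim k _
          (λ i ρ → ≡.subst (λ μ → μ (λ i → ρ i ^ e) ≈ μ ρ ^ e) (≡.sym (monomialˡ i)) (X.monomial-^ e i (ρ ∘ suc)))
          (λ i ρ → ≡.subst (λ μ → μ (λ i → ρ i ^ e) ≈ μ ρ ^ e) (≡.sym (monomialʳ i))
             (trans (*-congˡ (Y.monomial-^ e i ρ)) (sym (^-distrib-* (ρ zero) (Y.monomial i ρ) e))))
      ; expand = λ ρ → trans (+-cong (X.expand (ρ ∘ suc)) (*-congˡ (Y.expand ρ)))
          (assemble X.coeff Y.coeff coeff′ coeffˡ coeffʳ ρ)
      ; coeff-Zero = λ p → X.coeff-Zero (λ i → trans (reflexive (≡.sym (coeffˡ i))) (p (i ↑ˡ l)))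
                         , Y.coeff-Zero (λ i → trans (reflexive (≡.sym (coeffʳ i))) (p (k ↑ʳ i)))
      ; build = λ b → X.build (b ∘ (_↑ˡ l)) ◂ Y.build (b ∘ (k ↑ʳ_))
      ; build-ev = λ b ρ → trans (+-cong (X.build-ev _ (ρ ∘ suc)) (*-congˡ (Y.build-ev _ ρ)))
          (assemble _ _ (proj₁ ∘ b) (λ _ → ≡.refl) (λ _ → ≡.refl) ρ)
      ; build-degree = λ { b zero (p , q) → X.build-degree _ 0 p , Y.build-degree _ 0 q
                         ; b (suc e) (p , q) → X.build-degree _ (suc e) p , Y.build-degree _ e q }
      ; build-Zero = λ b (p , q) → ++-elim k _ (X.build-Zero _ p) (Y.build-Zero _ q)
      }
      where
      module X = Expansion X
      module Y = Expansion Y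
      k = X.size
      l = Y.size
      coeff′ : Vector Carrier (k ℕ.+ l)
      coeff′ = X.coeff Vec.++ Y.coeff
      coeffˡ : ∀ i → coeff′ (i ↑ˡ l) ≡ X.coeff i
      coeffˡ = lookup-++ˡ X.coeff Y.coeff
      coeffʳ : ∀ i → coeff′ (k ↑ʳ i) ≡ Y.coeff i
      coeffʳ = lookup-++ʳ X.coeff Y.coeff
      leftMonomial : Vector (Vector Carrier _ → Carrier) k
      leftMonomial i ρ = X.monomial i (ρ ∘ suc)
      rightMonomial : Vector (Vector Carrier _ → Carrier) l
      rightMonomial i ρ = ρ zero * Y.monomial i ρ
      monomial′ : Vector (Vector Carrier _ → Carrier) (k ℕ.+ l)
      monomial′ = leftMonomial Vec.++ rightMonomial
      monomialˡ : ∀ i → monomial′ (i ↑ˡ l) ≡ leftMonomial i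
      monomialˡ = lookup-++ˡ leftMonomial rightMonomial
      monomialʳ : ∀ i → monomial′ (k ↑ʳ i) ≡ rightMonomial i
      monomialʳ = lookup-++ʳ leftMonomial rightMonomial
      assemble : ∀ (a : Vector Carrier k) (b : Vector Carrier l) (d : Vector Carrier (k ℕ.+ l)) →
                 (∀ i → d (i ↑ˡ l) ≡ a i) → (∀ i → d (k ↑ʳ i) ≡ b i) → ∀ ρ →
                 sum (λ i → a i * X.monomial i (ρ ∘ suc)) + ρ zero * sum (λ i → b i * Y.monomial i ρ)
                 ≈ sum (λ i → d i * monomial′ i ρ)
      assemble a b d dˡ dʳ ρ = sym (trans (sum-++ k (λ i → d i * monomial′ i ρ)) (+-cong
        (sum-cong-≋ λ i → *-cong (reflexive (dˡ i)) (reflexive (≡.cong (λ μ → μ ρ) (monomialˡ i))))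
        (sym (trans (*-distribˡ-sum (ρ zero) (λ i → b i * Y.monomial i ρ)) (sum-cong-≋ λ i → begin
          ρ zero * (b i * Y.monomial i ρ)
            ≈⟨ solve 3 (λ x b m → x ⊗ (b ⊗ m) ⊜ b ⊗ (x ⊗ m)) refl (ρ zero) (b i) (Y.monomial i ρ) ⟩
          b i * (ρ zero * Y.monomial i ρ)
            ≈⟨ *-cong (reflexive (dʳ i)) (reflexive (≡.cong (λ μ → μ ρ) (monomialʳ i))) ⟨
          d (k ↑ʳ i) * monomial′ (k ↑ʳ i) ρ ∎)))))

  module PositiveCharacteristic (q : ℕ) (char : HasCharacteristic K (suc q))
                                (separable : IsSeparableOver K (suc q) E) where
    open Frobenius em K q char

    -- thin 0 f is obtained from a polynomial f in the Xᵢᵖ by replacing Xᵢᵖ by Xᵢ;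
    -- the number counts the coefficients of f, now in X₀, that are to be dropped next.
    thin : ℕ → Poly n → Poly n
    thin k       (con a) = con a
    thin k       nil     = nil
    thin zero    (f ◂ g) = thin 0 f ◂ thin q g
    thin (suc k) (f ◂ g) = thin k g

    -- The condition says that f is X₀ᵏ times a polynomial in the Xᵢᵖ, with k = 0 for a polynomial
    -- in the Xᵢᵖ itself.
    InPowers : ℕ → Poly n → Set ℓ
    InPowers k       (con a) = ⊤
    InPowers k       nil     = ⊤
    InPowers zero    (f ◂ g) = InPowers 0 f × InPowers q g
    InPowers (suc k) (f ◂ g) = Zero f × InPowers k g

    ev-thin₀ : ∀ (f : Poly n) ρ → InPowers 0 f → ev f ρ ≈ ev (thin 0 f) (λ i → ρ i ^ p)
    ev-thin  : ∀ k (f : Poly (suc n)) ρ → InPowers k f → ev f ρ ≈ ρ zero ^ k * ev (thin k f) (λ i → ρ i ^ p)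
    ev-thin₀ (con a)  ρ _ = refl
    ev-thin₀ nil ρ P = refl
    ev-thin₀ (f ◂ g) ρ P = trans (ev-thin 0 (f ◂ g) ρ P) (*-identityˡ _)
    ev-thin k nil ρ _ = sym (zeroʳ _)
    ev-thin zero (f ◂ g) ρ (P , Q) = trans (+-cong (ev-thin₀ f (ρ ∘ suc) P) (*-congˡ (ev-thin q g ρ Q)))
      (solve 4 (λ F x y G → F ⊕ x ⊗ (y ⊗ G) ⊜ κ (ℤ.+ 1) ⊗ (F ⊕ (x ⊗ y) ⊗ G)) refl
        (ev (thin 0 f) (λ i → ρ (suc i) ^ p)) (ρ zero) (ρ zero ^ q) (ev (thin q g) (λ i → ρ i ^ p)))
    ev-thin (suc k) (f ◂ g) ρ (P , Q) = trans (+-cong (ev-Zero f P _) (*-congˡ (ev-thin k g ρ Q)))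
      (trans (+-identityˡ _) (sym (*-assoc _ _ _)))

    degree-thin : ∀ e k (f : Poly n) → DegreeLT e f → DegreeLT e (thin k f)
    degree-thin zero    k       (con a) P       = P
    degree-thin (suc e) k       (con a) P       = tt
    degree-thin e       k       nil     P       = nil-degree e
    degree-thin zero    zero    (f ◂ g) (P , Q) = degree-thin zero 0 f P , degree-thin zero q g Q
    degree-thin (suc e) zero    (f ◂ g) (P , Q) = degree-thin (suc e) 0 f P , degree-thin e q g Q
    degree-thin zero    (suc k) (f ◂ g) (P , Q) = degree-thin zero k g Q
    degree-thin (suc e) (suc k) (f ◂ g) (P , Q) = degree-suc e _ (degree-thin e k g Q)

    degree-thin-≢0 : ∀ e k → k ≢ 0 → (f : Poly (suc n)) → DegreeLT (suc e) f → DegreeLT e (thin k f)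
    degree-thin-≢0 e zero    0≢0 f       P       = contradiction ≡.refl 0≢0
    degree-thin-≢0 e (suc k) _   nil     P       = nil-degree e
    degree-thin-≢0 e (suc k) _   (f ◂ g) (P , Q) = degree-thin e k g Q

    -- As p ≥ 2, some coefficient is dropped between two that are kept, so the bound falls. It
    -- cannot fall from 1 to 0, because thinning leaves constants unchanged.
    degree-thin₀ : ∀ e (f : Poly n) → DegreeLT (suc (suc e)) f → DegreeLT (suc e) (thin 0 f)
    degree-thin₀ e (con a) P       = tt
    degree-thin₀ e nil     P       = tt
    degree-thin₀ e (f ◂ g) (P , Q) = degree-thin₀ e f P , degree-thin-≢0 e q q≢0 g Q

    thin-Zero : ∀ k (f : Poly n) → InPowers k f → Zero (thin k f) → Zero f
    thin-Zero k       (con a) _       a≈0     = a≈0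
    thin-Zero k       nil     _       _       = tt
    thin-Zero zero    (f ◂ g) (P , Q) (Z , W) = thin-Zero 0 f P Z , thin-Zero q g Q W
    thin-Zero (suc k) (f ◂ g) (P , Q) Z       = P , thin-Zero k g Q Z

    D-Zero⇒inPowers : (f : Poly n) → (∀ i → Zero (D i f)) → InPowers 0 f
    -- Here j is the exponent that X₀ has in the original polynomial at the first coefficient of f,
    -- and k is the distance to the next multiple of p; hence the invariant that p divides j + k. If
    -- k > 0, then p does not divide j, so j is invertible in K and the coefficient vanishes.
    weighted-Zero⇒inPowers : ∀ k j (f : Poly (suc n)) → k ℕ.< p → p ∣ℕ j ℕ.+ k →
      Zero (weighted j f) → (∀ i → Zero (D (suc i) f)) → InPowers k f
    D-Zero⇒inPowers (con a) Z = tt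
    D-Zero⇒inPowers nil     Z = tt
    D-Zero⇒inPowers (f ◂ g) Z = D-Zero⇒inPowers f (λ i → proj₁ (Z (suc i)))
      , weighted-Zero⇒inPowers q 1 g (ℕ.n<1+n q) ∣-refl (Z zero) (λ i → proj₂ (Z (suc i)))
    weighted-Zero⇒inPowers k       j nil     k<p p∣j+k Z W = tt
    weighted-Zero⇒inPowers zero    j (f ◂ g) k<p p∣j+k (_ , Z) W =
        D-Zero⇒inPowers f (λ i → proj₁ (W i))
      , weighted-Zero⇒inPowers q (suc j) g (ℕ.n<1+n q)
          (≡.subst (p ∣ℕ_) (ℕ.+-suc j q) (∣m∣n⇒∣m+n (≡.subst (p ∣ℕ_) (ℕ.+-identityʳ j) p∣j+k) ∣-refl))
          Z (λ i → proj₂ (W i))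
    weighted-Zero⇒inPowers (suc k) j (f ◂ g) k<p p∣j+k (Zf , Z) W =
        unscale (∤⇒≉0 λ p∣j → ℕ.<⇒≱ k<p (∣⇒≤ (∣m+n∣m⇒∣n p∣j+k p∣j))) f Zf
      , weighted-Zero⇒inPowers k (suc j) g (ℕ.<-trans (ℕ.n<1+n k) k<p)
          (≡.subst (p ∣ℕ_) (ℕ.+-suc j k) p∣j+k) Z (λ i → proj₂ (W i))

    -- If all derivatives of f vanish, then f is a sum of terms a mᵖ with a in E and monomials m,
    -- and separability yields a relation between the m(z) from the relation f(z) = 0.
    independent-step : {z : Vector Carrier n} → DerivativeClosed z → ∀ e →
                       (∀ f → DegreeLT (suc e) f → ev f z ≈ 0# → Zero f) →
                       ∀ f → DegreeLT (suc (suc e)) f → ev f z ≈ 0# → Zero f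
    independent-step {z = z} closed e IH f P eq = thin-Zero 0 f inPowers (coeff-Zero
      (separable⇒independent separable coeff (λ k → monomial k z) coeff-∈ monomials-independent (begin
        sum (λ k → coeff k * monomial k z ^ p)
          ≈⟨ sum-cong-≋ (λ k → *-congˡ (monomial-^ p k z)) ⟨
        sum (λ k → coeff k * monomial k (λ i → z i ^ p))
          ≈⟨ expand (λ i → z i ^ p) ⟨
        ev (thin 0 f) (λ i → z i ^ p)
          ≈⟨ ev-thin₀ f z inPowers ⟨
        ev f z
          ≈⟨ eq ⟩
        0# ∎)))
      where
      inPowers : InPowers 0 f
      inPowers = D-Zero⇒inPowers f λ i → IH (D i f) (degree-D (suc e) i f P) (closed f i eq)
      open Expansion (expansion (thin 0 f))
      monomials-independent : ∀ b → (∀ k → b k ∈ E) → sum (λ k → b k * monomial k z) ≈ 0# → ∀ k → b k ≈ 0#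
      -- A linear relation between these monomials at z is a polynomial relation within the bound
      -- for `thin 0 f`, which is one less than the bound for f.
      monomials-independent b b∈ eq = build-Zero b′
        (IH (build b′) (build-degree b′ (suc e) (degree-thin₀ e f P)) (trans (build-ev b′ z) eq))
        where b′ = λ k → b k , b∈ k

    independent : {z : Vector Carrier n} → DerivativeClosed z → ∀ e (f : Poly n) →
                  DegreeLT e f → ev f z ≈ 0# → Zero f
    independent         closed zero          f P eq = P
    independent {z = z} closed (suc zero)    f P eq = constant-Zero f z P eq
    independent         closed (suc (suc e)) f P eq = independent-step closed e (independent closed (suc e)) f P eq

  independent : ∀ {p} → HasCharacteristicExponent K p → IsSeparableOver K p E →
                {z : Vector Carrier n} → DerivativeClosed z → ∀ f → ev f z ≈ 0# → Zero f
  independent (inj₁ (char , _)) _ closed f =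
    CharacteristicZero.independent char closed (suc (proj₁ (degree-bound f))) f (proj₂ (degree-bound f))
  independent (inj₂ (q , char , ≡.refl)) separable closed f =
    PositiveCharacteristic.independent q char separable closed (suc (proj₁ (degree-bound f))) f (proj₂ (degree-bound f))

-- Small elements for a nontrivial absolute value

module AbsoluteValues (em : ∀ {a} → ExcludedMiddle a) {c ℓ} (K : Field c ℓ) (a : NontrivialAbsoluteValue K) where
  open Classical em
  private
    module K = FieldProperties em K
    module a = NontrivialAbsoluteValue a
    module R = RealField a.ℝ
  open FieldProperties em R.field′
  open R using (+-monoʳ-≤; *-nonNeg; complete; UpperBound) renaming (_≤_ to infix 4 _≤_; _<_ to infix 4 _<_)
  open IsTotalOrder R.isTotalOrder using (antisym; total; ≤-respˡ-≈; ≤-respʳ-≈)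
    renaming (trans to ≤-trans; reflexive to ≤-reflexive)
  open a using (∣_∣)

  0≤y-x : ∀ {x y} → x ≤ y → 0# ≤ y - x
  0≤y-x {x} {y} x≤y = ≤-respˡ-≈ (-‿inverseˡ x) (≤-respʳ-≈ (+-comm (- x) y) (+-monoʳ-≤ (- x) x≤y))

  0≤y-x⇒x≤y : ∀ {x y} → 0# ≤ y - x → x ≤ y
  0≤y-x⇒x≤y {x} {y} 0≤ = ≤-respˡ-≈ (+-identityʳ x)
    (≤-respʳ-≈ (solve 2 (λ x y → x ⊕ (y ⊖ x) ⊜ y) refl x y) (+-monoʳ-≤ x 0≤))

  *-monoˡ : ∀ {x y t} → 0# ≤ t → x ≤ y → t * x ≤ t * y
  *-monoˡ {x} {y} {t} 0≤t x≤y = 0≤y-x⇒x≤y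
    (≤-respʳ-≈ (solve 3 (λ t x y → t ⊗ (y ⊖ x) ⊜ t ⊗ y ⊖ t ⊗ x) refl t x y) (*-nonNeg 0≤t (0≤y-x x≤y)))

  0≤1 : 0# ≤ 1#
  0≤1 with total 0# 1#
  ... | inj₁ 0≤1 = 0≤1
  ... | inj₂ 1≤0 = ≤-respʳ-≈ (solve 0 ((κ (ℤ.+ 0) ⊖ κ (ℤ.+ 1)) ⊗ (κ (ℤ.+ 0) ⊖ κ (ℤ.+ 1)) ⊜ κ (ℤ.+ 1)) refl)
                     (*-nonNeg (0≤y-x 1≤0) (0≤y-x 1≤0))

  ∣_∣≉0 : ∀ x → x K.≉ K.0# → ∣ x ∣ ≉ 0#
  ∣ x ∣≉0 x≉0 ∣x∣≈0 = x≉0 (Equivalence.to (a.definite x) ∣x∣≈0)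

  ∣1∣≈1 : ∣ K.1# ∣ ≈ 1#
  ∣1∣≈1 = -≈0⇒≈ (*-cancel-0 (∣ K.1# ∣≉0 K.1≉0) (begin
    ∣ K.1# ∣ * (∣ K.1# ∣ - 1#)
      ≈⟨ solve 1 (λ x → x ⊗ (x ⊖ κ (ℤ.+ 1)) ⊜ x ⊗ x ⊖ x) refl ∣ K.1# ∣ ⟩
    ∣ K.1# ∣ * ∣ K.1# ∣ - ∣ K.1# ∣
      ≈⟨ +-congʳ (trans (sym (a.homo-* K.1# K.1#)) (a.cong (K.*-identityˡ K.1#))) ⟩
    ∣ K.1# ∣ - ∣ K.1# ∣
      ≈⟨ -‿inverseʳ _ ⟩
    0# ∎))

  ∣x∣∣y∣≈1 : ∀ {x y} → x K.* y K.≈ K.1# → ∣ x ∣ * ∣ y ∣ ≈ 1#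
  ∣x∣∣y∣≈1 {x} {y} xy≈1 = trans (sym (a.homo-* x y)) (trans (a.cong xy≈1) ∣1∣≈1)

  -- Either the element of value different from 1 or its inverse will do.
  contracting : ∃ λ b → b K.≉ K.0# × ∣ b ∣ ≤ 1# × ∣ b ∣ ≉ 1#
  contracting with a.nontrivial
  ... | x , x≉0 , ∣x∣≉1 with total ∣ x ∣ 1# | K.inverse x x≉0
  ... | inj₁ ∣x∣≤1 | _ = x , x≉0 , ∣x∣≤1 , ∣x∣≉1
  ... | inj₂ 1≤∣x∣ | y , xy≈1 = y
      , (λ y≈0 → K.1≉0 (K.trans (K.sym xy≈1) (K.trans (K.*-congˡ y≈0) (K.zeroʳ x))))
      , ≤-respˡ-≈ (*-identityʳ _) (≤-respʳ-≈ ∣y∣∣x∣≈1 (*-monoˡ (a.nonNeg y) 1≤∣x∣))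
      , (λ ∣y∣≈1 → ∣x∣≉1 (trans (sym (*-identityˡ _)) (trans (*-congʳ (sym ∣y∣≈1)) ∣y∣∣x∣≈1)))
    where
    ∣y∣∣x∣≈1 : ∣ y ∣ * ∣ x ∣ ≈ 1#
    ∣y∣∣x∣≈1 = trans (*-comm _ _) (∣x∣∣y∣≈1 xy≈1)

  -- Otherwise the values ε ∣ x ∣ would be bounded by 1, and multiplying by the value of
  -- a contracting element would lower their least upper bound.
  small : ∀ {ε} → 0# < ε → ∃ λ x → x K.≉ K.0# × ∣ x ∣ < ε
  small {ε} (0≤ε , 0≉ε) = ¬¬-elim λ none → impossible none
    where
    impossible : ¬ ¬ (∃ λ x → x K.≉ K.0# × ∣ x ∣ < ε)
    impossible none = proj₁ contradictory (proj₂ contradictory)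
      where
      ε≤ : ∀ x → x K.≉ K.0# → ε ≤ ∣ x ∣
      ε≤ x x≉0 with total ε ∣ x ∣
      ... | inj₁ ε≤∣x∣ = ε≤∣x∣
      ... | inj₂ ∣x∣≤ε = ≤-reflexive (¬¬-elim λ ε≉∣x∣ → none (x , x≉0 , ∣x∣≤ε , λ ∣x∣≈ε → ε≉∣x∣ (sym ∣x∣≈ε)))
      S : Pred Carrier _
      S r = ∃ λ x → r ≈ ∣ x ∣ * ε
      bounded : UpperBound S 1#
      bounded r (x , r≈) with dec (x K.≈ K.0#)
      ... | yes x≈0 = ≤-respˡ-≈ (sym (trans r≈ (trans (*-congʳ (Equivalence.from (a.definite x) x≈0)) (zeroˡ ε)))) 0≤1
      ... | no x≉0 with K.inverse x x≉0
      ... | y , xy≈1 = ≤-respˡ-≈ (sym r≈) (≤-respʳ-≈ (∣x∣∣y∣≈1 xy≈1) (*-monoˡ (a.nonNeg x)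
              (ε≤ y λ y≈0 → K.1≉0 (K.trans (K.sym xy≈1) (K.trans (K.*-congˡ y≈0) (K.zeroʳ x))))))
      sup = complete S (_ , K.1# , refl) (1# , bounded)
      u = proj₁ sup
      b = proj₁ contracting
      t = ∣ b ∣
      b≉0 = proj₁ (proj₂ contracting)
      t≤1 = proj₁ (proj₂ (proj₂ contracting))
      t≉1 = proj₂ (proj₂ (proj₂ contracting))
      contracted : UpperBound S (t * u)
      contracted r (x , r≈) with K.inverse b b≉0
      ... | b⁻¹ , bb⁻¹≈1 = ≤-respˡ-≈ (begin
          t * (∣ b⁻¹ K.* x ∣ * ε)     ≈⟨ *-assoc _ _ _ ⟨
          t * ∣ b⁻¹ K.* x ∣ * ε       ≈⟨ *-congʳ (a.homo-* _ _) ⟨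
          ∣ b K.* (b⁻¹ K.* x) ∣ * ε   ≈⟨ *-congʳ (a.cong (K.trans (K.sym (K.*-assoc _ _ _))
                                           (K.trans (K.*-congʳ bb⁻¹≈1) (K.*-identityˡ x)))) ⟩
          ∣ x ∣ * ε                   ≈⟨ r≈ ⟨
          r                           ∎)
        (*-monoˡ (a.nonNeg b) (proj₁ (proj₂ sup) _ (_ , refl)))
      u≤tu : u ≤ t * u
      u≤tu = proj₂ (proj₂ sup) (t * u) contracted
      ε≤u : ε ≤ u
      ε≤u = ≤-respˡ-≈ (trans (*-congʳ ∣1∣≈1) (*-identityˡ ε)) (proj₁ (proj₂ sup) _ (K.1# , refl))
      0≤u : 0# ≤ u
      0≤u = ≤-trans 0≤ε ε≤u
      u≈tu : u ≈ t * u
      u≈tu = antisym u≤tu (≤-respˡ-≈ (*-comm u t) (≤-respʳ-≈ (*-identityʳ u) (*-monoˡ 0≤u t≤1)))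
      contradictory : u ≉ 0# × u ≈ 0#
      contradictory = (λ u≈0 → 0≉ε (antisym 0≤ε (≤-respʳ-≈ u≈0 ε≤u)))
        , *-cancel-0 {1# - t} (λ 1-t≈0 → t≉1 (sym (-≈0⇒≈ 1-t≈0))) (begin
            (1# - t) * u   ≈⟨ solve 2 (λ t u → (κ (ℤ.+ 1) ⊖ t) ⊗ u ⊜ u ⊖ t ⊗ u) refl t u ⟩
            u - t * u      ≈⟨ +-congʳ u≈tu ⟩
            t * u - t * u  ≈⟨ -‿inverseʳ _ ⟩
            0#             ∎)

-- Neighbourhoods in a henselian topology

module HenselianTopologies (em : ∀ {a} → ExcludedMiddle a) {c ℓ} (K : Field c ℓ)
                           (τ : Topology (Field.setoid K)) (henselian : IsHenselian K τ)
                           {E : Pred (Field.Carrier K) (c ⊔ ℓ)} (isSubfield : IsSubfield K E) where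
  open FieldProperties em K
  open Classical em
  open Polynomials em K isSubfield
  open Vanishing em K isSubfield
  open Topology τ
  open IsHenselian henselian

  private
    variable
      m n : ℕ

    x+d-d≈x : ∀ x d → (x + d) - d ≈ x
    x+d-d≈x = solve 2 (λ x d → (x ⊕ d) ⊖ d ⊜ x) refl

    x+d≉d : ∀ {x d} → x ≉ 0# → x + d ≉ d
    x+d≉d {x} {d} x≉0 x+d≈d = x≉0 (trans (sym (x+d-d≈x x d)) (trans (+-congʳ x+d≈d) (-‿inverseʳ d)))

    module FromAbsoluteValue (a : NontrivialAbsoluteValue K) where
      module a = NontrivialAbsoluteValue a
      module ℝ = RealField a.ℝ
      open IsTotalOrder ℝ.isTotalOrder using (≤-respˡ-≈)

      <-respˡ-≈ : ∀ {r s t} → r ℝ.≈ s → r ℝ.< t → s ℝ.< t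
      <-respˡ-≈ r≈s (r≤t , r≉t) = ≤-respˡ-≈ r≈s r≤t , λ s≈t → r≉t (ℝ.trans r≈s s≈t)

      nondiscrete-absoluteValue : ∀ {U} → a.IsOpen U → ∀ {d} → d ∈ U → ∃ λ d′ → d′ ∈ U × d′ ≉ d
      nondiscrete-absoluteValue {U} U-open {d} d∈U = move (AbsoluteValues.small em K a (proj₁ (proj₂ ball)))
        where
        ball = U-open d d∈U
        ε = proj₁ ball
        move : (∃ λ x → x ≉ 0# × a.∣ x ∣ ℝ.< ε) → ∃ λ d′ → d′ ∈ U × d′ ≉ d
        move (x , x≉0 , ∣x∣<ε) =
          x + d , proj₂ (proj₂ ball) (x + d) (<-respˡ-≈ (a.cong (sym (x+d-d≈x x d))) ∣x∣<ε) , x+d≉d x≉0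

    module FromValuation (v : NontrivialValuation K) where
      module v = NontrivialValuation v
      module Γ = OrderedAbelianGroup v.Γ

      ≥γ : ∀ {γ} w → w Γ.≈⁺ [ γ ] → [ γ ] Γ.≤⁺ w
      ≥γ [ w ] SupremumEq.[ w≈γ ] = SupremumOrder.[ IsTotalOrder.reflexive Γ.isTotalOrder (Γ.sym w≈γ) ]

      finite : ∀ {γ} w → w Γ.≈⁺ [ γ ] → ¬ (w Γ.≈⁺ ⊤⁺)
      finite [ w ] _ ()

      nondiscrete-valuation : ∀ {U} → v.IsOpen U → ∀ {d} → d ∈ U → ∃ λ d′ → d′ ∈ U × d′ ≉ d
      nondiscrete-valuation {U} U-open {d} d∈U = move (v.surjective γ)
        where
        ball = U-open d d∈U
        γ = proj₁ ball
        move : (∃ λ x → v.v x Γ.≈⁺ [ γ ]) → ∃ λ d′ → d′ ∈ U × d′ ≉ d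
        move (x , vx≈γ) = x + d
          , proj₂ ball (x + d) (≥γ _ (≈⁺-trans _ Γ.trans (v.cong (x+d-d≈x x d)) vx≈γ))
          , x+d≉d λ x≈0 → finite (v.v x) vx≈γ (Equivalence.from (v.definite x) x≈0)

  -- The V-topology enters here: d is translated by a small nonzero element. For an absolute value
  -- such an element comes from completeness of the reals, for a valuation from surjectivity onto
  -- the value group.
  nondiscrete : ∀ {U} → Open U → ∀ {d} → d ∈ U → ∃ λ d′ → d′ ∈ U × d′ ≉ d
  nondiscrete {U} U-open {d} d∈U = by-cases isVTopology
    where
    by-cases : IsVTopology K τ → ∃ λ d′ → d′ ∈ U × d′ ≉ d
    by-cases (inj₁ (a , open⇔)) = FromAbsoluteValue.nondiscrete-absoluteValue a (Equivalence.to (open⇔ U) U-open) d∈U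
    by-cases (inj₂ (v , open⇔)) = FromValuation.nondiscrete-valuation v (Equivalence.to (open⇔ U) U-open) d∈U

  record Neighbourhood (e : Vector Carrier n) : Set (Level.suc (c ⊔ ℓ)) where
    field
      side      : Fin n → Subset
      side-open : ∀ i → Open (side i)
      centre    : e ∈ Box side

  open Neighbourhood public

  openᵐ⇒neighbourhood : ∀ {W : Pred (Vector Carrier n) (c ⊔ ℓ)} → Openᵐ W → ∀ {e} → e ∈ W →
                        Σ (Neighbourhood e) λ N → ∀ x → x ∈ Box (side N) → x ∈ W
  openᵐ⇒neighbourhood openᵐ {e} e∈W with openᵐ e e∈W
  ... | N , N-open , N⊆W = record { side = N ; side-open = proj₁ ∘ N-open ; centre = proj₂ ∘ N-open } , N⊆W

  _∩ᴺ_ : ∀ {e : Vector Carrier n} → Neighbourhood e → Neighbourhood e → Neighbourhood e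
  M ∩ᴺ N = record
    { side      = λ i → side M i ∩ side N i
    ; side-open = λ i → open-∩ (side-open M i) (side-open N i)
    ; centre    = λ i → centre M i , centre N i
    }

  whole : (e : Vector Carrier n) → Neighbourhood e
  whole e = record
    { side = λ _ _ → ⊤ ; side-open = λ _ → open-all (λ _ → tt) ; centre = λ _ → tt }

  -- If g(e) ≠ 0, then solving g Y = 1 near e shows that g is invertible near e.
  invertible-neighbourhood : (f : Polynomial Carrier (suc n)) {g : Vector Carrier n → Carrier} →
    (∀ y x → evalPoly K f (y Vec.∷ x) ≈ g x * y - 1#) →
    (∀ y x → evalPoly K (∂ zero f) (y Vec.∷ x) ≈ g x) →
    ∀ e → g e ≉ 0# → Σ (Neighbourhood e) λ N → ∀ x → x ∈ Box (side N) → g x ≉ 0#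
  invertible-neighbourhood f {g} f≈ ∂f≈ e ge≉0 with inverse (g e) ge≉0
  ... | d , ged≈1 with implicitFunctionTheorem f e d
      (trans (f≈ d e) (trans (+-congʳ ged≈1) (-‿inverseʳ 1#))) (≉-resp (sym (∂f≈ d e)) ge≉0)
  ... | U , V , U-open , V-open , e∈U , d∈V , h , implicit =
    let N , N⊆U = openᵐ⇒neighbourhood U-open e∈U
    in N , λ x x∈N gx≈0 →
         let hx = h x (N⊆U x x∈N)
             fx≈0 = proj₂ (Equivalence.from (IsImplicitFunction.graph implicit x (N⊆U x x∈N) hx) refl)
         in 1≉0 (begin
              1#          ≈⟨ -≈0⇒≈ (trans (sym (f≈ hx x)) fx≈0) ⟨
              g x * hx    ≈⟨ *-congʳ gx≈0 ⟩
              0# * hx     ≈⟨ zeroˡ hx ⟩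
              0#          ∎)

  nonzero-neighbourhood : ∀ (f : Poly n) e → ev f e ≉ 0# →
                          Σ (Neighbourhood e) λ N → ∀ x → x ∈ Box (side N) → ev f x ≉ 0#
  nonzero-neighbourhood f = invertible-neighbourhood (toTerm suc f :* var zero :+ :- :1)
    (λ y x → +-congʳ (*-congʳ (eval-toTerm (y Vec.∷ x) suc f)))
    (λ y x → trans
      (+-congʳ (+-cong (*-congʳ (∂-toTerm-0 (y Vec.∷ x) f (λ i → i))) (*-congʳ (eval-toTerm (y Vec.∷ x) suc f))))
      (solve 2 (λ g y → (κ (ℤ.+ 0) ⊗ y ⊕ g ⊗ κ (ℤ.+ 1)) ⊕ (⊝ κ (ℤ.+ 0)) ⊜ g) refl (ev f x) y))

  -- The polynomial x - a is invertible near e, which gives the Hausdorff property without recourse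
  -- to the metric or the valuation.
  separated : ∀ {e a} → e ≉ a → ∃ λ N → Open N × e ∈ N × (∀ x → x ∈ N → x ≉ a)
  separated {e} {a} e≉a =
    let N , N≉0 = invertible-neighbourhood {n = 1} ((var (suc zero) :+ :- par a) :* var zero :+ :- :1)
          {λ x → x zero - a} (λ _ _ → refl)
          (λ y x → solve 3 (λ x a y → ((κ (ℤ.+ 0) ⊕ ⊝ κ (ℤ.+ 0)) ⊗ y ⊕ (x ⊖ a) ⊗ κ (ℤ.+ 1)) ⊕ ⊝ κ (ℤ.+ 0) ⊜ x ⊖ a) refl
                     (x zero) a y)
          (λ _ → e) (λ e-a≈0 → e≉a (-≈0⇒≈ e-a≈0))
    in side N zero , side-open N zero , centre N zero
     , λ x x∈N x≈a → N≉0 (λ _ → x) (λ { zero → x∈N }) (trans (+-congʳ x≈a) (-‿inverseʳ a))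

  another-point : ∀ {U d} → Open U → d ∈ U → ∀ x → ∃ λ e → e ∈ U × e ≉ x
  another-point {U} {d} U-open d∈U x = by-cases (dec (d ≈ x)) (nondiscrete U-open d∈U)
    where
    by-cases : Dec (d ≈ x) → (∃ λ e → e ∈ U × e ≉ d) → ∃ λ e → e ∈ U × e ≉ x
    by-cases (no d≉x)  _               = d , d∈U , d≉x
    by-cases (yes d≈x) (e , e∈U , e≉d) = e , e∈U , λ e≈x → e≉d (trans e≈x (sym d≈x))

  -- The points to be avoided are excluded one by one: move off x inside U, then shrink U to a
  -- neighbourhood that misses x.
  open⇒infinite : ∀ {U d} → Open U → d ∈ U → Infinite U
  open⇒infinite {U} {d} U-open d∈U []       = d , d∈U , λ _ ()
  open⇒infinite {U} {d} U-open d∈U (x ∷ xs) = avoid-x (another-point U-open d∈U x)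
    where
    avoid-x : (∃ λ e → e ∈ U × e ≉ x) → ∃ λ y → y ∈ U × (∀ z → z ∈ₚ x ∷ xs → y ≉ z)
    avoid-x (e , e∈U , e≉x) = avoid-xs (separated e≉x)
      where
      avoid-xs : (∃ λ N → Open N × e ∈ N × (∀ y → y ∈ N → y ≉ x)) → ∃ λ y → y ∈ U × (∀ z → z ∈ₚ x ∷ xs → y ≉ z)
      avoid-xs (N , N-open , e∈N , N≉x) = conclude (open⇒infinite (open-∩ U-open N-open) (e∈U , e∈N) xs)
        where
        conclude : (∃ λ y → y ∈ U ∩ N × (∀ z → z ∈ₚ xs → y ≉ z)) → ∃ λ y → y ∈ U × (∀ z → z ∈ₚ x ∷ xs → y ≉ z)
        conclude (y , (y∈U , y∈N) , y≉xs) =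
          y , y∈U , λ { _ (here ≡.refl) → N≉x y y∈N ; z (there z∈xs) → y≉xs z z∈xs }

  neighbourhood-infinite : ∀ {e : Vector Carrier n} (N : Neighbourhood e) → ∀ i → Infinite (side N i)
  neighbourhood-infinite N i = open⇒infinite (side-open N i) (centre N i)

-- Pseudo-division, minimal polynomials and specialisation

module MinimalPolynomials (em : ∀ {a} → ExcludedMiddle a) {c ℓ} (K : Field c ℓ)
                          {E : Pred (Field.Carrier K) (c ⊔ ℓ)} (isSubfield : IsSubfield K E) where
  open FieldProperties em K
  open Classical em
  open Polynomials em K isSubfield
  open Vanishing em K isSubfield

  private variable
    m n d : ℕ

  evaluate : Vector (Poly m) n → Carrier → Vector Carrier m → Carrier
  evaluate q y ρ = powerSum (λ i → ev (q i) ρ) y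

  -- The multiplier is a power of the leading coefficient of q. It keeps quotient and remainder
  -- polynomial in ρ, so `correct` holds at all points and can be used at ρ and at its
  -- specialisations alike.
  record PseudoDivision (q : Vector (Poly m) (suc d)) (f : Poly (suc m)) : Set (c ⊔ ℓ) where
    field
      multiplier : Poly m
      quotient   : Poly (suc m)
      remainder  : Vector (Poly m) d
      multiplier≉0 : ∀ ρ → ev (last q) ρ ≉ 0# → ev multiplier ρ ≉ 0#
      correct : ∀ y ρ → ev multiplier ρ * ev f (y Vec.∷ ρ)
                        ≈ ev quotient (y Vec.∷ ρ) * evaluate q y ρ + evaluate remainder y ρ

  pseudoDivide : (q : Vector (Poly m) (suc d)) → ∀ f → PseudoDivision q f
  pseudoDivide {m} {d} q nil = record
    { multiplier = 1ₚ ; quotient = nil ; remainder = λ _ → 0ₚ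
    ; multiplier≉0 = λ ρ _ → ≉-resp (sym (ev-1 ρ)) 1≉0
    ; correct = λ y ρ → begin
        ev 1ₚ ρ * 0#                            ≈⟨ zeroʳ _ ⟩
        0#                                      ≈⟨ trans (+-cong (zeroˡ _) (sum-≈0 {d} λ i → trans (*-congʳ (ev-0 ρ)) (zeroˡ _)))
                                                         (+-identityˡ 0#) ⟨
        0# * evaluate q y ρ + evaluate {n = d} (λ _ → 0ₚ) y ρ  ∎ }
  pseudoDivide {m} {d} q (f₀ ◂ f₁) = extend (pseudoDivide q f₁)
    where
    extend : PseudoDivision q f₁ → PseudoDivision q (f₀ ◂ f₁)
    extend division = record
      { multiplier = l *ₚ u
      ; quotient = l • (0ₚ ◂ g) +ₚ (b ◂ nil)
      ; remainder = r′
      ; multiplier≉0 = λ ρ l≉0 → ≉-resp (sym (ev-* l u ρ)) (*-≉0 l≉0 (multiplier≉0 ρ l≉0))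
      ; correct = correct′ }
      where
      open PseudoDivision division renaming (multiplier to u; quotient to g; remainder to r)
      l = last q
      -- Writing f = f₀ + X f₁ and u f₁ = g q + r gives u f = X g q + w with w = u f₀ + X r of
      -- degree at most d. The top coefficients of l w and b q agree, and `r′` is what remains of
      -- their difference.
      w : Vector (Poly m) (suc d)
      w = (u *ₚ f₀) Vec.∷ r
      b = last w
      r′ : Vector (Poly m) d
      r′ i = l *ₚ init w i +ₚ -ₚ (b *ₚ init q i)
      correct′ : ∀ y ρ → ev (l *ₚ u) ρ * ev (f₀ ◂ f₁) (y Vec.∷ ρ)
                 ≈ ev (l • (0ₚ ◂ g) +ₚ (b ◂ nil)) (y Vec.∷ ρ) * evaluate q y ρ + evaluate r′ y ρ
      correct′ y ρ = begin
        ev (l *ₚ u) ρ * (F₀ + y * F₁)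
          ≈⟨ *-congʳ (ev-* l u ρ) ⟩
        (L * U) * (F₀ + y * F₁)
          ≈⟨ solve 5 (λ L U F₀ y F₁ → (L ⊗ U) ⊗ (F₀ ⊕ y ⊗ F₁) ⊜ L ⊗ (U ⊗ F₀ ⊕ y ⊗ (U ⊗ F₁))) refl L U F₀ y F₁ ⟩
        L * (U * F₀ + y * (U * F₁))
          ≈⟨ *-congˡ (+-congˡ (*-congˡ (correct y ρ))) ⟩
        L * (U * F₀ + y * (G * Q + R))
          ≈⟨ solve 6 (λ L V y G Q R → L ⊗ (V ⊕ y ⊗ (G ⊗ Q ⊕ R)) ⊜ L ⊗ y ⊗ G ⊗ Q ⊕ L ⊗ (V ⊕ y ⊗ R)) refl L (U * F₀) y G Q R ⟩
        L * y * G * Q + L * (U * F₀ + y * R)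
          ≈⟨ +-cong (*-congˡ Q≈) (*-congˡ W≈) ⟩
        L * y * G * (Q₀ + L * Y) + L * (W₀ + B * Y)
          ≈⟨ solve 7 (λ L y G Q₀ Y W₀ B →
               L ⊗ y ⊗ G ⊗ (Q₀ ⊕ L ⊗ Y) ⊕ L ⊗ (W₀ ⊕ B ⊗ Y)
               ⊜ (L ⊗ (κ (ℤ.+ 0) ⊕ y ⊗ G) ⊕ (B ⊕ y ⊗ κ (ℤ.+ 0))) ⊗ (Q₀ ⊕ L ⊗ Y) ⊕ (L ⊗ W₀ ⊕ (⊝ B) ⊗ Q₀)) refl L y G Q₀ Y W₀ B ⟩
        (L * (0# + y * G) + (B + y * 0#)) * (Q₀ + L * Y) + (L * W₀ + (- B) * Q₀)
          ≈⟨ +-cong (*-cong G′≈ Q≈) R′≈ ⟨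
        ev (l • (0ₚ ◂ g) +ₚ (b ◂ nil)) (y Vec.∷ ρ) * Q + evaluate r′ y ρ ∎
        where
        L = ev l ρ
        U = ev u ρ
        B = ev b ρ
        F₀ = ev f₀ ρ
        F₁ = ev f₁ (y Vec.∷ ρ)
        G = ev g (y Vec.∷ ρ)
        Q = evaluate q y ρ
        R = evaluate r y ρ
        Q₀ = evaluate (init q) y ρ
        W₀ = evaluate (init w) y ρ
        Y = y ^ d
        Q≈ : Q ≈ Q₀ + L * Y
        Q≈ = powerSum-init (λ i → ev (q i) ρ) y
        W≈ : U * F₀ + y * R ≈ W₀ + B * Y
        W≈ = begin
          U * F₀ + y * R           ≈⟨ +-congʳ (ev-* u f₀ ρ) ⟨
          ev (u *ₚ f₀) ρ + y * R   ≈⟨ powerSum-suc (λ i → ev (w i) ρ) y ⟨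
          evaluate w y ρ           ≈⟨ powerSum-init (λ i → ev (w i) ρ) y ⟩
          W₀ + B * Y               ∎
        G′≈ : ev (l • (0ₚ ◂ g) +ₚ (b ◂ nil)) (y Vec.∷ ρ) ≈ L * (0# + y * G) + (B + y * 0#)
        G′≈ = trans (ev-+ (l • (0ₚ ◂ g)) (b ◂ nil) _)
          (+-congʳ (trans (ev-• l (0ₚ ◂ g) _) (*-congˡ (+-congʳ (ev-0 ρ)))))
        R′≈ : evaluate r′ y ρ ≈ L * W₀ + (- B) * Q₀
        R′≈ = trans
          (powerSum-cong y λ i → trans (ev-+ (l *ₚ init w i) (-ₚ (b *ₚ init q i)) ρ)
            (+-cong (ev-* l (init w i) ρ) (trans (ev-neg (b *ₚ init q i) ρ) (trans (-‿cong (ev-* b (init q i) ρ))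
              (solve 2 (λ x y → ⊝ (x ⊗ y) ⊜ (⊝ x) ⊗ y) refl B (ev (init q i) ρ))))))
          (powerSum-linear (λ i → ev (init w i) ρ) (λ i → ev (init q i) ρ) L (- B) y)

  Independent : Carrier → Vector Carrier m → ℕ → Set (c ⊔ ℓ)
  Independent {m} θ ρ d = (r : Vector (Poly m) d) → evaluate r θ ρ ≈ 0# → ∀ i → ev (r i) ρ ≈ 0#

  record MinimalPolynomial (θ : Carrier) (ρ : Vector Carrier m) : Set (c ⊔ ℓ) where
    field
      {degree} : ℕ
      poly     : Vector (Poly m) (suc degree)
      root     : evaluate poly θ ρ ≈ 0#
      lead≉0   : ev (last poly) ρ ≉ 0#
      minimal  : Independent θ ρ degree

  -- The descent stops where θ⁰, ..., θⁿ are dependent over E[ρ] but the powers below θⁿ are not; a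
  -- relation there with vanishing leading coefficient would relate the lower powers.
  minimalPolynomial : ∀ {θ} {ρ : Vector Carrier m} n → ¬ Independent θ ρ n → MinimalPolynomial θ ρ
  minimalPolynomial zero ¬independent = contradiction (λ _ _ ()) ¬independent
  minimalPolynomial {θ = θ} {ρ} (suc n) ¬independent with dec (Independent θ ρ n)
  ... | no ¬independent′ = minimalPolynomial n ¬independent′
  ... | yes independent with ¬∀⇒∃¬ ¬independent
  ... | q , ¬q = record
    { poly = q
    ; root = root
    ; lead≉0 = λ last≈0 → ¬q λ _ → init-last-≈0 (λ i → ev (q i) ρ) (independent (init q) (begin
        evaluate (init q) θ ρ                           ≈⟨ +-identityʳ _ ⟨
        evaluate (init q) θ ρ + 0#                      ≈⟨ +-congˡ (trans (*-congʳ last≈0) (zeroˡ _)) ⟨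
        evaluate (init q) θ ρ + ev (last q) ρ * θ ^ n   ≈⟨ powerSum-init (λ i → ev (q i) ρ) θ ⟨
        evaluate q θ ρ                                  ≈⟨ root ⟩
        0#                                              ∎)) last≈0
    ; minimal = independent }
    where
    root : evaluate q θ ρ ≈ 0#
    root = ¬¬-elim λ q≉0 → ¬q λ q≈0 → contradiction q≈0 q≉0

  -- ρ′ is a specialisation of ρ over E, that is, a point of the Zariski closure of ρ over E.
  _⇝_ : Vector Carrier n → Vector Carrier n → Set (c ⊔ ℓ)
  ρ ⇝ ρ′ = ∀ f → ev f ρ ≈ 0# → ev f ρ′ ≈ 0#

  module _ {θ} {ρ : Vector Carrier m} (μ : MinimalPolynomial θ ρ) where
    open MinimalPolynomial μ

    remainder-vanishes : ∀ {f} (division : PseudoDivision poly f) → ev f (θ Vec.∷ ρ) ≈ 0# →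
                         ∀ i → ev (PseudoDivision.remainder division i) ρ ≈ 0#
    remainder-vanishes {f} division fθ≈0 = minimal remainder (begin
      evaluate remainder θ ρ
        ≈⟨ trans (+-congʳ (trans (*-congˡ root) (zeroʳ _))) (+-identityˡ _) ⟨
      ev quotient (θ Vec.∷ ρ) * evaluate poly θ ρ + evaluate remainder θ ρ
        ≈⟨ correct θ ρ ⟨
      ev multiplier ρ * ev f (θ Vec.∷ ρ)
        ≈⟨ trans (*-congˡ fθ≈0) (zeroʳ _) ⟩
      0# ∎)
      where open PseudoDivision division

    -- Divide f by the minimal polynomial. By minimality the coefficients of the remainder vanish at
    -- ρ, hence at ρ′. So the multiplier times f vanishes at the new point, and the multiplier does
    -- not.
    ⇝-extend : ∀ {θ′} {ρ′ : Vector Carrier m} → ρ ⇝ ρ′ → ev (last poly) ρ′ ≉ 0# → evaluate poly θ′ ρ′ ≈ 0# →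
               (θ Vec.∷ ρ) ⇝ (θ′ Vec.∷ ρ′)
    ⇝-extend {θ′} {ρ′} ρ⇝ρ′ lead≉0′ root′ f fθ≈0 = *-cancel-0 (multiplier≉0 ρ′ lead≉0′) (begin
      ev multiplier ρ′ * ev f (θ′ Vec.∷ ρ′)
        ≈⟨ correct θ′ ρ′ ⟩
      ev quotient (θ′ Vec.∷ ρ′) * evaluate poly θ′ ρ′ + evaluate remainder θ′ ρ′
        ≈⟨ +-cong (trans (*-congˡ root′) (zeroʳ _)) (sum-≈0 λ i →
             trans (*-congʳ (ρ⇝ρ′ (remainder i) (remainder-vanishes division fθ≈0 i))) (zeroˡ _)) ⟩
      0# + 0#
        ≈⟨ +-identityˡ 0# ⟩
      0# ∎)
      where
      division = pseudoDivide poly f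
      open PseudoDivision division

    -- Differentiate u f = g q + r at θ, where q and the coefficients of r vanish: this leaves u f′
    -- = g q′. As u and f′ are nonzero there, so is q′.
    minimal-separable : Infinite (λ _ → ⊤) → ∀ f → ev f (θ Vec.∷ ρ) ≈ 0# → ev (D zero f) (θ Vec.∷ ρ) ≉ 0# →
                        ev (D zero (toPoly poly)) (θ Vec.∷ ρ) ≉ 0#
    minimal-separable infinite f fθ≈0 f′θ≉0 q′θ≈0 = *-≉0 (multiplier≉0 ρ lead≉0) f′θ≉0 (begin
      ev multiplier ρ * ev (D zero f) (θ Vec.∷ ρ)
        ≈⟨ D-• multiplier f _ ⟨
      ev (D zero (multiplier • f)) (θ Vec.∷ ρ)
        ≈⟨ D-respects-≈ infinite (multiplier • f) (quotient *ₚ toPoly poly +ₚ toPoly remainder) ρ identity θ ⟩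
      ev (D zero (quotient *ₚ toPoly poly +ₚ toPoly remainder)) (θ Vec.∷ ρ)
        ≈⟨ trans (D-+ (quotient *ₚ toPoly poly) (toPoly remainder) _) (+-cong (D-* quotient (toPoly poly) _)
             (proj₂ (vanish⇒D≈0 (toPoly remainder) (θ Vec.∷ ρ)
               (toPoly-vanish remainder ρ (remainder-vanishes division fθ≈0))))) ⟩
      (ev (D zero quotient) (θ Vec.∷ ρ) * ev (toPoly poly) (θ Vec.∷ ρ)
        + ev quotient (θ Vec.∷ ρ) * ev (D zero (toPoly poly)) (θ Vec.∷ ρ)) + 0#
        ≈⟨ +-congʳ (+-cong (*-congˡ (trans (ev-toPoly poly _) root)) (*-congˡ q′θ≈0)) ⟩
      (ev (D zero quotient) (θ Vec.∷ ρ) * 0# + ev quotient (θ Vec.∷ ρ) * 0#) + 0#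
        ≈⟨ solve 2 (λ x y → (x ⊗ κ (ℤ.+ 0) ⊕ y ⊗ κ (ℤ.+ 0)) ⊕ κ (ℤ.+ 0) ⊜ κ (ℤ.+ 0)) refl _ _ ⟩
      0# ∎)
      where
      division = pseudoDivide poly f
      open PseudoDivision division
      identity : ∀ y → ev (multiplier • f) (y Vec.∷ ρ)
                       ≈ ev (quotient *ₚ toPoly poly +ₚ toPoly remainder) (y Vec.∷ ρ)
      identity y = begin
        ev (multiplier • f) (y Vec.∷ ρ)
          ≈⟨ ev-• multiplier f _ ⟩
        ev multiplier ρ * ev f (y Vec.∷ ρ)
          ≈⟨ correct y ρ ⟩
        ev quotient (y Vec.∷ ρ) * evaluate poly y ρ + evaluate remainder y ρ
          ≈⟨ +-cong (*-congˡ (ev-toPoly poly (y Vec.∷ ρ))) (ev-toPoly remainder (y Vec.∷ ρ)) ⟨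
        ev quotient (y Vec.∷ ρ) * ev (toPoly poly) (y Vec.∷ ρ) + ev (toPoly remainder) (y Vec.∷ ρ)
          ≈⟨ +-congʳ (ev-* quotient (toPoly poly) _) ⟨
        ev (quotient *ₚ toPoly poly) (y Vec.∷ ρ) + ev (toPoly remainder) (y Vec.∷ ρ)
          ≈⟨ ev-+ (quotient *ₚ toPoly poly) (toPoly remainder) _ ⟨
        ev (quotient *ₚ toPoly poly +ₚ toPoly remainder) (y Vec.∷ ρ) ∎

-- Deformation of tuples and algebraicity of finite definable sets

module Deformations (em : ∀ {a} → ExcludedMiddle a) {c ℓ} (K : Field c ℓ)
                    (τ : Topology (Field.setoid K)) (henselian : IsHenselian K τ)
                    {E : Pred (Field.Carrier K) (c ⊔ ℓ)} (isSubfield : IsSubfield K E) where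
  open FieldProperties em K
  open Classical em
  open Polynomials em K isSubfield
  open Vanishing em K isSubfield
  open MinimalPolynomials em K isSubfield
  open HenselianTopologies em K τ henselian isSubfield
  open Topology τ
  open IsHenselian henselian
  open Independence em K isSubfield using (DerivativeClosed; independent)

  private variable
    m n : ℕ

  infinite : Infinite (λ _ → ⊤)
  infinite = open⇒infinite {d = 0#} (open-all λ _ → tt) tt

  -- The coordinates z ∘ parameter can be moved freely to nearby values; the other coordinates
  -- follow them, in such a way that all the polynomial equations over E satisfied by z persist.
  record Deformation (z : Vector Carrier n) : Set (Level.suc (c ⊔ ℓ)) where
    field
      {dimension} : ℕ
      parameter   : Fin dimension → Fin n
      algebraic   : ∀ {x} → AlgebraicOver (Values z) x → AlgebraicOver (Values (z ∘ parameter)) x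
      deform      : (W : Neighbourhood z) → Σ (Neighbourhood (z ∘ parameter)) λ N →
                    ∀ t → t ∈ Box (side N) →
                    ∃ λ z′ → z′ ∈ Box (side W) × z ⇝ z′ × (∀ i → z′ (parameter i) ≈ t i)

  independent⇒deformation : ∀ {z : Vector Carrier n} → (∀ f → ev f z ≈ 0# → Zero f) → Deformation z
  independent⇒deformation z-independent = record
    { parameter = λ i → i
    ; algebraic = λ alg → alg
    ; deform    = λ W → W , λ t t∈W → t , t∈W , (λ f fz≈0 → ev-Zero f (z-independent f fz≈0) t) , λ _ → refl
    }

  punchIn-elim : ∀ i {p} (P : Fin (suc n) → Set p) → P i → (∀ j → P (punchIn i j)) → ∀ j → P j
  punchIn-elim i P Pi Pj j with i ≟ᶠ j
  ... | yes ≡.refl = Pi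
  ... | no i≢j     = ≡.subst P (punchIn-punchOut i≢j) (Pj (punchOut i≢j))

  -- Moves the variable i to the front.
  front : Fin (suc n) → Fin (suc n) → Fin (suc n)
  front i = insertAt suc i zero

  front-∘ : ∀ i y (ρ : Vector Carrier n) {p} (P : Fin (suc n) → Carrier → Set p) → P i y →
            (∀ j → P (punchIn i j) (ρ j)) → ∀ j → P j ((y Vec.∷ ρ) (front i j))
  front-∘ i y ρ P Pi Pj = punchIn-elim i (λ j → P j ((y Vec.∷ ρ) (front i j)))
    (≡.subst (λ k → P i ((y Vec.∷ ρ) k)) (≡.sym (insertAt-lookup suc i zero)) Pi)
    (λ j → ≡.subst (λ k → P (punchIn i j) ((y Vec.∷ ρ) k)) (≡.sym (insertAt-punchIn suc i zero j)) (Pj j))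

  module SeparableStep (z : Vector Carrier (suc n)) (i : Fin (suc n)) (f : Poly (suc n))
                       (fz≈0 : ev f z ≈ 0#) (f′z≉0 : ev (D i f) z ≉ 0#)
                       (δ : Deformation (z ∘ punchIn i)) where
    open Deformation δ
    θ = z i
    ρ = z ∘ punchIn i
    F = rename (front i) f

    z≈ : ∀ j → (θ Vec.∷ ρ) (front i j) ≈ z j
    z≈ = front-∘ i θ ρ (λ j y → y ≈ z j) refl (λ _ → refl)

    ev-front : ∀ g → ev (rename (front i) g) (θ Vec.∷ ρ) ≈ ev g z
    ev-front g = trans (ev-rename (θ Vec.∷ ρ) (front i) g) (ev-cong g z≈)

    Fθ≈0 : ev F (θ Vec.∷ ρ) ≈ 0#
    Fθ≈0 = trans (ev-front f) fz≈0

    F′θ≉0 : ev (D zero F) (θ Vec.∷ ρ) ≉ 0#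
    F′θ≉0 = ≉-resp (sym (trans (D-rename (θ Vec.∷ ρ) (front i) i (insertAt-lookup suc i zero)
      (λ j j≢i → punchIn-elim i (λ j → j ≢ i → ∃ λ k → front i j ≡ suc k)
        (λ i≢i → contradiction ≡.refl i≢i) (λ k _ → k , insertAt-punchIn suc i zero k) j j≢i) f)
      (ev-cong (D i f) z≈))) f′z≉0

    coefficients≉0 : ¬ (∀ k → ev (coefficient F k) ρ ≈ 0#)
    coefficients≉0 F≈0 = F′θ≉0 (proj₂ (vanish⇒D≈0 F (θ Vec.∷ ρ) (coefficient-vanish F ρ F≈0)))

    θ-algebraic : AlgebraicOver (Values ρ) θ
    θ-algebraic = length F , (λ k → ev (coefficient F k) ρ) , (λ k → coefficient F k , refl)
      , ¬∀⇒∃¬ coefficients≉0 , trans (sym (ev-coefficient F (θ Vec.∷ ρ))) Fθ≈0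

    -- `F` shows that θ is algebraic over ρ and a simple root. The equation to be solved near ρ is
    -- the minimal one, because its roots inherit every relation of z by `⇝-extend`.
    μ : MinimalPolynomial θ ρ
    μ = minimalPolynomial (length F) λ Findependent →
      coefficients≉0 (Findependent (coefficient F) (trans (sym (ev-coefficient F (θ Vec.∷ ρ))) Fθ≈0))
    open MinimalPolynomial μ using (poly; root; lead≉0)

    equation : Polynomial Carrier (suc n)
    equation = toTerm id (toPoly poly)

    equation≈ : ∀ y ρ → evalPoly K equation (y Vec.∷ ρ) ≈ evaluate poly y ρ
    equation≈ y ρ = trans (eval-toTerm (y Vec.∷ ρ) id (toPoly poly)) (ev-toPoly poly (y Vec.∷ ρ))

    ∂equation≉0 : evalPoly K (∂ zero equation) (θ Vec.∷ ρ) ≉ 0#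
    ∂equation≉0 = ≉-resp (sym (∂-toTerm (θ Vec.∷ ρ) (toPoly poly))) (minimal-separable μ infinite F Fθ≈0 F′θ≉0)

    algebraic′ : ∀ {x} → AlgebraicOver (Values z) x → AlgebraicOver (Values (ρ ∘ parameter)) x
    algebraic′ alg = algebraic (algebraic-trans θ-algebraic
      (algebraic-⊆ {R = Values z} {R′ = Values (θ Vec.∷ ρ)} (λ (g , gz≈v) → rename (front i) g , trans (ev-front g) gz≈v) alg))

    deform′ : (W : Neighbourhood z) → Σ (Neighbourhood (ρ ∘ parameter)) λ N →
              ∀ t → t ∈ Box (side N) →
              ∃ λ z′ → z′ ∈ Box (side W) × z ⇝ z′ × (∀ j → z′ (punchIn i (parameter j)) ≈ t j)
    deform′ W = solve-near (implicitFunctionTheorem equation ρ θ (trans (equation≈ θ ρ) root) ∂equation≉0)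
      where
      Goal : Set _
      Goal = Σ (Neighbourhood (ρ ∘ parameter)) λ N → ∀ t → t ∈ Box (side N) →
             ∃ λ z′ → z′ ∈ Box (side W) × z ⇝ z′ × (∀ j → z′ (punchIn i (parameter j)) ≈ t j)

      solve-near : (∃ λ U → ∃ λ V → Openᵐ U × Open V × ρ ∈ U × θ ∈ V ×
                    Σ (∀ x → x ∈ U → Carrier) (IsImplicitFunction K τ equation U V)) → Goal
      solve-near (U , V , _ , _ , ρ∈U , θ∈V , h , implicit) =
        conclude (openᵐ⇒neighbourhood (continuous (side W i) (side-open W i)) ρ∈U′)
                 (nonzero-neighbourhood (last poly) ρ lead≉0)
        where
        open IsImplicitFunction implicit
        U′ : Pred (Vector Carrier n) _
        U′ x = Σ (x ∈ U) λ x∈U → h x x∈U ∈ side W i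

        -- By the uniqueness part of the graph condition, the implicit function passes through θ, so
        -- continuity controls its values near ρ.
        hρ≈θ : θ ≈ h ρ ρ∈U
        hρ≈θ = Equivalence.to (graph ρ ρ∈U θ) (θ∈V , trans (equation≈ θ ρ) root)

        ρ∈U′ : ρ ∈ U′
        ρ∈U′ = ρ∈U , open-resp (side-open W i) hρ≈θ (centre W i)

        conclude : (Σ (Neighbourhood ρ) λ N → ∀ x → x ∈ Box (side N) → x ∈ U′) →
                   (Σ (Neighbourhood ρ) λ N → ∀ x → x ∈ Box (side N) → ev (last poly) x ≉ 0#) → Goal
        conclude (M , M⊆U′) (M′ , lead≉0′) = proj₁ δ′ , λ t t∈ → lift t (proj₂ δ′ t t∈)
          where
          W′ : Neighbourhood ρ
          W′ = record { side = side W ∘ punchIn i ; side-open = side-open W ∘ punchIn i ; centre = centre W ∘ punchIn i }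
          -- On M the solved coordinate is defined and stays in W, on M′ the leading coefficient is
          -- nonzero, and W′ keeps the other coordinates in W.
          δ′ = deform ((M ∩ᴺ M′) ∩ᴺ W′)
          lift : ∀ t → (∃ λ ρ′ → ρ′ ∈ Box (side ((M ∩ᴺ M′) ∩ᴺ W′)) × ρ ⇝ ρ′ × (∀ j → ρ′ (parameter j) ≈ t j)) →
                 ∃ λ z′ → z′ ∈ Box (side W) × z ⇝ z′ × (∀ j → z′ (punchIn i (parameter j)) ≈ t j)
          lift t (ρ′ , ρ′∈ , ρ⇝ρ′ , ρ′≈t) = z′ , z′∈W , z⇝z′ , z′≈t
            where
            ρ′∈U′ = M⊆U′ ρ′ (λ j → proj₁ (proj₁ (ρ′∈ j)))
            θ′ = h ρ′ (proj₁ ρ′∈U′)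
            z′ = (θ′ Vec.∷ ρ′) ∘ front i

            root′ : evaluate poly θ′ ρ′ ≈ 0#
            root′ = trans (sym (equation≈ θ′ ρ′)) (proj₂ (Equivalence.from (graph ρ′ (proj₁ ρ′∈U′) θ′) refl))

            z′∈W : z′ ∈ Box (side W)
            z′∈W = front-∘ i θ′ ρ′ (λ j y → y ∈ side W j) (proj₂ ρ′∈U′) (λ j → proj₂ (ρ′∈ j))

            z⇝z′ : z ⇝ z′
            z⇝z′ g gz≈0 = trans (sym (ev-rename (θ′ Vec.∷ ρ′) (front i) g))
              (⇝-extend μ ρ⇝ρ′ (lead≉0′ ρ′ λ j → proj₂ (proj₁ (ρ′∈ j))) root′
                (rename (front i) g) (trans (ev-front g) gz≈0))

            z′≈t : ∀ j → z′ (punchIn i (parameter j)) ≈ t j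
            z′≈t j = trans (reflexive (≡.cong (θ′ Vec.∷ ρ′) (insertAt-punchIn suc i zero (parameter j)))) (ρ′≈t j)

    deformation : Deformation z
    deformation = record { parameter = punchIn i ∘ parameter ; algebraic = algebraic′ ; deform = deform′ }

  deformation : ∀ {p} → HasCharacteristicExponent K p → IsSeparableOver K p E →
                ∀ {n} (z : Vector Carrier n) → Deformation z
  deformation char separable z = by-cases z (dec (∃₂ λ f i → ev f z ≈ 0# × ev (D i f) z ≉ 0#))
    where
    by-cases : ∀ {n} (z : Vector Carrier n) → Dec (∃₂ λ f i → ev f z ≈ 0# × ev (D i f) z ≉ 0#) → Deformation z
    by-cases z (no ∄) = independent⇒deformation (independent char separable
      λ f i fz≈0 → ¬¬-elim λ f′z≉0 → ∄ (f , i , fz≈0 , f′z≉0))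
    by-cases {suc n} z (yes (f , i , fz≈0 , f′z≉0)) = SeparableStep.deformation z i f fz≈0 f′z≉0
      (by-cases (z ∘ punchIn i) (dec _))

  -- Truth is compared in both directions because negation exchanges them. An equation true at z
  -- persists along specialisations, a false one stays false near z.
  Agree : ∀ {p} {P : Set p} → (P → Coefficient) → QuantifierFree P n → Vector Carrier n → Set (Level.suc (c ⊔ ℓ))
  Agree co φ z = Σ (Neighbourhood z) λ W → ∀ z′ → z′ ∈ Box (side W) → z ⇝ z′ →
    (Holds K (proj₁ ∘ co) φ z → Holds K (proj₁ ∘ co) φ z′) × (Holds K (proj₁ ∘ co) φ z′ → Holds K (proj₁ ∘ co) φ z)

  module _ {p} {P : Set p} (co : P → Coefficient) (z : Vector Carrier n) where

    agree-≈ : ∀ t u → Agree co (t :≈ u) z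
    agree-≈ t u = by-cases (dec (ev f z ≈ 0#))
      where
      f = fromTerm co t +ₚ -ₚ fromTerm co u
      f≈ : ∀ z → ev f z ≈ evalTerm K (proj₁ ∘ co) t z - evalTerm K (proj₁ ∘ co) u z
      f≈ z = trans (ev-+ (fromTerm co t) (-ₚ fromTerm co u) z)
        (+-cong (ev-fromTerm co t z) (trans (ev-neg (fromTerm co u) z) (-‿cong (ev-fromTerm co u z))))
      f≈0⇒ : ∀ z → ev f z ≈ 0# → Holds K (proj₁ ∘ co) (t :≈ u) z
      f≈0⇒ z fz≈0 = -≈0⇒≈ (trans (sym (f≈ z)) fz≈0)
      ⇒f≈0 : ∀ z → Holds K (proj₁ ∘ co) (t :≈ u) z → ev f z ≈ 0#
      ⇒f≈0 z t≈u = trans (f≈ z) (trans (+-congʳ t≈u) (-‿inverseʳ _))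
      nonzero : (Σ (Neighbourhood z) λ W → ∀ z′ → z′ ∈ Box (side W) → ev f z′ ≉ 0#) → ev f z ≉ 0# → Agree co (t :≈ u) z
      nonzero (W , f≉0) fz≉0 = W , λ z′ z′∈W _ →
        (λ t≈u → contradiction (⇒f≈0 z t≈u) fz≉0) , λ t≈u → contradiction (⇒f≈0 z′ t≈u) (f≉0 z′ z′∈W)
      by-cases : Dec (ev f z ≈ 0#) → Agree co (t :≈ u) z
      by-cases (yes fz≈0) = whole z , λ z′ _ z⇝z′ → (λ _ → f≈0⇒ z′ (z⇝z′ f fz≈0)) , λ _ → f≈0⇒ z fz≈0
      by-cases (no fz≉0)  = nonzero (nonzero-neighbourhood f z fz≉0) fz≉0

    agree : ∀ φ → Agree co φ z
    agree (t :≈ u) = agree-≈ t u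
    agree (:¬ φ) = negate (agree φ)
      where
      negate : Agree co φ z → Agree co (:¬ φ) z
      negate (W , p) = W , λ z′ z′∈ z⇝z′ → (_∘ proj₂ (p z′ z′∈ z⇝z′)) , (_∘ proj₁ (p z′ z′∈ z⇝z′))
    agree (φ :∧ ψ) = combine (agree φ) (agree ψ)
      where
      combine : Agree co φ z → Agree co ψ z → Agree co (φ :∧ ψ) z
      combine (V , p) (W , q) = V ∩ᴺ W , λ z′ z′∈ z⇝z′ →
          Product.map (proj₁ (p z′ (proj₁ ∘ z′∈) z⇝z′)) (proj₁ (q z′ (proj₂ ∘ z′∈) z⇝z′))
        , Product.map (proj₂ (p z′ (proj₁ ∘ z′∈) z⇝z′)) (proj₂ (q z′ (proj₂ ∘ z′∈) z⇝z′))
    agree (φ :∨ ψ) = combine (agree φ) (agree ψ)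
      where
      combine : Agree co φ z → Agree co ψ z → Agree co (φ :∨ ψ) z
      combine (V , p) (W , q) = V ∩ᴺ W , λ z′ z′∈ z⇝z′ →
          Sum.map (proj₁ (p z′ (proj₁ ∘ z′∈) z⇝z′)) (proj₁ (q z′ (proj₂ ∘ z′∈) z⇝z′))
        , Sum.map (proj₂ (p z′ (proj₁ ∘ z′∈) z⇝z′)) (proj₂ (q z′ (proj₂ ∘ z′∈) z⇝z′))

  open SetoidMembership setoid using () renaming (_∈_ to _∈ₗ_)

  isolate : ∀ x xs → ∃ λ N → Open N × x ∈ N × (∀ y → y ∈ N → y ∈ₗ xs → y ≈ x)
  isolate x []       = (λ _ → ⊤) , open-all (λ _ → tt) , tt , λ _ _ ()
  isolate x (a ∷ xs) = by-cases (dec (x ≈ a)) (isolate x xs)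
    where
    by-cases : Dec (x ≈ a) → (∃ λ N → Open N × x ∈ N × (∀ y → y ∈ N → y ∈ₗ xs → y ≈ x)) →
               ∃ λ N → Open N × x ∈ N × (∀ y → y ∈ N → y ∈ₗ a ∷ xs → y ≈ x)
    by-cases (yes x≈a) (N , N-open , x∈N , isolated) = N , N-open , x∈N
      , λ { y y∈N (here y≈a) → trans y≈a (sym x≈a) ; y y∈N (there y∈xs) → isolated y y∈N y∈xs }
    by-cases (no x≉a) (N , N-open , x∈N , isolated) = shrink (separated x≉a)
      where
      shrink : (∃ λ M → Open M × x ∈ M × (∀ y → y ∈ M → y ≉ a)) →
               ∃ λ N → Open N × x ∈ N × (∀ y → y ∈ N → y ∈ₗ a ∷ xs → y ≈ x)
      shrink (M , M-open , x∈M , M≉a) = M ∩ N , open-∩ M-open N-open , (x∈M , x∈N)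
        , λ { y (y∈M , _) (here y≈a) → contradiction y≈a (M≉a y y∈M) ; y (_ , y∈N) (there y∈xs) → isolated y y∈N y∈xs }

  extendNeighbourhood : ∀ {x} {ys : Vector Carrier n} {N} → Open N → x ∈ N → Neighbourhood (x Vec.∷ ys)
  extendNeighbourhood {N = N} N-open x∈N = record
    { side      = λ { zero → N ; (suc _) → λ _ → ⊤ }
    ; side-open = λ { zero → N-open ; (suc _) → open-all (λ _ → tt) }
    ; centre    = λ { zero → x∈N ; (suc _) → tt } }

  coordinate-algebraic : ∀ (z : Vector Carrier n) i → AlgebraicOver (Values z) (z i)
  coordinate-algebraic z i = 2 , (- z i Vec.∷ 1# Vec.∷ Vec.[])
    , (λ { zero → -ₚ variable′ i , trans (ev-neg (variable′ i) z) (-‿cong (ev-variable i z)) ; (suc zero) → 1ₚ , ev-1 z })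
    , (suc zero , 1≉0)
    , solve 1 (λ x → (⊝ x) ⊗ κ (ℤ.+ 1) ⊕ (κ (ℤ.+ 1) ⊗ (x ⊗ κ (ℤ.+ 1)) ⊕ κ (ℤ.+ 0)) ⊜ κ (ℤ.+ 0)) refl (z i)

  finite⇒algebraic : ∀ {p} → HasCharacteristicExponent K p → IsSeparableOver K p E →
    ∀ {P : Set (c ⊔ ℓ)} (co : P → Coefficient) {k} (φ : QuantifierFree P (suc k)) xs →
    (∀ x → x ∈ Defines K (proj₁ ∘ co) (:∃ φ) → x ∈ₗ xs) →
    ∀ {x} → x ∈ Defines K (proj₁ ∘ co) (:∃ φ) → AlgebraicOver E x
  finite⇒algebraic char separable co φ xs finite {x} (ys , φz) = ¬¬-elim contradictory
    where
    z = x Vec.∷ ys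
    open Deformation (deformation char separable z)
    isolated = isolate x xs
    W = proj₁ (agree co z φ) ∩ᴺ extendNeighbourhood (proj₁ (proj₂ isolated)) (proj₁ (proj₂ (proj₂ isolated)))
    N = proj₁ (deform W)
    alg = algebraic (coordinate-algebraic z zero)
    a = proj₁ (proj₂ alg)
    b = λ i → proj₁ (proj₁ (proj₂ (proj₂ alg)) i)
    b≈a : ∀ i → ev (b i) (z ∘ parameter) ≈ a i
    b≈a i = proj₂ (proj₁ (proj₂ (proj₂ alg)) i)
    Q = toPoly b

    Qx≈0 : ev Q (x Vec.∷ z ∘ parameter) ≈ 0#
    Qx≈0 = trans (ev-toPoly b _) (trans (powerSum-cong x b≈a) (proj₂ (proj₂ (proj₂ (proj₂ alg)))))

    -- Some `a i` is nonzero, so the polynomial in y with these coefficients cannot vanish on the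
    -- infinite field.
    Q≉0 : ¬ (∀ y → ev Q (y Vec.∷ z ∘ parameter) ≈ 0#)
    Q≉0 Q≈0 = proj₂ aᵢ≉0 (powerSum-vanish infinite a (λ y _ →
      trans (powerSum-cong y (sym ∘ b≈a)) (trans (sym (ev-toPoly b _)) (Q≈0 y))) (proj₁ aᵢ≉0))
      where aᵢ≉0 = proj₁ (proj₂ (proj₂ (proj₂ alg)))

    first-constant : ∀ {z′} → z′ ∈ Box (side W) → z ⇝ z′ → z′ zero ≈ x
    first-constant {z′} z′∈W z⇝z′ = proj₂ (proj₂ (proj₂ isolated)) (z′ zero) (proj₂ (z′∈W zero))
      (finite (z′ zero) (z′ ∘ suc , proj₁ (proj₂ (agree co z φ) z″ z″∈ z⇝z″) φz))
      where
      -- `Defines` speaks of a tuple of this shape, which agrees with z′ only pointwise; truth of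
      -- the formula is therefore transferred to z″ directly.
      z″ = z′ zero Vec.∷ z′ ∘ suc
      z″≈ : ∀ i → z″ i ≡ z′ i
      z″≈ zero    = ≡.refl
      z″≈ (suc i) = ≡.refl
      z″∈ : z″ ∈ Box (side (proj₁ (agree co z φ)))
      z″∈ i = ≡.subst (_∈ side (proj₁ (agree co z φ)) i) (≡.sym (z″≈ i)) (proj₁ (z′∈W i))
      z⇝z″ : z ⇝ z″
      z⇝z″ f fz≈0 = trans (ev-cong f (reflexive ∘ z″≈)) (z⇝z′ f fz≈0)

    Q-vanishes : ∀ t → t ∈ Box (side N) → ev Q (x Vec.∷ t) ≈ 0#
    Q-vanishes t t∈N = specialize (proj₂ (deform W) t t∈N)
      where
      specialize : (∃ λ z′ → z′ ∈ Box (side W) × z ⇝ z′ × (∀ i → z′ (parameter i) ≈ t i)) → ev Q (x Vec.∷ t) ≈ 0#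
      specialize (z′ , z′∈W , z⇝z′ , z′≈t) = begin
        ev Q (x Vec.∷ t)
          ≈⟨ ev-cong Q (λ { zero → first-constant z′∈W z⇝z′ ; (suc i) → z′≈t i }) ⟨
        ev Q (z′ ∘ (zero Vec.∷ parameter))
          ≈⟨ ev-rename z′ (zero Vec.∷ parameter) Q ⟨
        ev (rename (zero Vec.∷ parameter) Q) z′
          ≈⟨ z⇝z′ (rename (zero Vec.∷ parameter) Q) (trans (ev-rename z (zero Vec.∷ parameter) Q)
               (trans (ev-cong Q λ { zero → refl ; (suc i) → refl }) Qx≈0)) ⟩
        0# ∎

    r = dimension
    -- `Q` has x in front of the parameters, while `transcendental⇒Zero` expects it behind them.
    last-first : Fin (suc r) → Fin (suc r)
    last-first = fromℕ r Vec.∷ punchIn (fromℕ r)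

    ev-last-first : ∀ t y → ev (rename last-first Q) (insertAt t (fromℕ r) y) ≈ ev Q (y Vec.∷ t)
    ev-last-first t y = trans (ev-rename (insertAt t (fromℕ r) y) last-first Q) (ev-cong Q λ
      { zero    → reflexive (insertAt-lookup t (fromℕ r) y)
      ; (suc i) → reflexive (insertAt-punchIn t (fromℕ r) y i) })

    -- For transcendental x the vanishing on the box makes the renamed `Q` the zero polynomial, so
    -- `Q` vanishes at the original parameters for every y as well.
    contradictory : ¬ ¬ AlgebraicOver E x
    contradictory transcendental = Q≉0 λ y → trans (sym (ev-last-first (z ∘ parameter) y))
      (ev-Zero (rename last-first Q) (transcendental⇒Zero transcendental (neighbourhood-infinite N) (rename last-first Q)
        (λ t t∈N → trans (ev-last-first t x) (Q-vanishes t t∈N))) _)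

corollary1p3 : (∀ {a} → ExcludedMiddle a) →
    ∀ {c ℓ} (K : Field c ℓ) (τ : Topology (Field.setoid K)) →
    IsHenselian K τ →
    (p : ℕ) → HasCharacteristicExponent K p →
    (B Λ : Pred (Field.Carrier K) (c ⊔ ℓ)) →
    IsΛ K p (PrimeField⟨_⟩ K B) Λ →
    ExistentialClosure K B ⊆ RelativeAlgebraicClosure K Λ
corollary1p3 em K τ henselian p char B Λ isΛ (:∃ φ , (xs , finite) , x∈) =
  finite⇒algebraic char separable (λ (b , b∈B) → b , contains (gen (inj₂ b∈B))) φ xs
    (λ x → Equivalence.to (finite x)) x∈
  where
  open IsΛ isΛ
  open Deformations em K τ henselian isSubfield
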